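{- There is an absolute constant $C$ such that for every latin square $\mathsf{L}\subset X\times Y\times Z$ of order $n$ and every $A\subset[n]$ with $1\le|A|=m\le n/C$, \[\Lambda\bigl(|P_A1_{S_X}|,|P_A1_{S_Y}|,|P_A1_{S_Z}|\bigr)\le\Bigl(\frac{n!}{n^n}\Bigr)^3(m/n)^{9m/8}e^{O(m+n/m)},\] with an absolute implied constant.
   Context: A latin square of order $n$ is $\mathsf{L}\subset X\times Y\times Z$ with $|X|=|Y|=|Z|=n$ such that every pair in $X\times Y$, $Y\times Z$, $Z\times X$ lies in exactly one triple. $\Lambda(f,g,h)=\mathbf{E}_{(x,y,z)\in\mathsf{L}^n}f(x)g(y)h(z)$, where $\mathsf{L}^n$ is the set of $(x,y,z)\in X^n\times Y^n\times Z^n$ with $(x_i,y_i,z_i)\in\mathsf{L}$ for all $i$. Functions on $X^n$ carry the inner product $\mathbf{E}_{x\in X^n}f\bar g$; for $B\subset[n]$, $Q_B$ is the orthogonal projection onto functions depending only on $(x_i:i\in B)$ and $P_A=\sum_{B\subset A}(-1)^{|A\setminus B|}Q_B$ (similarly on $Y^n,Z^n$). $S_X\subset X^n$ is the set of bijections $[n]\to X$, similarly $S_Y,S_Z$; $|F|$ is the pointwise absolute value. -}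

module Defs where

open import Data.Nat as ℕ using (ℕ; zero; suc; _!)
open import Data.Integer using (+_)
open import Data.Rational as ℚ using (ℚ; 0ℚ; 1ℚ; _+_; _*_; -_; ∣_∣)
open import Data.Bool using (Bool; true; false; if_then_else_; _∧_; _∨_; not)
open import Data.Fin using (Fin; zero; suc)
open import Data.Fin.Properties using () renaming (_≟_ to _≟F_)
open import Data.Vec using (Vec; []; _∷_)
open import Data.List using (List; []; _∷_; map; _++_; length; concatMap; filter)
open import Data.Product using (Σ; _×_; _,_)
open import Relation.Binary.PropositionalEquality using (_≡_)
open import Relation.Nullary.Decidable using (⌊_⌋)

_^ℚ_ : ℚ → ℕ → ℚ
q ^ℚ zero  = 1ℚ
q ^ℚ suc k = q * (q ^ℚ k)

-- a / d as a rational (d = 0 gives 0; only used with d ≥ 1)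
frac : ℕ → ℕ → ℚ
frac a zero    = 0ℚ
frac a (suc k) = (+ a) ℚ./ suc k

-- ceiling division ⌈ a / d ⌉ (d = 0 gives 0; only used with d ≥ 1)
cdiv : ℕ → ℕ → ℕ
cdiv a zero    = 0
cdiv a (suc k) = (a ℕ.+ k) ℕ./ suc k

sumℚ : List ℚ → ℚ
sumℚ []       = 0ℚ
sumℚ (q ∷ qs) = q + sumℚ qs

avg : List ℚ → ℚ
avg []       = 0ℚ
avg (q ∷ qs) = sumℚ (q ∷ qs) * ((+ 1) ℚ./ suc (length qs))

allB : ∀ k → (Fin k → Bool) → Bool
allB zero    p = true
allB (suc k) p = p zero ∧ allB k (λ i → p (suc i))

anyB : ∀ k → (Fin k → Bool) → Bool
anyB zero    p = false
anyB (suc k) p = p zero ∨ anyB k (λ i → p (suc i))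

eqF : ∀ {n} → Fin n → Fin n → Bool
eqF i j = ⌊ i ≟F j ⌋

allFuns : ∀ k n → List (Fin k → Fin n)
allFuns zero    n = (λ ()) ∷ []
allFuns (suc k) n =
  concatMap (λ a → map (λ g → λ { zero → a ; (suc i) → g i }) (allFuns k n))
            (allFins n)
  where
  allFins : ∀ n → List (Fin n)
  allFins zero    = []
  allFins (suc n) = zero ∷ map suc (allFins n)

-- Latin squares of order n on X = Y = Z = Fin n, as a set of triples

Triples : ℕ → Set
Triples n = Fin n → Fin n → Fin n → Bool

ExactlyOne : ∀ {n} → (Fin n → Bool) → Set
ExactlyOne {n} R = Σ (Fin n) λ c → (R c ≡ true) × (∀ c' → R c' ≡ true → c' ≡ c)

record IsLatinSquare {n : ℕ} (L : Triples n) : Set where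
  field
    xy : ∀ x y → ExactlyOne (λ z → L x y z)
    yz : ∀ y z → ExactlyOne (λ x → L x y z)
    zx : ∀ z x → ExactlyOne (λ y → L x y z)

-- Functions on X^n, where X^n = ([n] → X) = (Fin n → Fin n)

Pt : ℕ → Set
Pt n = Fin n → Fin n

Fun : ℕ → Set
Fun n = Pt n → ℚ

Subset : ℕ → Set
Subset n = Vec Bool n

mem : ∀ {n} → Subset n → Fin n → Bool
mem (b ∷ _)  zero    = b
mem (_ ∷ bs) (suc i) = mem bs i

card : ∀ {n} → Subset n → ℕ
card []           = 0
card (true ∷ bs)  = suc (card bs)
card (false ∷ bs) = card bs

subsetsOf : ∀ {n} → Subset n → List (Subset n)
subsetsOf []           = [] ∷ []
subsetsOf (true ∷ A)   = map (true ∷_) (subsetsOf A) ++ map (false ∷_) (subsetsOf A)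
subsetsOf (false ∷ A)  = map (false ∷_) (subsetsOf A)

E : ∀ {n} → Fun n → ℚ
E {n} f = avg (map f (allFuns n n))

merge : ∀ {n} → Subset n → Pt n → Pt n → Pt n
merge B x y i = if mem B i then x i else y i

-- Q_B : orthogonal projection onto functions depending only on (x_i : i ∈ B),
-- i.e. conditional expectation given the coordinates in B (uniform measure)
Q : ∀ {n} → Subset n → Fun n → Fun n
Q B f x = E (λ y → f (merge B x y))

sign : ℕ → ℚ
sign zero          = 1ℚ
sign (suc zero)    = - 1ℚ
sign (suc (suc k)) = sign k

P : ∀ {n} → Subset n → Fun n → Fun n
P A f x = sumℚ (map (λ B → sign (card A ℕ.∸ card B) * Q B f x) (subsetsOf A))

isBij : ∀ {n} → Pt n → Bool
isBij {n} x =
  allB n (λ i → allB n (λ j → not (eqF (x i) (x j)) ∨ eqF i j)) ∧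
  allB n (λ a → anyB n (λ i → eqF (x i) a))

1S : ∀ {n} → Fun n
1S x = if isBij x then 1ℚ else 0ℚ

absF : ∀ {n} → Fun n → Fun n
absF f x = ∣ f x ∣

inLn : ∀ {n} → Triples n → Pt n → Pt n → Pt n → Bool
inLn {n} L x y z = allB n (λ i → L (x i) (y i) (z i))

Λ : ∀ {n} → Triples n → Fun n → Fun n → Fun n → ℚ
Λ {n} L f g h =
  avg (concatMap (λ x → concatMap (λ y → concatMap (λ z →
         if inLn L x y z then (f x * g y * h z) ∷ [] else [])
       (allFuns n n)) (allFuns n n)) (allFuns n n))

{-# OPTIONS --safe #-}
-- P_A 1_S is n!/n^n times an alternating sum over B ⊆ A of n^b / (n)_b restricted to those B on
-- which x is injective.  A coordinate whose value is unique in x|_A does not influence injectivity,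
-- hence acts as a finite difference in b, and s of them gain a factor e^{O(m)} (m/n)^{s/2}.  So it
-- suffices to show, with ρ ≈ n/m, that the average of ρ^{(t(x) + t(y) + t(z)) / 2} is at most
-- ρ^{3m/8} e^{O(m + n/m)}, where t counts the coordinates in A with a repeated value.
--
-- Expose the cells (x_i , y_i , z_i) in the order given by a labelling of A by nine labels, and call
-- a value old if it already occurred.  At each step one old value has probability O(1/ρ), and two
-- or three have O(1/ρ²); repeating an entire cell has probability m/n², which is as good as 1/ρ³
-- up to the factor max(1, ρ/m), and (ρ/m)^m ≤ 2^ρ.  So if w_i is the number of old values at i,
-- with three counted as two unless a cell is repeated, the average of ρ^{Σ w_i} is e^{O(m + n/m)}
-- for each labelling.  For a random labelling the expectation of w_i is at least half the
-- number of repeated values at i, minus 3/8: the case of three mates is the tight one, and the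
-- three mates are distinct since in a latin square a cell is determined by any two coordinates.
-- The 9^m labellings are then summed over.
--
-- To stay within the naturals, ρ is q^8 with q^8 m ≤ n < (q + 1)^8 m.

module Submission where

open import Defs
open import Data.Nat
open import Data.Nat.Properties
open import Data.Nat.DivMod using (m≡m%n+[m/n]*n; m%n<n; m/n*n≤m; m*n/n≡m; /-monoˡ-≤)
open import Data.Nat.Tactic.RingSolver using (solve-∀)
open import Data.Integer using (ℤ; ∣_∣; 0ℤ; -[1+_]; +≤+) renaming (+_ to pos)
import Data.Integer as ℤ
import Data.Integer.Properties as ℤ
import Data.Integer.Tactic.RingSolver as ℤ-Ring
open import Data.Rational using (ℚ; 0ℚ; toℚᵘ)
import Data.Rational
import Data.Rational as ℚ
import Data.Rational.Properties as ℚ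
open import Data.Rational.Unnormalised using (mkℚᵘ; *≡*; *≤*) renaming (_≃_ to _≃ᵘ_)
import Data.Rational.Unnormalised as ℚᵘ
import Data.Rational.Unnormalised.Properties as ℚᵘ
open import Data.Bool using (Bool; true; false; not; if_then_else_; _∧_; _∨_)
open import Data.Fin using (Fin; zero; suc; toℕ)
open import Data.Fin.Properties using (any?) renaming (_≟_ to _≟F_)
open import Data.List using (List; []; _∷_; _++_; map; length; concat; concatMap; allFin)
open import Data.List.Properties using (map-++; map-∘; map-tabulate; length-++; length-map; length-tabulate)
open import Data.List.Relation.Binary.Permutation.Propositional using (_↭_; ↭-refl; ↭-sym; ↭-trans; prep; swap; ↭⇒↭ₛ)
open import Data.List.Relation.Binary.Permutation.Propositional.Properties using (shift; ↭-length)
open import Data.List.Relation.Binary.Permutation.Setoid.Properties using (Unique-resp-↭)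
open import Data.List.Relation.Unary.All using (All; []; _∷_)
import Data.List.Relation.Unary.All as All
import Data.List.Relation.Unary.All.Properties as All
open import Data.List.Relation.Unary.AllPairs using (AllPairs; []; _∷_)
import Data.List.Relation.Unary.AllPairs as AllPairs
open import Data.List.Relation.Unary.Unique.Propositional using (Unique)
open import Data.List.Relation.Unary.Unique.Propositional.Properties using (allFin⁺)
open import Data.Vec using (Vec; []; _∷_; lookup; replicate; _[_]≔_)
import Data.Vec as Vec
open import Data.Vec.Properties using (lookup∘update; lookup∘update′)
open import Data.Product using (Σ; ∃; _×_; _,_; proj₁; proj₂)
open import Data.Unit using (tt)
open import Function using (id; _∘_)
open import Relation.Binary.PropositionalEquality hiding (J; resp)
open import Relation.Nullary using (¬_; yes; no; contradiction; Dec; _×-dec_; ¬?)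
open import Relation.Nullary.Decidable using (⌊_⌋)

-- A fixed order would not do, since the first member of a class of equal values is never old. In a
-- random order a mate is earlier about half the time, which pays for the factor ρ^(1/2) lost at
-- each repeated value: two such losses for a pair, one coincidence of probability 1/ρ. The obstacle
-- is the truncation at two. As row and column determine the symbol, a third coincidence can come
-- free with the first two. For three mates in a uniformly random order this costs 1/4 per
-- coordinate. With finitely many labels ties count as not earlier and the cost is larger, but nine
-- labels keep it below 3/8. Taking 3/8 from the 3/2 gained by the three functions leaves the
-- exponent 9/8. The good labelling depends on the point (x , y). Summing over all labellings
-- removes this dependence; it is affordable because the number of labels is bounded, so that 9^m is
-- e^{O(m)}. The inequality is stated between eighth powers, which makes the exponent 9m/8 an
-- integer. `K` raised to 8 (m + ⌈n/m⌉) stands for the eighth power of e^{O(m + n/m)}.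

private
  variable
    α γ : Set

-- Finite sums

∑ : List α → (α → ℕ) → ℕ
∑ []       f = 0
∑ (a ∷ as) f = f a + ∑ as f

∑-cong : ∀ (D : List α) {f g : α → ℕ} → (∀ a → f a ≡ g a) → ∑ D f ≡ ∑ D g
∑-cong []      f≡g = refl
∑-cong (a ∷ D) f≡g = cong₂ _+_ (f≡g a) (∑-cong D f≡g)

∑-mono : ∀ (D : List α) {f g : α → ℕ} → (∀ a → f a ≤ g a) → ∑ D f ≤ ∑ D g
∑-mono []      f≤g = z≤n
∑-mono (a ∷ D) f≤g = +-mono-≤ (f≤g a) (∑-mono D f≤g)

∑-const : ∀ (D : List α) c → ∑ D (λ _ → c) ≡ length D * c
∑-const []      c = refl
∑-const (a ∷ D) c = cong (c +_) (∑-const D c)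

∑-zero : ∀ (D : List α) → ∑ D (λ _ → 0) ≡ 0
∑-zero D = trans (∑-const D 0) (*-zeroʳ (length D))

∑-+ : ∀ (D : List α) (f g : α → ℕ) → ∑ D (λ a → f a + g a) ≡ ∑ D f + ∑ D g
∑-+ []      f g = refl
∑-+ (a ∷ D) f g = trans (cong (f a + g a +_) (∑-+ D f g)) (lemma (f a) (g a) (∑ D f) (∑ D g))
  where
  lemma : ∀ p q r s → (p + q) + (r + s) ≡ (p + r) + (q + s)
  lemma = solve-∀

∑-*ˡ : ∀ (D : List α) c (f : α → ℕ) → ∑ D (λ a → c * f a) ≡ c * ∑ D f
∑-*ˡ []      c f = sym (*-zeroʳ c)
∑-*ˡ (a ∷ D) c f = trans (cong (c * f a +_) (∑-*ˡ D c f)) (sym (*-distribˡ-+ c (f a) (∑ D f)))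

∑-*ʳ : ∀ (D : List α) c (f : α → ℕ) → ∑ D (λ a → f a * c) ≡ ∑ D f * c
∑-*ʳ D c f = trans (∑-cong D λ a → *-comm (f a) c) (trans (∑-*ˡ D c f) (*-comm c (∑ D f)))

∑-* : ∀ (D : List α) (E : List γ) (f : α → ℕ) (g : γ → ℕ) →
      ∑ D (λ a → ∑ E (λ b → f a * g b)) ≡ ∑ D f * ∑ E g
∑-* D E f g = trans (∑-cong D λ a → ∑-*ˡ E (f a) g) (∑-*ʳ D (∑ E g) f)

∑-comm : ∀ (D : List α) (E : List γ) (f : α → γ → ℕ) →
         ∑ D (λ a → ∑ E (f a)) ≡ ∑ E (λ b → ∑ D (λ a → f a b))
∑-comm []      E f = sym (∑-zero E)
∑-comm (a ∷ D) E f = trans (cong (∑ E (f a) +_) (∑-comm D E f)) (sym (∑-+ E (f a) _))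

∑-map : ∀ (h : γ → α) (D : List γ) (f : α → ℕ) → ∑ (map h D) f ≡ ∑ D (f ∘ h)
∑-map h []      f = refl
∑-map h (a ∷ D) f = cong (f (h a) +_) (∑-map h D f)

∑-++ : ∀ (D E : List α) (f : α → ℕ) → ∑ (D ++ E) f ≡ ∑ D f + ∑ E f
∑-++ []      E f = refl
∑-++ (a ∷ D) E f = trans (cong (f a +_) (∑-++ D E f)) (sym (+-assoc (f a) _ _))

∑-concatMap : ∀ (h : γ → List α) (D : List γ) (f : α → ℕ) →
              ∑ (concatMap h D) f ≡ ∑ D (λ a → ∑ (h a) f)
∑-concatMap h []      f = refl
∑-concatMap h (a ∷ D) f =
  trans (∑-++ (h a) (concatMap h D) f) (cong (∑ (h a) f +_) (∑-concatMap h D f))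

∑-allFin-suc : ∀ n (f : Fin (suc n) → ℕ) →
               ∑ (allFin (suc n)) f ≡ f zero + ∑ (allFin n) (f ∘ suc)
∑-allFin-suc n f = cong (f zero +_)
  (trans (cong (λ l → ∑ l f) (sym (map-tabulate id suc))) (∑-map suc (allFin n) f))

∑-allFin-const : ∀ n c → ∑ (allFin n) (λ _ → c) ≡ n * c
∑-allFin-const zero    c = refl
∑-allFin-const (suc n) c = trans (∑-allFin-suc n (λ _ → c)) (cong (c +_) (∑-allFin-const n c))

≤∑-allFin : ∀ {n} (f : Fin n → ℕ) i → f i ≤ ∑ (allFin n) f
≤∑-allFin {suc n} f zero    = ≤-trans (m≤m+n (f zero) _) (≤-reflexive (sym (∑-allFin-suc n f)))
≤∑-allFin {suc n} f (suc i) =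
  ≤-trans (≤-trans (≤∑-allFin (f ∘ suc) i) (m≤n+m _ (f zero))) (≤-reflexive (sym (∑-allFin-suc n f)))

ind : Bool → ℕ
ind true  = 1
ind false = 0

ind-≤1 : ∀ b → ind b ≤ 1
ind-≤1 true  = ≤-refl
ind-≤1 false = z≤n

∑-unique : ∀ {n} (R : Fin n → Bool) (h : Fin n → ℕ) c → R c ≡ true →
           (∀ c′ → R c′ ≡ true → c′ ≡ c) → ∑ (allFin n) (λ a → ind (R a) * h a) ≡ h c
∑-unique {suc n} R h zero Rc uniq = trans (∑-allFin-suc n _)
  (trans (cong₂ _+_ (trans (cong (λ b → ind b * h zero) Rc) (+-identityʳ _))
                    (trans (∑-cong (allFin n) others) (∑-zero (allFin n))))
         (+-identityʳ _))
  where
  others : ∀ a → ind (R (suc a)) * h (suc a) ≡ 0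
  others a with R (suc a) in eq
  ... | false = refl
  ... | true with () ← uniq (suc a) eq
∑-unique {suc n} R h (suc c) Rc uniq = trans (∑-allFin-suc n _)
  (cong₂ _+_ first (∑-unique (R ∘ suc) (h ∘ suc) c Rc uniq′))
  where
  first : ind (R zero) * h zero ≡ 0
  first with R zero in eq
  ... | false = refl
  ... | true with () ← uniq zero eq
  uniq′ : ∀ c′ → R (suc c′) ≡ true → c′ ≡ c
  uniq′ c′ e with refl ← uniq (suc c′) e = refl

∑-exactlyOne : ∀ {n} (R : Fin n → Bool) (R! : ExactlyOne R) (h : Fin n → ℕ) →
               ∑ (allFin n) (λ a → ind (R a) * h a) ≡ h (proj₁ R!)
∑-exactlyOne R (c , Rc , uniq) h = ∑-unique R h c Rc uniq

-- Sums over vectors and resampling of one coordinate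

vecs : List α → ∀ k → List (Vec α k)
vecs D zero    = [] ∷ []
vecs D (suc k) = concatMap (λ a → map (a ∷_) (vecs D k)) D

∑-vecs-suc : ∀ (D : List α) k (g : Vec α (suc k) → ℕ) →
             ∑ (vecs D (suc k)) g ≡ ∑ D (λ a → ∑ (vecs D k) (λ v → g (a ∷ v)))
∑-vecs-suc D k g =
  trans (∑-concatMap (λ a → map (a ∷_) (vecs D k)) D g) (∑-cong D λ a → ∑-map (a ∷_) (vecs D k) g)

length-vecs : ∀ (D : List α) k → length (vecs D k) ≡ length D ^ k
length-vecs D k = trans (sym (trans (∑-const (vecs D k) 1) (*-identityʳ _))) (go k)
  where
  go : ∀ k → ∑ (vecs D k) (λ _ → 1) ≡ length D ^ k
  go zero    = refl
  go (suc k) = trans (∑-vecs-suc D k _) (trans (∑-cong D λ _ → go k) (∑-const D _))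

-- Overwriting coordinate `i` by every element of `D` reaches each vector `length D` times. This is
-- Fubini in the form in which independence is used below, both for cells and for labels.
resample : ∀ (D : List α) {k} (g : Vec α k → ℕ) i →
           length D * ∑ (vecs D k) g ≡ ∑ (vecs D k) (λ v → ∑ D (λ a → g (v [ i ]≔ a)))
resample D {suc k} g zero = sym (begin
  ∑ (vecs D (suc k)) (λ v → ∑ D (λ a → g (v [ zero ]≔ a)))
    ≡⟨ ∑-vecs-suc D k _ ⟩
  ∑ D (λ _ → ∑ (vecs D k) (λ v → ∑ D (λ a → g (a ∷ v))))
    ≡⟨ ∑-const D _ ⟩
  length D * ∑ (vecs D k) (λ v → ∑ D (λ a → g (a ∷ v)))
    ≡⟨ cong (length D *_) (∑-comm (vecs D k) D _) ⟩
  length D * ∑ D (λ a → ∑ (vecs D k) (λ v → g (a ∷ v)))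
    ≡⟨ cong (length D *_) (sym (∑-vecs-suc D k g)) ⟩
  length D * ∑ (vecs D (suc k)) g ∎)
  where open ≡-Reasoning
resample D {suc k} g (suc i) = begin
  length D * ∑ (vecs D (suc k)) g
    ≡⟨ cong (length D *_) (∑-vecs-suc D k g) ⟩
  length D * ∑ D (λ a → ∑ (vecs D k) (λ v → g (a ∷ v)))
    ≡⟨ sym (∑-*ˡ D (length D) _) ⟩
  ∑ D (λ a → length D * ∑ (vecs D k) (λ v → g (a ∷ v)))
    ≡⟨ ∑-cong D (λ a → resample D (λ v → g (a ∷ v)) i) ⟩
  ∑ D (λ a → ∑ (vecs D k) (λ v → ∑ D (λ b → g (a ∷ v [ i ]≔ b))))
    ≡⟨ sym (∑-vecs-suc D k _) ⟩
  ∑ (vecs D (suc k)) (λ v → ∑ D (λ b → g (v [ suc i ]≔ b))) ∎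
  where open ≡-Reasoning

*-^ : ∀ a b k → (a * b) ^ k ≡ a ^ k * b ^ k
*-^ a b zero    = refl
*-^ a b (suc k) = trans (cong (a * b *_) (*-^ a b k)) (lemma a b (a ^ k) (b ^ k))
  where
  lemma : ∀ a b p q → (a * b) * (p * q) ≡ (a * p) * (b * q)
  lemma = solve-∀

-- Sums over allFuns

-- The enumeration of Fin n used by allFuns is local to a where block, so it is named here by
-- unification.  Abstracting map makes its list argument solvable in a stuck application, and
-- abstracting suc n separates the parameter of the where block from the running index.
mutual
  enum : ∀ k n → List (Fin n)
  enum k n = _

  extensions : ∀ k n → Fin n → List (Fin (suc k) → Fin n)
  extensions k n = _

  allFuns-unfold : ∀ k n → Σ (List (Fin (suc k) → Fin n)) (_≡ allFuns (suc k) n)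
  allFuns-unfold k n with map {A = Fin n} {B = List (Fin (suc k) → Fin n)}
  ... | h = concat (h (extensions k n) (enum k n)) , refl

mutual
  enumTail : ∀ k n → List (Fin n)
  enumTail k n = _

  enum-unfold : ∀ k n → Σ (List (Fin (suc n))) (_≡ enum k (suc n))
  enum-unfold k n with map {A = Fin n} {B = Fin (suc n)}
  ... | h = zero ∷ h suc (enumTail k n) , refl

mutual
  enumFrom : ∀ k w n → List (Fin n)
  enumFrom k w n = _

  enumTail-unfold : ∀ k n → Σ (List (Fin n)) (_≡ enumTail k n)
  enumTail-unfold k n with suc n
  ... | w = enumFrom k w n , refl

enumFrom≡allFin : ∀ k w n → enumFrom k w n ≡ allFin n
enumFrom≡allFin k w zero    = refl
enumFrom≡allFin k w (suc n) =
  cong (zero ∷_) (trans (cong (map suc) (enumFrom≡allFin k w n)) (map-tabulate id suc))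

-- The functions enumerated by `allFuns` are pattern lambdas, which agree with `cons a f` or
-- `lookup v` only pointwise. Summands therefore have to respect pointwise equality.
Extensional : ∀ {k n} {R : Set} → ((Fin k → Fin n) → R) → Set
Extensional g = ∀ f f′ → (∀ i → f i ≡ f′ i) → g f ≡ g f′

cons : ∀ {k n} → Fin n → (Fin k → Fin n) → Fin (suc k) → Fin n
cons a f zero    = a
cons a f (suc i) = f i

∑-allFuns-suc : ∀ k n (g : (Fin (suc k) → Fin n) → ℕ) → Extensional g →
                ∑ (allFuns (suc k) n) g ≡ ∑ (allFin n) (λ a → ∑ (allFuns k n) (λ f → g (cons a f)))
∑-allFuns-suc k n g ext = begin
  ∑ (concatMap (extensions k n) (enum k n)) g
    ≡⟨ ∑-concatMap (extensions k n) (enum k n) g ⟩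
  ∑ (enum k n) (λ a → ∑ (extensions k n a) g)
    ≡⟨ ∑-cong (enum k n) (λ a → trans (∑-map _ (allFuns k n) g)
         (∑-cong (allFuns k n) (λ f → ext _ _ λ { zero → refl ; (suc i) → refl }))) ⟩
  ∑ (enum k n) (λ a → ∑ (allFuns k n) (λ f → g (cons a f)))
    ≡⟨ cong (λ l → ∑ l (λ a → ∑ (allFuns k n) (λ f → g (cons a f)))) (enumFrom≡allFin k n n) ⟩
  ∑ (allFin n) (λ a → ∑ (allFuns k n) (λ f → g (cons a f))) ∎
  where open ≡-Reasoning

∑-allFuns : ∀ k n (g : (Fin k → Fin n) → ℕ) → Extensional g →
            ∑ (allFuns k n) g ≡ ∑ (vecs (allFin n) k) (g ∘ lookup)
∑-allFuns zero    n g ext = cong (_+ 0) (ext _ _ λ ())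
∑-allFuns (suc k) n g ext = begin
  ∑ (allFuns (suc k) n) g
    ≡⟨ ∑-allFuns-suc k n g ext ⟩
  ∑ (allFin n) (λ a → ∑ (allFuns k n) (λ f → g (cons a f)))
    ≡⟨ ∑-cong (allFin n) (λ a → trans
         (∑-allFuns k n (g ∘ cons a) λ f f′ f≗f′ → ext _ _ λ { zero → refl ; (suc i) → f≗f′ i })
         (∑-cong (vecs (allFin n) k) λ v → ext _ _ λ { zero → refl ; (suc i) → refl })) ⟩
  ∑ (allFin n) (λ a → ∑ (vecs (allFin n) k) (λ v → g (lookup (a ∷ v))))
    ≡⟨ sym (∑-vecs-suc (allFin n) k _) ⟩
  ∑ (vecs (allFin n) (suc k)) (g ∘ lookup) ∎
  where open ≡-Reasoning

length-allFin : ∀ n → length (allFin n) ≡ n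
length-allFin n = length-tabulate {n = n} id

length-vecs-allFin : ∀ n k → length (vecs (allFin n) k) ≡ n ^ k
length-vecs-allFin n k = trans (length-vecs (allFin n) k) (cong (_^ k) (length-allFin n))

length≡∑1 : ∀ {X : Set} (D : List X) → length D ≡ ∑ D (λ _ → 1)
length≡∑1 D = sym (trans (∑-const D 1) (*-identityʳ _))

length-allFuns : ∀ k n → length (allFuns k n) ≡ n ^ k
length-allFuns k n = trans (length≡∑1 (allFuns k n))
  (trans (∑-allFuns k n (λ _ → 1) (λ _ _ _ → refl))
         (trans (sym (length≡∑1 (vecs (allFin n) k))) (length-vecs-allFin n k)))

-- Alternating sums and finite differences

Δ : (ℕ → ℤ) → ℕ → ℤ
Δ v b = v (suc b) ℤ.- v b

Δ^ : ℕ → (ℕ → ℤ) → ℕ → ℤ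
Δ^ zero    v = v
Δ^ (suc s) v = Δ (Δ^ s v)

Δ^-Δ : ∀ s v b → Δ^ s (Δ v) b ≡ Δ^ (suc s) v b
Δ^-Δ zero    v b = refl
Δ^-Δ (suc s) v b = cong₂ ℤ._-_ (Δ^-Δ s v (suc b)) (Δ^-Δ s v b)

Δ^-suc : ∀ s v b → Δ^ s (v ∘ suc) b ≡ Δ^ s v (suc b)
Δ^-suc zero    v b = refl
Δ^-suc (suc s) v b = cong₂ ℤ._-_ (Δ^-suc s v (suc b)) (Δ^-suc s v b)

-- In closed form, the sum of (-1)^(m - card B) `v (card B)` over the B satisfying `p`. The
-- recursion keeps the sign in the subtraction and the size in `v ∘ suc`, so that a coordinate on
-- which `p` does not depend produces `Δ v` at once.
alt : ∀ {m} → (Subset m → Bool) → (ℕ → ℤ) → ℤ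
alt {zero}  p v = if p [] then v 0 else 0ℤ
alt {suc m} p v = alt (p ∘ (true ∷_)) (v ∘ suc) ℤ.- alt (p ∘ (false ∷_)) v

alt-cong : ∀ {m} {p p′ : Subset m → Bool} → (∀ B → p B ≡ p′ B) → ∀ v → alt p v ≡ alt p′ v
alt-cong {zero}  p≗p′ v = cong (if_then v 0 else 0ℤ) (p≗p′ [])
alt-cong {suc m} p≗p′ v =
  cong₂ ℤ._-_ (alt-cong (p≗p′ ∘ (true ∷_)) (v ∘ suc)) (alt-cong (p≗p′ ∘ (false ∷_)) v)

alt-sub : ∀ {m} (p : Subset m → Bool) v w →
          alt p v ℤ.- alt p w ≡ alt p (λ b → v b ℤ.- w b)
alt-sub {zero}  p v w with p []
... | true  = refl
... | false = refl
alt-sub {suc m} p v w = trans (lemma (alt p₁ (v ∘ suc)) (alt p₀ v) (alt p₁ (w ∘ suc)) (alt p₀ w))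
  (cong₂ ℤ._-_ (alt-sub p₁ (v ∘ suc) (w ∘ suc)) (alt-sub p₀ v w))
  where
  p₁ = p ∘ (true ∷_)
  p₀ = p ∘ (false ∷_)
  lemma : ∀ a b c d → (a ℤ.- b) ℤ.- (c ℤ.- d) ≡ (a ℤ.- c) ℤ.- (b ℤ.- d)
  lemma = ℤ-Ring.solve-∀

Ignores : ∀ {m} → (Fin m → Bool) → (Subset m → Bool) → Set
Ignores T p = ∀ B B′ → (∀ i → T i ≡ false → mem B i ≡ mem B′ i) → p B ≡ p B′

ignores-tail : ∀ {m} {T : Fin (suc m) → Bool} {p} → Ignores T p →
               ∀ b → Ignores (T ∘ suc) (p ∘ (b ∷_))
ignores-tail ign b B B′ e = ign (b ∷ B) (b ∷ B′) λ { zero _ → refl ; (suc i) → e i }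

#_ : ∀ {m} → (Fin m → Bool) → ℕ
#_ {m} T = ∑ (allFin m) (ind ∘ T)

-- Each ignored coordinate turns the alternating sum of v into that of Δ v.
alt-bound : ∀ {m} (T : Fin m → Bool) (p : Subset m → Bool) → Ignores T p →
            ∀ v c β → (∀ b → b + # T ≤ m → ∣ Δ^ (# T) v b ∣ * c ≤ β) →
            ∣ alt p v ∣ * c ≤ 2 ^ m * β
alt-bound {zero}  T p ign v c β h with p []
... | true  = ≤-trans (h 0 z≤n) (≤-reflexive (sym (*-identityˡ β)))
... | false = z≤n
alt-bound {suc m} T p ign v c β h = split (T zero) refl
  where
  open ≤-Reasoning
  p₁ = p ∘ (true ∷_)
  p₀ = p ∘ (false ∷_)

  #T : ∀ {t} → T zero ≡ t → # T ≡ ind t + # (T ∘ suc)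
  #T T₀ = trans (∑-allFin-suc m _) (cong (λ b → ind b + # (T ∘ suc)) T₀)

  h′ : ∀ {t} → T zero ≡ t → ∀ b → b + (ind t + # (T ∘ suc)) ≤ suc m →
       ∣ Δ^ (ind t + # (T ∘ suc)) v b ∣ * c ≤ β
  h′ T₀ b = subst (λ s → b + s ≤ suc m → ∣ Δ^ s v b ∣ * c ≤ β) (#T T₀) (h b)

  lemma : ∀ x y → x * y + x * y ≡ (2 * x) * y
  lemma = solve-∀

  p₁≗p₀ : T zero ≡ true → ∀ B → p₁ B ≡ p₀ B
  p₁≗p₀ T₀ B = ign _ _ λ { zero e → contradiction (trans (sym T₀) e) λ () ; (suc i) _ → refl }

  split : ∀ t → T zero ≡ t → ∣ alt p₁ (v ∘ suc) ℤ.- alt p₀ v ∣ * c ≤ 2 ^ suc m * β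
  split true T₀ = begin
    ∣ alt p₁ (v ∘ suc) ℤ.- alt p₀ v ∣ * c
      ≡⟨ cong (λ i → ∣ i ∣ * c) (trans (cong (ℤ._- alt p₀ v) (alt-cong (p₁≗p₀ T₀) (v ∘ suc)))
                                       (alt-sub p₀ (v ∘ suc) v)) ⟩
    ∣ alt p₀ (Δ v) ∣ * c
      ≤⟨ alt-bound (T ∘ suc) p₀ (ignores-tail ign false) (Δ v) c β
           (λ b b≤ → ≤-trans (≤-reflexive (cong (λ i → ∣ i ∣ * c) (Δ^-Δ (# (T ∘ suc)) v b)))
                    (h′ T₀ b (≤-trans (≤-reflexive (+-suc b _)) (s≤s b≤)))) ⟩
    2 ^ m * β
      ≤⟨ *-monoˡ-≤ β (m≤m+n (2 ^ m) _) ⟩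
    2 ^ suc m * β ∎
  -- A coordinate that is not ignored is paid for by the triangle inequality, which is the origin of
  -- the factor 2 ^ m.
  split false T₀ = begin
    ∣ alt p₁ (v ∘ suc) ℤ.- alt p₀ v ∣ * c
      ≤⟨ *-monoˡ-≤ c (ℤ.∣i-j∣≤∣i∣+∣j∣ (alt p₁ (v ∘ suc)) (alt p₀ v)) ⟩
    (∣ alt p₁ (v ∘ suc) ∣ + ∣ alt p₀ v ∣) * c
      ≡⟨ *-distribʳ-+ c ∣ alt p₁ (v ∘ suc) ∣ ∣ alt p₀ v ∣ ⟩
    ∣ alt p₁ (v ∘ suc) ∣ * c + ∣ alt p₀ v ∣ * c
      ≤⟨ +-mono-≤
           (alt-bound (T ∘ suc) p₁ (ignores-tail ign true) (v ∘ suc) c β λ b b≤ →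
             ≤-trans (≤-reflexive (cong (λ i → ∣ i ∣ * c) (Δ^-suc (# (T ∘ suc)) v b)))
                     (h′ T₀ (suc b) (s≤s b≤)))
           (alt-bound (T ∘ suc) p₀ (ignores-tail ign false) v c β λ b b≤ → h′ T₀ b (m≤n⇒m≤1+n b≤)) ⟩
    2 ^ m * β + 2 ^ m * β
      ≡⟨ lemma (2 ^ m) β ⟩
    2 ^ suc m * β ∎

-- (n ∸ b)! n ^ b is the number of y such that completing an injective x on b coordinates by y
-- gives a bijection.
V : ℕ → ℕ → ℕ
V n b = (n ∸ b) ! * n ^ b

-- `V n b` is n! n^b / (n)_b with (n)_b the falling factorial, so consecutive values have ratio n /
-- (n - b).
V-step : ∀ n b → suc b ≤ n → n * V n b ≡ (n ∸ b) * V n (suc b)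
V-step n b b<n = trans (cong (λ k → n * (k ! * n ^ b)) eq)
  (trans (lemma n (n ∸ suc b) ((n ∸ suc b) !) (n ^ b)) (cong (λ k → k * V n (suc b)) (sym eq)))
  where
  eq : n ∸ b ≡ suc (n ∸ suc b)
  eq = +-∸-assoc 1 {n} {suc b} b<n
  lemma : ∀ n k f p → n * ((f + k * f) * p) ≡ suc k * (f * (n * p))
  lemma = solve-∀

halved-< : ∀ {n} b → 2 * b ≤ n → 1 ≤ n → b < n
halved-< zero    _    1≤n = 1≤n
halved-< (suc b) 2b≤n _   =
  ≤-trans (s≤s (m≤m+n (suc b) b)) (≤-trans (≤-reflexive (lemma b)) 2b≤n)
  where
  lemma : ∀ b → suc (suc b + b) ≡ 2 * suc b
  lemma = solve-∀

-- Up to b = n/2 the ratio n / (n - b) is at most 2. This is why a set of at most n/2 coordinates is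
-- small enough.
V-double : ∀ n b → 2 * b ≤ n → 1 ≤ n → V n (suc b) ≤ 2 * V n b
V-double n b 2b≤n 1≤n = *-cancelˡ-≤ n {{>-nonZero 1≤n}} (begin
  n * V n (suc b)
    ≤⟨ *-monoˡ-≤ (V n (suc b)) n≤ ⟩
  (2 * (n ∸ b)) * V n (suc b)
    ≡⟨ *-assoc 2 (n ∸ b) _ ⟩
  2 * ((n ∸ b) * V n (suc b))
    ≡⟨ cong (2 *_) (sym (V-step n b b<n)) ⟩
  2 * (n * V n b)
    ≡⟨ lemma n (V n b) ⟩
  n * (2 * V n b) ∎)
  where
  open ≤-Reasoning
  lemma : ∀ n v → 2 * (n * v) ≡ n * (2 * v)
  lemma = solve-∀
  b<n : b < n
  b<n = halved-< b 2b≤n 1≤n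
  n≤ : n ≤ 2 * (n ∸ b)
  n≤ = begin
    n                     ≡⟨ sym (m∸n+n≡m (≤-trans (n≤1+n b) b<n)) ⟩
    (n ∸ b) + b           ≤⟨ +-monoʳ-≤ (n ∸ b) b≤n∸b ⟩
    (n ∸ b) + (n ∸ b)     ≡⟨ cong (n ∸ b +_) (sym (+-identityʳ _)) ⟩
    2 * (n ∸ b)           ∎
    where
    b≤n∸b : b ≤ n ∸ b
    b≤n∸b = ≤-trans (≤-reflexive (sym (m+n∸n≡m b b)))
              (∸-monoˡ-≤ b (≤-trans (≤-reflexive (cong (b +_) (sym (+-identityʳ b)))) 2b≤n))

V≤ : ∀ n b → 2 * b ≤ n → 1 ≤ n → V n b ≤ 2 ^ b * n !
V≤ n zero    _    1≤n = ≤-reflexive (*-comm (n !) 1)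
V≤ n (suc b) 2b≤n 1≤n = begin
  V n (suc b)           ≤⟨ V-double n b 2b≤n′ 1≤n ⟩
  2 * V n b             ≤⟨ *-monoʳ-≤ 2 (V≤ n b 2b≤n′ 1≤n) ⟩
  2 * (2 ^ b * n !)     ≡⟨ sym (*-assoc 2 (2 ^ b) (n !)) ⟩
  2 ^ suc b * n !       ∎
  where
  open ≤-Reasoning
  2b≤n′ : 2 * b ≤ n
  2b≤n′ = ≤-trans (*-monoʳ-≤ 2 (n≤1+n b)) 2b≤n

module _ (n : ℕ) where

  Vℤ : ℕ → ℤ
  Vℤ b = pos (V n b)

  -- By `V-step`, subtracting n V(b) from n V(b + 1) leaves n - (n - b) = b copies of V(b + 1).
  Δ-V : ∀ b → suc b ≤ n → pos n ℤ.* Δ Vℤ b ≡ pos b ℤ.* Vℤ (suc b)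
  Δ-V b b<n = begin
    pos n ℤ.* (Vℤ (suc b) ℤ.- Vℤ b)
      ≡⟨ lemma₁ (pos n) (Vℤ (suc b)) (Vℤ b) ⟩
    pos n ℤ.* Vℤ (suc b) ℤ.- pos n ℤ.* Vℤ b
      ≡⟨ cong₂ ℤ._-_ (cong (λ k → pos k ℤ.* Vℤ (suc b)) (sym (m∸n+n≡m (≤-trans (n≤1+n b) b<n))))
                     (trans (sym (ℤ.pos-* n (V n b))) (trans (cong pos (V-step n b b<n)) (ℤ.pos-* (n ∸ b) _))) ⟩
    pos (n ∸ b + b) ℤ.* Vℤ (suc b) ℤ.- pos (n ∸ b) ℤ.* Vℤ (suc b)
      ≡⟨ lemma₂ (pos (n ∸ b)) (pos b) (Vℤ (suc b)) ⟩
    pos b ℤ.* Vℤ (suc b) ∎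
    where
    open ≡-Reasoning
    lemma₁ : ∀ a x y → a ℤ.* (x ℤ.- y) ≡ a ℤ.* x ℤ.- a ℤ.* y
    lemma₁ = ℤ-Ring.solve-∀
    lemma₂ : ∀ a b x → (a ℤ.+ b) ℤ.* x ℤ.- a ℤ.* x ≡ b ℤ.* x
    lemma₂ = ℤ-Ring.solve-∀

  -- The Leibniz rule for finite differences. `Δ-V` writes n ΔV as the product of the linear
  -- function b and a shift of V; in the higher differences of such a product only two terms
  -- survive.
  Δ^-V : ∀ s b → suc (b + suc s) ≤ n →
         pos n ℤ.* Δ^ (2 + s) Vℤ b ≡
         pos b ℤ.* Δ^ (1 + s) Vℤ (1 + b) ℤ.+ pos (suc s) ℤ.* Δ^ s Vℤ (2 + b)
  Δ^-V zero b b<n = begin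
    pos n ℤ.* (Δ Vℤ (suc b) ℤ.- Δ Vℤ b)
      ≡⟨ lemma₁ (pos n) (Δ Vℤ (suc b)) (Δ Vℤ b) ⟩
    pos n ℤ.* Δ Vℤ (suc b) ℤ.- pos n ℤ.* Δ Vℤ b
      ≡⟨ cong₂ ℤ._-_ (Δ-V (suc b) (≤-trans (≤-reflexive (cong suc (+-comm 1 b))) b<n))
                     (Δ-V b (≤-trans (s≤s (m≤m+n b 1)) b<n)) ⟩
    pos (suc b) ℤ.* Vℤ (2 + b) ℤ.- pos b ℤ.* Vℤ (1 + b)
      ≡⟨ lemma₂ (pos b) (Vℤ (1 + b)) (Vℤ (2 + b)) ⟩
    pos b ℤ.* Δ Vℤ (1 + b) ℤ.+ pos 1 ℤ.* Vℤ (2 + b) ∎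
    where
    open ≡-Reasoning
    lemma₁ : ∀ a x y → a ℤ.* (x ℤ.- y) ≡ a ℤ.* x ℤ.- a ℤ.* y
    lemma₁ = ℤ-Ring.solve-∀
    lemma₂ : ∀ b x y → (pos 1 ℤ.+ b) ℤ.* y ℤ.- b ℤ.* x ≡ b ℤ.* (y ℤ.- x) ℤ.+ pos 1 ℤ.* y
    lemma₂ = ℤ-Ring.solve-∀
  Δ^-V (suc s) b b<n = begin
    pos n ℤ.* (Δ^ (2 + s) Vℤ (suc b) ℤ.- Δ^ (2 + s) Vℤ b)
      ≡⟨ lemma₁ (pos n) (Δ^ (2 + s) Vℤ (suc b)) (Δ^ (2 + s) Vℤ b) ⟩
    pos n ℤ.* Δ^ (2 + s) Vℤ (suc b) ℤ.- pos n ℤ.* Δ^ (2 + s) Vℤ b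
      ≡⟨ cong₂ ℤ._-_ (Δ^-V s (suc b) (≤-trans (≤-reflexive (cong suc (sym (+-suc b (suc s))))) b<n))
                     (Δ^-V s b (≤-trans (s≤s (+-monoʳ-≤ b (n≤1+n (suc s)))) b<n)) ⟩
    (pos (suc b) ℤ.* D₁ (2 + b) ℤ.+ pos (suc s) ℤ.* D₀ (3 + b)) ℤ.- (pos b ℤ.* D₁ (1 + b) ℤ.+ pos (suc s) ℤ.* D₀ (2 + b))
      ≡⟨ lemma₂ (pos b) (pos (suc s)) (D₁ (1 + b)) (D₀ (2 + b)) (D₀ (3 + b)) ⟩
    pos b ℤ.* (D₁ (2 + b) ℤ.- D₁ (1 + b)) ℤ.+ pos (2 + s) ℤ.* D₁ (2 + b) ∎
    where
    open ≡-Reasoning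
    D₁ = Δ^ (1 + s) Vℤ
    D₀ = Δ^ s Vℤ
    lemma₁ : ∀ a x y → a ℤ.* (x ℤ.- y) ≡ a ℤ.* x ℤ.- a ℤ.* y
    lemma₁ = ℤ-Ring.solve-∀
    lemma₂ : ∀ b s d x y → ((pos 1 ℤ.+ b) ℤ.* (y ℤ.- x) ℤ.+ s ℤ.* y) ℤ.- (b ℤ.* d ℤ.+ s ℤ.* x) ≡
             b ℤ.* ((y ℤ.- x) ℤ.- d) ℤ.+ (pos 1 ℤ.+ s) ℤ.* (y ℤ.- x)
    lemma₂ = ℤ-Ring.solve-∀

  module _ (m q : ℕ) (1≤m : 1 ≤ m) (2m≤n : 2 * m ≤ n) (q⁸m≤n : q ^ 8 * m ≤ n) (1≤q : 1 ≤ q) where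

    private
      1≤n : 1 ≤ n
      1≤n = ≤-trans 1≤m (≤-trans (m≤m+n m _) 2m≤n)

      m≤n : m ≤ n
      m≤n = ≤-trans (m≤m+n m _) 2m≤n

      W : ℕ
      W = 2 ^ m * n !

      q⁴m≤n : q ^ 4 * m ≤ n
      q⁴m≤n = ≤-trans (*-monoˡ-≤ m (^-monoʳ-≤ q {{>-nonZero 1≤q}} {4} {8} (s≤s (s≤s (s≤s (s≤s z≤n)))))) q⁸m≤n

    V≤W : ∀ b → b ≤ m → V n b ≤ W
    V≤W b b≤m = ≤-trans (V≤ n b (≤-trans (*-monoʳ-≤ 2 b≤m) 2m≤n) 1≤n)
                        (*-monoˡ-≤ (n !) (^-monoʳ-≤ 2 b≤m))

    -- With λ = q⁻⁴, so that m/n ≤ λ², the recursion reads Dₛ₊₁ ≤ λ² Dₛ + λ² Dₛ₋₁.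
    Δ^-V-bound : ∀ s b → b + s ≤ m → ∣ Δ^ s Vℤ b ∣ * (q ^ 4) ^ s ≤ 2 ^ s * W
    Δ^-V-bound zero b b≤m = begin
      V n b * 1   ≡⟨ *-identityʳ _ ⟩
      V n b       ≤⟨ V≤W b (≤-trans (m≤m+n b 0) b≤m) ⟩
      W           ≡⟨ sym (*-identityˡ W) ⟩
      1 * W       ∎
      where open ≤-Reasoning
    Δ^-V-bound (suc zero) b b≤m = *-cancelˡ-≤ n {{>-nonZero 1≤n}} (begin
      n * (∣ Δ Vℤ b ∣ * (r * 1))
        ≡⟨ sym (*-assoc n ∣ Δ Vℤ b ∣ (r * 1)) ⟩
      n * ∣ Δ Vℤ b ∣ * (r * 1)
        ≡⟨ cong (_* (r * 1)) (trans (sym (ℤ.abs-* (pos n) (Δ Vℤ b)))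
             (trans (cong ∣_∣ (Δ-V b (≤-trans b<m m≤n))) (ℤ.abs-* (pos b) (Vℤ (suc b))))) ⟩
      b * V n (suc b) * (r * 1)
        ≤⟨ *-monoˡ-≤ (r * 1) (*-mono-≤ (≤-trans (n≤1+n b) b<m) (V≤W (suc b) b<m)) ⟩
      m * W * (r * 1)
        ≡⟨ lemma m W r ⟩
      (r * m) * W
        ≤⟨ *-monoˡ-≤ W q⁴m≤n ⟩
      n * W
        ≤⟨ *-monoʳ-≤ n (m≤m+n W _) ⟩
      n * (2 * W) ∎)
      where
      open ≤-Reasoning
      r = q ^ 4
      b<m : suc b ≤ m
      b<m = ≤-trans (≤-reflexive (+-comm 1 b)) b≤m
      lemma : ∀ m W r → m * W * (r * 1) ≡ (r * m) * W
      lemma = solve-∀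
    Δ^-V-bound (suc (suc s)) b b≤m = *-cancelˡ-≤ n {{>-nonZero 1≤n}} (begin
      n * (∣ Δ^ (2 + s) Vℤ b ∣ * r ^ (2 + s))
        ≡⟨ sym (*-assoc n _ _) ⟩
      n * ∣ Δ^ (2 + s) Vℤ b ∣ * r ^ (2 + s)
        ≡⟨ cong (_* r ^ (2 + s)) (trans (sym (ℤ.abs-* (pos n) (Δ^ (2 + s) Vℤ b)))
             (cong ∣_∣ (Δ^-V s b (≤-trans (≤-reflexive (sym (+-suc b (suc s)))) (≤-trans b≤m m≤n))))) ⟩
      ∣ pos b ℤ.* D₁ ℤ.+ pos (suc s) ℤ.* D₀ ∣ * r ^ (2 + s)
        ≤⟨ *-monoˡ-≤ (r ^ (2 + s)) (ℤ.∣i+j∣≤∣i∣+∣j∣ (pos b ℤ.* D₁) (pos (suc s) ℤ.* D₀)) ⟩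
      (∣ pos b ℤ.* D₁ ∣ + ∣ pos (suc s) ℤ.* D₀ ∣) * r ^ (2 + s)
        ≡⟨ cong₂ (λ x y → (x + y) * r ^ (2 + s)) (ℤ.abs-* (pos b) D₁) (ℤ.abs-* (pos (suc s)) D₀) ⟩
      (b * ∣ D₁ ∣ + suc s * ∣ D₀ ∣) * r ^ (2 + s)
        ≤⟨ *-monoˡ-≤ (r ^ (2 + s)) (+-mono-≤ (*-monoˡ-≤ ∣ D₁ ∣ (≤-trans (m≤m+n b _) b≤m))
                                             (*-monoˡ-≤ ∣ D₀ ∣ s<m)) ⟩
      (m * ∣ D₁ ∣ + m * ∣ D₀ ∣) * r ^ (2 + s)
        ≡⟨ lemma₁ m ∣ D₁ ∣ ∣ D₀ ∣ r (r ^ s) ⟩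
      (r * m) * (∣ D₁ ∣ * r ^ (1 + s)) + (r * r * m) * (∣ D₀ ∣ * r ^ s)
        ≤⟨ +-mono-≤ (*-mono-≤ q⁴m≤n (Δ^-V-bound (suc s) (suc b) (≤-trans (≤-reflexive (sym (+-suc b (suc s)))) b≤m)))
                    (*-mono-≤ r²m≤n (Δ^-V-bound s (2 + b) (≤-trans (≤-reflexive (l b s)) b≤m))) ⟩
      n * (2 ^ (1 + s) * W) + n * (2 ^ s * W)
        ≤⟨ +-monoʳ-≤ (n * (2 ^ (1 + s) * W)) (*-monoʳ-≤ n (*-monoˡ-≤ W (m≤m+n (2 ^ s) _))) ⟩
      n * (2 ^ (1 + s) * W) + n * (2 ^ (1 + s) * W)
        ≡⟨ lemma₂ n (2 ^ (1 + s)) W ⟩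
      n * (2 ^ (2 + s) * W) ∎)
      where
      open ≤-Reasoning
      r = q ^ 4
      D₁ = Δ^ (1 + s) Vℤ (1 + b)
      D₀ = Δ^ s Vℤ (2 + b)
      s<m : suc s ≤ m
      s<m = ≤-trans (≤-trans (n≤1+n (suc s)) (m≤n+m (2 + s) b)) b≤m
      r²m≤n : r * r * m ≤ n
      r²m≤n = ≤-trans (≤-reflexive (cong (_* m) (sym (^-distribˡ-+-* q 4 4)))) q⁸m≤n
      l : ∀ b s → 2 + b + s ≡ b + (2 + s)
      l = solve-∀
      lemma₁ : ∀ m x y r p → (m * x + m * y) * (r * (r * p)) ≡ (r * m) * (x * (r * p)) + (r * r * m) * (y * p)
      lemma₁ = solve-∀
      lemma₂ : ∀ n p W → n * (p * W) + n * (p * W) ≡ n * ((2 * p) * W)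
      lemma₂ = solve-∀

    -- The base 8 is 2 · 2 · 2: the triangle inequality in `alt-bound`, the two-term recursion for
    -- the differences, and the growth of `V n` up to `m`.
    alt-V-bound : ∀ (T : Fin m → Bool) p → Ignores T p →
                  ∣ alt p Vℤ ∣ * (q ^ 4) ^ (# T) ≤ 8 ^ m * n !
    alt-V-bound T p ign = begin
      ∣ alt p Vℤ ∣ * (q ^ 4) ^ (# T)
        ≤⟨ alt-bound T p ign Vℤ _ (2 ^ m * W) (λ b b≤ → ≤-trans (Δ^-V-bound (# T) b b≤)
             (*-monoˡ-≤ W (^-monoʳ-≤ 2 (≤-trans (m≤n+m (# T) b) b≤)))) ⟩
      2 ^ m * (2 ^ m * (2 ^ m * n !))
        ≡⟨ lemma (2 ^ m) (n !) ⟩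
      2 ^ m * (2 ^ m * 2 ^ m) * n !
        ≡⟨ cong (_* n !) (trans (cong (2 ^ m *_) (sym (*-^ 2 2 m))) (sym (*-^ 2 4 m))) ⟩
      8 ^ m * n ! ∎
      where
      open ≤-Reasoning
      lemma : ∀ x y → x * (x * (x * y)) ≡ x * (x * x) * y
      lemma = solve-∀

-- Counting bijections extending a partial injection

⌊⌋-true : ∀ {P : Set} (d : Dec P) → P → ⌊ d ⌋ ≡ true
⌊⌋-true (yes _)  _ = refl
⌊⌋-true (no ¬p)  p = contradiction p ¬p

⌊⌋-sound : ∀ {P : Set} (d : Dec P) → ⌊ d ⌋ ≡ true → P
⌊⌋-sound (yes p) _ = p

bool-ext : ∀ {a b} → (a ≡ true → b ≡ true) → (b ≡ true → a ≡ true) → a ≡ b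
bool-ext {true}  {true}  _ _ = refl
bool-ext {true}  {false} f _ = sym (f refl)
bool-ext {false} {true}  _ g = g refl
bool-ext {false} {false} _ _ = refl

∧-sound : ∀ {a b} → a ∧ b ≡ true → a ≡ true × b ≡ true
∧-sound {true} {true} _ = refl , refl

ind-∧ : ∀ a b → ind (a ∧ b) ≡ ind a * ind b
ind-∧ true  b = sym (*-identityˡ (ind b))
ind-∧ false b = refl

ind-not : ∀ b → ind (not b) + ind b ≡ 1
ind-not true  = refl
ind-not false = refl

eqF-sound : ∀ {n} {i j : Fin n} → eqF i j ≡ true → i ≡ j
eqF-sound {i = i} {j} = ⌊⌋-sound (i ≟F j)

eqF-refl : ∀ {n} (i : Fin n) → eqF i i ≡ true
eqF-refl i = ⌊⌋-true (i ≟F i) refl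

∑-eqF : ∀ {n} c (h : Fin n → ℕ) → ∑ (allFin n) (λ a → ind (eqF a c) * h a) ≡ h c
∑-eqF c h = ∑-unique (λ a → eqF a c) h c (eqF-refl c) (λ _ → eqF-sound)

∑-eqF-1 : ∀ {n} (c : Fin n) → ∑ (allFin n) (λ a → ind (eqF a c)) ≡ 1
∑-eqF-1 {n} c = trans (∑-cong (allFin n) λ a → sym (*-identityʳ _)) (∑-eqF c (λ _ → 1))

-- Lists of distinct values

elem : ∀ {n} → Fin n → List (Fin n) → Bool
elem a []      = false
elem a (w ∷ W) = eqF a w ∨ elem a W

uniq : ∀ {n} → List (Fin n) → Bool
uniq []      = true
uniq (w ∷ W) = not (elem w W) ∧ uniq W

∉⇒All≢ : ∀ {n} (a : Fin n) W → elem a W ≡ false → All (a ≢_) W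
∉⇒All≢ a []      _ = []
∉⇒All≢ a (w ∷ W) e with a ≟F w
... | no a≢w = a≢w ∷ ∉⇒All≢ a W e

All≢⇒∉ : ∀ {n} (a : Fin n) W → All (a ≢_) W → elem a W ≡ false
All≢⇒∉ a []      []          = refl
All≢⇒∉ a (w ∷ W) (a≢w ∷ ≢W) with a ≟F w
... | yes a≡w = contradiction a≡w a≢w
... | no  _   = All≢⇒∉ a W ≢W

not-true : ∀ {b} → not b ≡ true → b ≡ false
not-true {false} _ = refl

uniq⇒Unique : ∀ {n} (W : List (Fin n)) → uniq W ≡ true → Unique W
uniq⇒Unique []      _ = []
uniq⇒Unique (w ∷ W) e =
  ∉⇒All≢ w W (not-true (proj₁ (∧-sound e))) ∷ uniq⇒Unique W (proj₂ (∧-sound {not (elem w W)} e))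

Unique⇒uniq : ∀ {n} (W : List (Fin n)) → Unique W → uniq W ≡ true
Unique⇒uniq []      []      = refl
Unique⇒uniq (w ∷ W) (p ∷ u) = cong₂ _∧_ (cong not (All≢⇒∉ w W p)) (Unique⇒uniq W u)

uniq-↭ : ∀ {n} {W W′ : List (Fin n)} → W ↭ W′ → uniq W ≡ uniq W′
uniq-↭ {n} p = bool-ext (transfer p) (transfer (↭-sym p))
  where
  transfer : ∀ {W W′} → W ↭ W′ → uniq W ≡ true → uniq W′ ≡ true
  transfer p e = Unique⇒uniq _ (Unique-resp-↭ (setoid (Fin n)) (↭⇒↭ₛ p) (uniq⇒Unique _ e))

∑-elem : ∀ {n} (W : List (Fin n)) → uniq W ≡ true → ∑ (allFin n) (λ a → ind (elem a W)) ≡ length W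
∑-elem {n} []      _ = ∑-zero (allFin n)
∑-elem {n} (w ∷ W) e = begin
  ∑ (allFin n) (λ a → ind (eqF a w ∨ elem a W))
    ≡⟨ ∑-cong (allFin n) split ⟩
  ∑ (allFin n) (λ a → ind (eqF a w) + ind (elem a W))
    ≡⟨ ∑-+ (allFin n) _ _ ⟩
  ∑ (allFin n) (λ a → ind (eqF a w)) + ∑ (allFin n) (λ a → ind (elem a W))
    ≡⟨ cong₂ _+_ (∑-eqF-1 w) (∑-elem W (proj₂ (∧-sound {not (elem w W)} e))) ⟩
  suc (length W) ∎
  where
  open ≡-Reasoning
  split : ∀ a → ind (eqF a w ∨ elem a W) ≡ ind (eqF a w) + ind (elem a W)
  split a with a ≟F w
  ... | yes refl rewrite not-true (proj₁ (∧-sound {not (elem w W)} e)) = refl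
  ... | no _     = refl

∑-∉ : ∀ {n} (W : List (Fin n)) → uniq W ≡ true →
      ∑ (allFin n) (λ a → ind (not (elem a W))) + length W ≡ n
∑-∉ {n} W e = begin
  ∑ (allFin n) (λ a → ind (not (elem a W))) + length W
    ≡⟨ cong (∑ (allFin n) (λ a → ind (not (elem a W))) +_) (sym (∑-elem W e)) ⟩
  ∑ (allFin n) (λ a → ind (not (elem a W))) + ∑ (allFin n) (λ a → ind (elem a W))
    ≡⟨ sym (∑-+ (allFin n) _ _) ⟩
  ∑ (allFin n) (λ a → ind (not (elem a W)) + ind (elem a W))
    ≡⟨ ∑-cong (allFin n) (λ a → ind-not (elem a W)) ⟩
  ∑ (allFin n) (λ _ → 1)
    ≡⟨ trans (∑-allFin-const n 1) (*-identityʳ n) ⟩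
  n ∎
  where open ≡-Reasoning

vals : ∀ {k} {X : Set} → Subset k → (Fin k → X) → List X
vals []          x = []
vals (true ∷ B)  x = x zero ∷ vals B (x ∘ suc)
vals (false ∷ B) x = vals B (x ∘ suc)

vals-cong : ∀ {k} {X : Set} (B : Subset k) {x y : Fin k → X} → (∀ i → x i ≡ y i) → vals B x ≡ vals B y
vals-cong []          x≗y = refl
vals-cong (true ∷ B)  x≗y = cong₂ _∷_ (x≗y zero) (vals-cong B (x≗y ∘ suc))
vals-cong (false ∷ B) x≗y = vals-cong B (x≗y ∘ suc)

length-vals : ∀ {k} {X : Set} (B : Subset k) (x : Fin k → X) → length (vals B x) ≡ card B
length-vals []          x = refl
length-vals (true ∷ B)  x = cong suc (length-vals B (x ∘ suc))
length-vals (false ∷ B) x = length-vals B (x ∘ suc)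

InjOn : ∀ {k} {X : Set} → Subset k → (Fin k → X) → Set
InjOn B x = ∀ i j → mem B i ≡ true → mem B j ≡ true → x i ≡ x j → i ≡ j

elem-vals : ∀ {k n} (B : Subset k) (x : Fin k → Fin n) i a →
            mem B i ≡ true → a ≡ x i → elem a (vals B x) ≡ true
elem-vals (true ∷ B)  x zero    a _ refl rewrite eqF-refl a = refl
elem-vals (true ∷ B)  x (suc i) a e eq with eqF a (x zero)
... | true  = refl
... | false = elem-vals B (x ∘ suc) i a e eq
elem-vals (false ∷ B) x (suc i) a e eq = elem-vals B (x ∘ suc) i a e eq

elem-vals⁻ : ∀ {k n} (B : Subset k) (x : Fin k → Fin n) a →
             elem a (vals B x) ≡ true → ∃ λ i → mem B i ≡ true × a ≡ x i
elem-vals⁻ (true ∷ B)  x a e with a ≟F x zero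
... | yes a≡x₀ = zero , refl , a≡x₀
... | no  _    with i , i∈B , eq ← elem-vals⁻ B (x ∘ suc) a e = suc i , i∈B , eq
elem-vals⁻ (false ∷ B) x a e with i , i∈B , eq ← elem-vals⁻ B (x ∘ suc) a e = suc i , i∈B , eq

uniq⇒InjOn : ∀ {k n} (B : Subset k) (x : Fin k → Fin n) → uniq (vals B x) ≡ true → InjOn B x
uniq⇒InjOn (b ∷ B)     x u zero    zero    _  _  _  = refl
uniq⇒InjOn (true ∷ B)  x u zero    (suc j) _  j∈ eq =
  contradiction (trans (sym (elem-vals B (x ∘ suc) j (x zero) j∈ eq)) (not-true (proj₁ (∧-sound u)))) λ ()
uniq⇒InjOn (true ∷ B)  x u (suc i) zero    i∈ _  eq =
  contradiction (trans (sym (elem-vals B (x ∘ suc) i (x zero) i∈ (sym eq))) (not-true (proj₁ (∧-sound u)))) λ ()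
uniq⇒InjOn (true ∷ B)  x u (suc i) (suc j) i∈ j∈ eq =
  cong suc (uniq⇒InjOn B (x ∘ suc) (proj₂ (∧-sound {not (elem (x zero) (vals B (x ∘ suc)))} u)) i j i∈ j∈ eq)
uniq⇒InjOn (false ∷ B) x u (suc i) (suc j) i∈ j∈ eq = cong suc (uniq⇒InjOn B (x ∘ suc) u i j i∈ j∈ eq)

injOn-tail : ∀ {k} {X : Set} b (B : Subset k) (x : Fin (suc k) → X) → InjOn (b ∷ B) x → InjOn B (x ∘ suc)
injOn-tail b B x inj i j i∈ j∈ eq with refl ← inj (suc i) (suc j) i∈ j∈ eq = refl

InjOn⇒uniq : ∀ {k n} (B : Subset k) (x : Fin k → Fin n) → InjOn B x → uniq (vals B x) ≡ true
InjOn⇒uniq []          x inj = refl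
InjOn⇒uniq (true ∷ B)  x inj with elem (x zero) (vals B (x ∘ suc)) in e
... | false = InjOn⇒uniq B (x ∘ suc) (injOn-tail true B x inj)
... | true with i , i∈ , eq ← elem-vals⁻ B (x ∘ suc) (x zero) e
           with () ← inj zero (suc i) refl i∈ eq
InjOn⇒uniq (false ∷ B) x inj = InjOn⇒uniq B (x ∘ suc) (injOn-tail false B x inj)

full : ∀ k → Subset k
full k = replicate k true

mem-full : ∀ {k} (i : Fin k) → mem (full k) i ≡ true
mem-full zero    = refl
mem-full (suc i) = mem-full i

card-full : ∀ k → card (full k) ≡ k
card-full zero    = refl
card-full (suc k) = cong suc (card-full k)

allB⁺ : ∀ k {p : Fin k → Bool} → (∀ i → p i ≡ true) → allB k p ≡ true
allB⁺ zero    h = refl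
allB⁺ (suc k) h = cong₂ _∧_ (h zero) (allB⁺ k (h ∘ suc))

allB⁻ : ∀ k {p : Fin k → Bool} → allB k p ≡ true → ∀ i → p i ≡ true
allB⁻ (suc k) {p} e zero    = proj₁ (∧-sound e)
allB⁻ (suc k) {p} e (suc i) = allB⁻ k (proj₂ (∧-sound {p zero} e)) i

anyB⁺ : ∀ k {p : Fin k → Bool} i → p i ≡ true → anyB k p ≡ true
anyB⁺ (suc k) {p} zero    e rewrite e = refl
anyB⁺ (suc k) {p} (suc i) e with p zero
... | true  = refl
... | false = anyB⁺ k i e

-- Pigeonhole by counting: n distinct values and the missed ones together number n, so no value is
-- missed.
uniq-full⇒elem : ∀ {n} (f : Fin n → Fin n) → uniq (vals (full n) f) ≡ true →
                 ∀ a → elem a (vals (full n) f) ≡ true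
uniq-full⇒elem {n} f u a with elem a (vals (full n) f) in e
... | true  = refl
... | false = contradiction 1≤0 λ ()
  where
  missed : Fin n → ℕ
  missed b = ind (not (elem b (vals (full n) f)))
  none : ∑ (allFin n) missed ≡ 0
  none = +-cancelʳ-≡ n (∑ (allFin n) missed) 0
    (trans (cong (∑ (allFin n) missed +_) (sym (trans (length-vals (full n) f) (card-full n))))
           (∑-∉ (vals (full n) f) u))
  1≤0 : 1 ≤ 0
  1≤0 = ≤-trans (≤-reflexive (cong (ind ∘ not) (sym e)))
                (≤-trans (≤∑-allFin missed a) (≤-reflexive none))

-- Surjectivity follows from injectivity on a finite set. Distinctness of a list, unlike `isBij`,
-- can be carried across a permutation that separates the coordinates in B from the others.
isBij≡uniq : ∀ {n} (f : Pt n) → isBij f ≡ uniq (vals (full n) f)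
isBij≡uniq {n} f = bool-ext to from
  where
  to : isBij f ≡ true → uniq (vals (full n) f) ≡ true
  to e = InjOn⇒uniq (full n) f λ i j _ _ fi≡fj → inj i j fi≡fj
    where
    inj : ∀ i j → f i ≡ f j → i ≡ j
    inj i j fi≡fj with f i ≟F f j | i ≟F j | allB⁻ n (allB⁻ n (proj₁ (∧-sound e)) i) j
    ... | yes _ | yes i≡j | _ = i≡j
    ... | no ≢  | _       | _ = contradiction fi≡fj ≢
  from : uniq (vals (full n) f) ≡ true → isBij f ≡ true
  from u = cong₂ _∧_
    (allB⁺ n λ i → allB⁺ n λ j → inj i j)
    (allB⁺ n λ a → let i , _ , a≡fi = elem-vals⁻ (full n) f a (uniq-full⇒elem f u a)
                   in anyB⁺ n i (⌊⌋-true (f i ≟F a) (sym a≡fi)))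
    where
    inj : ∀ i j → not (eqF (f i) (f j)) ∨ eqF i j ≡ true
    inj i j with f i ≟F f j
    ... | no _ = refl
    ... | yes fi≡fj = ⌊⌋-true (i ≟F j) (uniq⇒InjOn (full n) f u i j (mem-full i) (mem-full j) fi≡fj)

∁ : ∀ {k} → Subset k → Subset k
∁ = Vec.map not

card-∁ : ∀ {k} (B : Subset k) → card (∁ B) + card B ≡ k
card-∁ []          = refl
card-∁ (true ∷ B)  = trans (+-suc (card (∁ B)) (card B)) (cong suc (card-∁ B))
card-∁ (false ∷ B) = cong suc (card-∁ B)

∁-∁ : ∀ {k} (B : Subset k) → ∁ (∁ B) ≡ B
∁-∁ []          = refl
∁-∁ (true ∷ B)  = cong (true ∷_) (∁-∁ B)
∁-∁ (false ∷ B) = cong (false ∷_) (∁-∁ B)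

vals-merge : ∀ {k} {X : Set} (B : Subset k) (x y : Fin k → X) →
             vals (full k) (λ i → if mem B i then x i else y i) ↭ vals (∁ B) y ++ vals B x
vals-merge []          x y = ↭-refl
vals-merge (true ∷ B)  x y =
  ↭-trans (prep (x zero) (vals-merge B (x ∘ suc) (y ∘ suc)))
          (↭-sym (shift (x zero) (vals (∁ B) (y ∘ suc)) (vals B (x ∘ suc))))
vals-merge (false ∷ B) x y = prep (y zero) (vals-merge B (x ∘ suc) (y ∘ suc))

-- With the values `W` taken, the coordinates in `C` are filled one at a time, each with one choice
-- fewer than the one before, while a coordinate outside `C` is free and contributes n. The
-- factorial on the left turns the falling factorial into a quotient of factorials without division.
count-extensions : ∀ {n k} (C : Subset k) (W : List (Fin n)) → card C + length W ≤ n →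
  (n ∸ (card C + length W)) ! * ∑ (vecs (allFin n) k) (λ y → ind (uniq (vals C (lookup y) ++ W))) ≡
  ind (uniq W) * ((n ∸ length W) ! * n ^ card (∁ C))
count-extensions {n} []         W _  = lemma ((n ∸ length W) !) (ind (uniq W))
  where
  lemma : ∀ x y → x * (y + 0) ≡ y * (x * 1)
  lemma = solve-∀
count-extensions {n} {suc k} (false ∷ C) W le = begin
  ((n ∸ (card C + length W)) !) * ∑ (vecs (allFin n) (suc k)) (λ y → ind (uniq (vals (false ∷ C) (lookup y) ++ W)))
    ≡⟨ cong (((n ∸ (card C + length W)) !) *_) (trans (∑-vecs-suc (allFin n) k _) (∑-allFin-const n _)) ⟩
  ((n ∸ (card C + length W)) !) * (n * ∑ (vecs (allFin n) k) (λ y → ind (uniq (vals C (lookup y) ++ W))))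
    ≡⟨ lemma₁ ((n ∸ (card C + length W)) !) n _ ⟩
  n * (((n ∸ (card C + length W)) !) * ∑ (vecs (allFin n) k) (λ y → ind (uniq (vals C (lookup y) ++ W))))
    ≡⟨ cong (n *_) (count-extensions C W le) ⟩
  n * (ind (uniq W) * ((n ∸ length W) ! * n ^ card (∁ C)))
    ≡⟨ lemma₂ n (ind (uniq W)) ((n ∸ length W) !) (n ^ card (∁ C)) ⟩
  ind (uniq W) * ((n ∸ length W) ! * n ^ card (∁ (false ∷ C))) ∎
  where
  open ≡-Reasoning
  lemma₁ : ∀ x n s → x * (n * s) ≡ n * (x * s)
  lemma₁ = solve-∀
  lemma₂ : ∀ n i x p → n * (i * (x * p)) ≡ i * (x * (n * p))
  lemma₂ = solve-∀
count-extensions {n} {suc k} (true ∷ C) W le = begin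
  (d′ !) * ∑ (vecs (allFin n) (suc k)) (λ y → ind (uniq (vals (true ∷ C) (lookup y) ++ W)))
    ≡⟨ cong ((d′ !) *_) (trans (∑-vecs-suc (allFin n) k _) (trans (∑-comm (allFin n) (vecs (allFin n) k) _)
         (∑-cong (vecs (allFin n) k) λ y → new (vals C (lookup y) ++ W) (size y)))) ⟩
  (d′ !) * ∑ (vecs (allFin n) k) (λ y → d * ind (uniq (vals C (lookup y) ++ W)))
    ≡⟨ cong ((d′ !) *_) (∑-*ˡ (vecs (allFin n) k) d _) ⟩
  (d′ !) * (d * ∑ (vecs (allFin n) k) (λ y → ind (uniq (vals C (lookup y) ++ W))))
    ≡⟨ trans (sym (*-assoc (d′ !) d _)) (cong (_* S) (trans (*-comm (d′ !) d) d!)) ⟩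
  (d !) * ∑ (vecs (allFin n) k) (λ y → ind (uniq (vals C (lookup y) ++ W)))
    ≡⟨ count-extensions C W (≤-trans (n≤1+n _) le) ⟩
  ind (uniq W) * ((n ∸ length W) ! * n ^ card (∁ C)) ∎
  where
  open ≡-Reasoning
  S  = ∑ (vecs (allFin n) k) (λ y → ind (uniq (vals C (lookup y) ++ W)))
  d  = n ∸ (card C + length W)
  d′ = n ∸ suc (card C + length W)
  d≡ : d ≡ suc d′
  d≡ = +-∸-assoc 1 {n} {suc (card C + length W)} le
  d! : d * d′ ! ≡ d !
  d! = trans (cong (_* d′ !) d≡) (cong _! (sym d≡))
  size : ∀ y → length (vals C (lookup y) ++ W) ≡ card C + length W
  size y = trans (length-++ (vals C (lookup y))) (cong (_+ length W) (length-vals C (lookup y)))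
  new : ∀ U → length U ≡ card C + length W → ∑ (allFin n) (λ a → ind (uniq (a ∷ U))) ≡ d * ind (uniq U)
  new U |U| = trans (∑-cong (allFin n) λ a → ind-∧ (not (elem a U)) (uniq U))
                    (trans (∑-*ʳ (allFin n) (ind (uniq U)) _) (go (uniq U) refl))
    where
    go : ∀ u → uniq U ≡ u → ∑ (allFin n) (λ a → ind (not (elem a U))) * ind u ≡ d * ind u
    go false _ = trans (*-zeroʳ (∑ (allFin n) _)) (sym (*-zeroʳ d))
    go true  e = cong (_* 1) (trans (sym (m+n∸n≡m _ (length U))) (cong₂ _∸_ (∑-∉ U e) |U|))

count-bijections : ∀ {n} (B : Subset n) (x : Pt n) →
  ∑ (allFuns n n) (λ y → ind (isBij (merge B x y))) ≡ ind (uniq (vals B x)) * V n (card B)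
count-bijections {n} B x = begin
  ∑ (allFuns n n) (λ y → ind (isBij (merge B x y)))
    ≡⟨ ∑-cong (allFuns n n) (λ y → cong ind (trans (isBij≡uniq (merge B x y)) (uniq-↭ (vals-merge B x y)))) ⟩
  ∑ (allFuns n n) (λ y → ind (uniq (vals (∁ B) y ++ W)))
    ≡⟨ ∑-allFuns n n _ (λ f f′ f≗f′ → cong (λ l → ind (uniq (l ++ W))) (vals-cong (∁ B) f≗f′)) ⟩
  ∑ (vecs (allFin n) n) (λ y → ind (uniq (vals (∁ B) (lookup y) ++ W)))
    ≡⟨ sym (*-identityˡ _) ⟩
  -- The completed list has all n entries, so the factorial demanded by `count-extensions` is 0! =
  -- 1.
  0 ! * ∑ (vecs (allFin n) n) (λ y → ind (uniq (vals (∁ B) (lookup y) ++ W)))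
    ≡⟨ cong (λ d → d ! * ∑ (vecs (allFin n) n) (λ y → ind (uniq (vals (∁ B) (lookup y) ++ W))))
         (sym (trans (cong (n ∸_) total) (n∸n≡0 n))) ⟩
  (n ∸ (card (∁ B) + length W)) ! * ∑ (vecs (allFin n) n) (λ y → ind (uniq (vals (∁ B) (lookup y) ++ W)))
    ≡⟨ count-extensions (∁ B) W (≤-reflexive total) ⟩
  ind (uniq W) * ((n ∸ length W) ! * n ^ card (∁ (∁ B)))
    ≡⟨ cong₂ (λ b C → ind (uniq W) * ((n ∸ b) ! * n ^ card C)) (length-vals B x) (∁-∁ B) ⟩
  ind (uniq W) * V n (card B) ∎
  where
  open ≡-Reasoning
  W = vals B x
  total : card (∁ B) + length W ≡ n
  total = trans (cong (card (∁ B) +_) (length-vals B x)) (card-∁ B)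

-- Repeated and single values

Repeat : ∀ {m} {n} → (Fin m → Fin n) → Fin m → Set
Repeat x i = ∃ λ j → j ≢ i × x j ≡ x i

repeat? : ∀ {m n} (x : Fin m → Fin n) i → Dec (Repeat x i)
repeat? x i = any? λ j → ¬? (j ≟F i) ×-dec (x j ≟F x i)

repeats : ∀ {m n} → (Fin m → Fin n) → ℕ
repeats x = # (λ i → ⌊ repeat? x i ⌋)

single : ∀ {m n} → (Fin m → Fin n) → Fin m → Bool
single x i = not ⌊ repeat? x i ⌋

single+repeats : ∀ {m n} (x : Fin m → Fin n) → # (single x) + repeats x ≡ m
single+repeats {m} x = trans (sym (∑-+ (allFin m) _ _))
  (trans (∑-cong (allFin m) λ i → ind-not ⌊ repeat? x i ⌋) (trans (∑-allFin-const m 1) (*-identityʳ m)))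

-- Both coordinates of a collision are repeated, and on repeated coordinates the two sets agree.
uniq-ignores-single : ∀ {m n} (x : Fin m → Fin n) → Ignores (single x) (λ B → uniq (vals B x))
uniq-ignores-single x B B′ agree = bool-ext (transfer B B′ agree) (transfer B′ B λ i s → sym (agree i s))
  where
  transfer : ∀ B B′ → (∀ i → single x i ≡ false → mem B i ≡ mem B′ i) →
             uniq (vals B x) ≡ true → uniq (vals B′ x) ≡ true
  transfer B B′ agree u = InjOn⇒uniq B′ x inj
    where
    repeated : ∀ i j → j ≢ i → x j ≡ x i → single x i ≡ false
    repeated i j j≢i eq = cong not (⌊⌋-true (repeat? x i) (j , j≢i , eq))
    inj : InjOn B′ x
    inj i j i∈ j∈ eq with i ≟F j
    ... | yes i≡j = i≡j
    ... | no  i≢j = uniq⇒InjOn B x u i j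
      (trans (agree i (repeated i j (i≢j ∘ sym) (sym eq))) i∈)
      (trans (agree j (repeated j i i≢j eq)) j∈) eq

-- Exposing the cells in the order of a labelling

∏ : ∀ {X : Set} → List X → (X → ℕ) → ℕ
∏ []       f = 1
∏ (a ∷ as) f = f a * ∏ as f

∏-congAll : ∀ {X : Set} {D : List X} {f g : X → ℕ} → All (λ a → f a ≡ g a) D → ∏ D f ≡ ∏ D g
∏-congAll []         = refl
∏-congAll (fg ∷ fgs) = cong₂ _*_ fg (∏-congAll fgs)

∏-mono : ∀ {X : Set} (D : List X) {f g : X → ℕ} → (∀ a → f a ≤ g a) → ∏ D f ≤ ∏ D g
∏-mono []      f≤g = ≤-refl
∏-mono (a ∷ D) f≤g = *-mono-≤ (f≤g a) (∏-mono D f≤g)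

∏-*ˡ : ∀ {X : Set} (D : List X) c (f : X → ℕ) → ∏ D (λ a → c * f a) ≡ c ^ length D * ∏ D f
∏-*ˡ []      c f = refl
∏-*ˡ (a ∷ D) c f = trans (cong (c * f a *_) (∏-*ˡ D c f)) (lemma c (f a) (c ^ length D) (∏ D f))
  where
  lemma : ∀ a b p q → (a * b) * (p * q) ≡ (a * p) * (b * q)
  lemma = solve-∀

∏-^ : ∀ {X : Set} (D : List X) r (f : X → ℕ) → ∏ D (λ a → r ^ f a) ≡ r ^ ∑ D f
∏-^ []      r f = refl
∏-^ (a ∷ D) r f = trans (cong (r ^ f a *_) (∏-^ D r f)) (sym (^-distribˡ-+-* r (f a) (∑ D f)))

∏-↭ : ∀ {X : Set} {D E : List X} (f : X → ℕ) → D ↭ E → ∏ D f ≡ ∏ E f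
∏-↭ f _↭_.refl        = refl
∏-↭ f (prep a p)      = cong (f a *_) (∏-↭ f p)
∏-↭ f (swap {xs = D} {ys = E} a b p) =
  trans (cong (λ k → f a * (f b * k)) (∏-↭ f p)) (lemma (f a) (f b) (∏ E f))
  where
  lemma : ∀ x y k → x * (y * k) ≡ y * (x * k)
  lemma = solve-∀
∏-↭ f (_↭_.trans p q) = trans (∏-↭ f p) (∏-↭ f q)

∑∑ : ∀ {X Y : Set} → List X → List Y → (X → Y → ℕ) → ℕ
∑∑ D E f = ∑ D (λ a → ∑ E (f a))

∑∑-cong : ∀ {X Y : Set} (D : List X) (E : List Y) {f g : X → Y → ℕ} →
          (∀ a b → f a b ≡ g a b) → ∑∑ D E f ≡ ∑∑ D E g
∑∑-cong D E f≗g = ∑-cong D λ a → ∑-cong E (f≗g a)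

∑∑-mono : ∀ {X Y : Set} (D : List X) (E : List Y) {f g : X → Y → ℕ} →
          (∀ a b → f a b ≤ g a b) → ∑∑ D E f ≤ ∑∑ D E g
∑∑-mono D E f≤g = ∑-mono D λ a → ∑-mono E (f≤g a)

∑∑-+ : ∀ {X Y : Set} (D : List X) (E : List Y) (f g : X → Y → ℕ) →
       ∑∑ D E (λ a b → f a b + g a b) ≡ ∑∑ D E f + ∑∑ D E g
∑∑-+ D E f g = trans (∑-cong D λ a → ∑-+ E (f a) (g a)) (∑-+ D _ _)

∑∑-*ˡ : ∀ {X Y : Set} (D : List X) (E : List Y) c (f : X → Y → ℕ) →
        ∑∑ D E (λ a b → c * f a b) ≡ c * ∑∑ D E f
∑∑-*ˡ D E c f = trans (∑-cong D λ a → ∑-*ˡ E c (f a)) (∑-*ˡ D c _)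

∑∑-*ʳ : ∀ {X Y : Set} (D : List X) (E : List Y) c (f : X → Y → ℕ) →
        ∑∑ D E (λ a b → f a b * c) ≡ ∑∑ D E f * c
∑∑-*ʳ D E c f = trans (∑-cong D λ a → ∑-*ʳ E c (f a)) (∑-*ʳ D c _)

resample₂ : ∀ {X : Set} (D : List X) {k} (g : Vec X k → Vec X k → ℕ) i →
  length D * length D * ∑∑ (vecs D k) (vecs D k) g ≡
  ∑∑ (vecs D k) (vecs D k) (λ x y → ∑∑ D D (λ a b → g (x [ i ]≔ a) (y [ i ]≔ b)))
resample₂ D {k} g i = begin
  d * d * ∑∑ Vs Vs g
    ≡⟨ *-assoc d d _ ⟩
  d * (d * ∑∑ Vs Vs g)
    ≡⟨ cong (d *_) (resample D (λ x → ∑ Vs (g x)) i) ⟩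
  d * ∑ Vs (λ x → ∑ D (λ a → ∑ Vs (g (x [ i ]≔ a))))
    ≡⟨ sym (∑∑-*ˡ Vs D d _) ⟩
  ∑ Vs (λ x → ∑ D (λ a → d * ∑ Vs (g (x [ i ]≔ a))))
    ≡⟨ ∑∑-cong Vs D (λ x a → resample D (g (x [ i ]≔ a)) i) ⟩
  ∑ Vs (λ x → ∑ D (λ a → ∑ Vs (λ y → ∑ D (λ b → g (x [ i ]≔ a) (y [ i ]≔ b)))))
    ≡⟨ ∑-cong Vs (λ x → ∑-comm D Vs _) ⟩
  ∑∑ Vs Vs (λ x y → ∑∑ D D (λ a b → g (x [ i ]≔ a) (y [ i ]≔ b))) ∎
  where
  open ≡-Reasoning
  d = length D
  Vs = vecs D k

-- Orderings given by labels

module Labelling {m k : ℕ} (ℓ : Vec (Fin k) m) where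

  label : Fin m → ℕ
  label i = toℕ (lookup ℓ i)

  -- The comparison is strict: coordinates with equal labels do not see each other, so their
  -- relative order in the exposure is immaterial.
  before : Fin m → Fin m → Bool
  before j i = label j <ᵇ label i

  <ᵇ-false : ∀ {a b} → b ≤ a → (a <ᵇ b) ≡ false
  <ᵇ-false {a} {b} b≤a with a <ᵇ b in e
  ... | false = refl
  ... | true  = contradiction (<ᵇ⇒< a b (subst Data.Bool.T (sym e) _)) (≤⇒≯ b≤a)

  before-≢ : ∀ {i j} → before j i ≡ true → j ≢ i
  before-≢ {i} e refl = contradiction (trans (sym e) (<ᵇ-false {label i} ≤-refl)) λ ()

  Descending : List (Fin m) → Set
  Descending = AllPairs (λ i j → label j ≤ label i)

  insert : Fin m → List (Fin m) → List (Fin m)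
  insert i []       = i ∷ []
  insert i (j ∷ js) with label i ≤? label j
  ... | yes _ = j ∷ insert i js
  ... | no  _ = i ∷ j ∷ js

  insert-↭ : ∀ i js → insert i js ↭ i ∷ js
  insert-↭ i []       = ↭-refl
  insert-↭ i (j ∷ js) with label i ≤? label j
  ... | yes _ = ↭-trans (prep j (insert-↭ i js)) (swap j i ↭-refl)
  ... | no  _ = ↭-refl

  insert-All : ∀ {P : Fin m → Set} {i js} → P i → All P js → All P (insert i js)
  insert-All {js = []}     p []        = p ∷ []
  insert-All {i = i} {js = j ∷ js} p (pj ∷ ps) with label i ≤? label j
  ... | yes _ = pj ∷ insert-All p ps
  ... | no  _ = p ∷ pj ∷ ps

  insert-desc : ∀ i {js} → Descending js → Descending (insert i js)
  insert-desc i {[]}     []       = [] ∷ []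
  insert-desc i {j ∷ js} (pj ∷ d) with label i ≤? label j
  ... | yes i≤j = insert-All i≤j pj ∷ insert-desc i d
  ... | no  i≰j = (<⇒≤ (≰⇒> i≰j) ∷ All.map (λ le → ≤-trans le (<⇒≤ (≰⇒> i≰j))) pj) ∷ pj ∷ d

  sort : List (Fin m) → List (Fin m)
  sort []       = []
  sort (i ∷ is) = insert i (sort is)

  sort-↭ : ∀ is → sort is ↭ is
  sort-↭ []       = ↭-refl
  sort-↭ (i ∷ is) = ↭-trans (insert-↭ i (sort is)) (prep i (sort-↭ is))

  sort-desc : ∀ is → Descending (sort is)
  sort-desc []       = []
  sort-desc (i ∷ is) = insert-desc i (sort-desc is)

  order : List (Fin m)
  order = sort (allFin m)

  order-pairs : AllPairs (λ i j → i ≢ j × label j ≤ label i) order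
  order-pairs = AllPairs.zip
    (Unique-resp-↭ (setoid (Fin m)) (↭⇒↭ₛ (↭-sym (sort-↭ (allFin m)))) (allFin⁺ m) , sort-desc (allFin m))

  length-order : length order ≡ m
  length-order = trans (↭-length (sort-↭ (allFin m))) (length-allFin m)

  earlier : Fin m → ℕ
  earlier i = ∑ (allFin m) (λ j → ind (before j i))

  earlier≤m : ∀ i → earlier i ≤ m
  earlier≤m i = ≤-trans (∑-mono (allFin m) (λ j → ind-≤1 (before j i)))
                        (≤-reflexive (trans (∑-allFin-const m 1) (*-identityʳ m)))

  -- A count with multiplicity rather than an indicator: the union bound becomes linearity, and the
  -- sums over cells can be evaluated exactly.
  old : ∀ {n} → Fin m → (Fin m → Fin n) → Fin n → ℕ
  old i x a = ∑ (allFin m) (λ j → ind (before j i) * ind (eqF a (x j)))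

  oldCell : ∀ {n} → Fin m → (x y : Fin m → Fin n) → Fin n → Fin n → ℕ
  oldCell i x y a b = ∑ (allFin m) (λ j → ind (before j i) * (ind (eqF a (x j)) * ind (eqF b (y j))))

  -- The map `h` takes each value exactly once. Besides the identity it will be a row or a column of
  -- the latin square, which treats symbols like rows and columns.
  ∑-old : ∀ {n} {D : Set} (Ds : List D) (h : D → Fin n) → (∀ c → ∑ Ds (λ a → ind (eqF (h a) c)) ≡ 1) →
          ∀ i x → ∑ Ds (λ a → old i x (h a)) ≡ earlier i
  ∑-old Ds h one i x = trans (∑-comm Ds (allFin m) _)
    (∑-cong (allFin m) λ j → trans (∑-*ˡ Ds (ind (before j i)) _)
      (trans (cong (ind (before j i) *_) (one (x j))) (*-identityʳ _)))

  ∑-oldCell : ∀ {n} i (x y : Fin m → Fin n) →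
              ∑∑ (allFin n) (allFin n) (oldCell i x y) ≡ earlier i
  ∑-oldCell {n} i x y = begin
    ∑ Fn (λ a → ∑ Fn (λ b → ∑ (allFin m) (λ j → B j * (ind (eqF a (x j)) * ind (eqF b (y j))))))
      ≡⟨ ∑-cong Fn (λ a → ∑-comm Fn (allFin m) _) ⟩
    ∑ Fn (λ a → ∑ (allFin m) (λ j → ∑ Fn (λ b → B j * (ind (eqF a (x j)) * ind (eqF b (y j))))))
      ≡⟨ ∑-comm Fn (allFin m) _ ⟩
    ∑ (allFin m) (λ j → ∑∑ Fn Fn (λ a b → B j * (ind (eqF a (x j)) * ind (eqF b (y j)))))
      ≡⟨ ∑-cong (allFin m) (λ j → trans (∑∑-*ˡ Fn Fn (B j) _) (trans
           (cong (B j *_) (trans (∑-* Fn Fn _ _) (cong₂ _*_ (∑-eqF-1 (x j)) (∑-eqF-1 (y j)))))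
           (*-identityʳ (B j)))) ⟩
    earlier i ∎
    where
    open ≡-Reasoning
    Fn = allFin n
    B : Fin m → ℕ
    B j = ind (before j i)

module Exposure {n : ℕ} (_⊙_ : Fin n → Fin n → Fin n)
  (∑-⊙ʳ : ∀ a c → ∑ (allFin n) (λ b → ind (eqF (a ⊙ b) c)) ≡ 1)
  (∑-⊙ˡ : ∀ b c → ∑ (allFin n) (λ a → ind (eqF (a ⊙ b) c)) ≡ 1)
  {m : ℕ} (ρ : ℕ) (ρm≤n : ρ * m ≤ n) {k : ℕ} (ℓ : Vec (Fin k) m) where

  open Labelling ℓ

  prod : (x y : Fin m → Fin n) → Fin m → Fin n
  prod x y j = x j ⊙ y j

  -- Each term has average O(1) over the cell (a , b), as at most m ≤ n / ρ cells are exposed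
  -- earlier; a repeated cell has probability only m / n², whence the extra factor m.
  potential : (X Y Z R : ℕ) → ℕ
  potential X Y Z R = 1 + ρ * (X + Y + Z) + ρ * ρ * (X * Y + X * Z + Y * Z) + ρ * ρ * m * R

  Φ : Fin m → (x y : Fin m → Fin n) → Fin n → Fin n → ℕ
  Φ i x y a b = potential (old i x a) (old i y b) (old i (prod x y) (a ⊙ b)) (oldCell i x y a b)

  -- Each of the four counts in `Φ i` carries the factor `ind (before j i)`. This locality allows a
  -- cell to be resampled without disturbing the factors at other coordinates whose label is not
  -- larger.
  Φ-cong : ∀ i {x x′ y y′ : Fin m → Fin n} →
           (∀ j → before j i ≡ true → x j ≡ x′ j) → (∀ j → before j i ≡ true → y j ≡ y′ j) →
           ∀ a b → Φ i x y a b ≡ Φ i x′ y′ a b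
  Φ-cong i {x} {x′} {y} {y′} xx′ yy′ a b = potential-cong
    (∑-cong (allFin m) λ j → guard j λ e → cong (λ c → ind (eqF a c)) (xx′ j e))
    (∑-cong (allFin m) λ j → guard j λ e → cong (λ c → ind (eqF b c)) (yy′ j e))
    (∑-cong (allFin m) λ j → guard j λ e → cong₂ (λ c d → ind (eqF (a ⊙ b) (c ⊙ d))) (xx′ j e) (yy′ j e))
    (∑-cong (allFin m) λ j → guard j λ e → cong₂ (λ c d → ind (eqF a c) * ind (eqF b d)) (xx′ j e) (yy′ j e))
    where
    potential-cong : ∀ {X X′ Y Y′ Z Z′ R R′} → X ≡ X′ → Y ≡ Y′ → Z ≡ Z′ → R ≡ R′ →
                     potential X Y Z R ≡ potential X′ Y′ Z′ R′
    potential-cong refl refl refl refl = refl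
    guard : ∀ j {p q : ℕ} → (before j i ≡ true → p ≡ q) → ind (before j i) * p ≡ ind (before j i) * q
    guard j h with before j i
    ... | true  = cong (_+ 0) (h refl)
    ... | false = refl

  private
    Fn = allFin n

  -- Any two of row, column and symbol vary independently over the cells, so a product of two counts
  -- averages to the product of their averages, each at most 1/ρ. The constant is 8 = 1 + 3 + 3 + 1,
  -- one summand for each monomial of `potential`.
  ∑∑-Φ : ∀ i x y → ∑∑ Fn Fn (Φ i x y) ≤ 8 * (n * n)
  ∑∑-Φ i x y = begin
    ∑∑ Fn Fn (Φ i x y)
      ≡⟨ trans (∑∑-+ Fn Fn _ _) (cong₂ _+_ (trans (∑∑-+ Fn Fn _ _) (cong₂ _+_ (trans (∑∑-+ Fn Fn _ _)
           (cong₂ _+_ sum₁ sumₗ)) sum₂)) sumᵣ) ⟩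
    n * n + ρ * (n * H + n * H + n * H) + ρ * ρ * (H * H + H * H + H * H) + ρ * ρ * m * H
      ≡⟨ lemma₁ n ρ m H ⟩
    n * n + 3 * (n * (ρ * H)) + 3 * ((ρ * H) * (ρ * H)) + (ρ * m) * (ρ * H)
      ≤⟨ +-mono-≤ (+-mono-≤ (+-monoʳ-≤ (n * n) (*-monoʳ-≤ 3 (*-monoʳ-≤ n ρH≤n)))
                            (*-monoʳ-≤ 3 (*-mono-≤ ρH≤n ρH≤n))) (*-mono-≤ ρm≤n ρH≤n) ⟩
    n * n + 3 * (n * n) + 3 * (n * n) + n * n
      ≡⟨ lemma₂ (n * n) ⟩
    8 * (n * n) ∎
    where
    open ≤-Reasoning
    H = earlier i
    ρH≤n : ρ * H ≤ n
    ρH≤n = ≤-trans (*-monoʳ-≤ ρ (earlier≤m i)) ρm≤n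
    lemma₁ : ∀ n ρ m H → n * n + ρ * (n * H + n * H + n * H) + ρ * ρ * (H * H + H * H + H * H) + ρ * ρ * m * H
                       ≡ n * n + 3 * (n * (ρ * H)) + 3 * ((ρ * H) * (ρ * H)) + (ρ * m) * (ρ * H)
    lemma₁ = solve-∀
    lemma₂ : ∀ s → s + 3 * s + 3 * s + s ≡ 8 * s
    lemma₂ = solve-∀
    X Y : Fin n → ℕ
    X a = old i x a
    Y b = old i y b
    Z R : Fin n → Fin n → ℕ
    Z a b = old i (prod x y) (a ⊙ b)
    R a b = oldCell i x y a b
    ∑X : ∑ Fn X ≡ H
    ∑X = ∑-old Fn id ∑-eqF-1 i x
    ∑Y : ∑ Fn Y ≡ H
    ∑Y = ∑-old Fn id ∑-eqF-1 i y
    ∑Zʳ : ∀ a → ∑ Fn (Z a) ≡ H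
    ∑Zʳ a = ∑-old Fn (a ⊙_) (∑-⊙ʳ a) i (prod x y)
    ∑Zˡ : ∀ b → ∑ Fn (λ a → Z a b) ≡ H
    ∑Zˡ b = ∑-old Fn (_⊙ b) (∑-⊙ˡ b) i (prod x y)
    sum₁ : ∑∑ Fn Fn (λ _ _ → 1) ≡ n * n
    sum₁ = trans (∑-allFin-const n _) (cong (n *_) (trans (∑-allFin-const n 1) (*-identityʳ n)))
    sumₗ : ∑∑ Fn Fn (λ a b → ρ * (X a + Y b + Z a b)) ≡ ρ * (n * H + n * H + n * H)
    sumₗ = trans (∑∑-*ˡ Fn Fn ρ _) (cong (ρ *_) (trans (∑∑-+ Fn Fn _ Z) (cong₂ _+_
      (trans (∑∑-+ Fn Fn _ _) (cong₂ _+_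
        (trans (∑-cong Fn λ a → ∑-allFin-const n (X a)) (trans (∑-*ˡ Fn n X) (cong (n *_) ∑X)))
        (trans (∑-allFin-const n _) (cong (n *_) ∑Y))))
      (trans (∑-cong Fn ∑Zʳ) (∑-allFin-const n H)))))
    sum₂ : ∑∑ Fn Fn (λ a b → ρ * ρ * (X a * Y b + X a * Z a b + Y b * Z a b)) ≡ ρ * ρ * (H * H + H * H + H * H)
    sum₂ = trans (∑∑-*ˡ Fn Fn (ρ * ρ) _) (cong (ρ * ρ *_) (trans (∑∑-+ Fn Fn _ _) (cong₂ _+_
      (trans (∑∑-+ Fn Fn _ _) (cong₂ _+_
        (trans (∑-* Fn Fn X Y) (cong₂ _*_ ∑X ∑Y))
        (trans (∑-cong Fn λ a → trans (∑-*ˡ Fn (X a) (Z a)) (cong (X a *_) (∑Zʳ a)))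
               (trans (∑-*ʳ Fn H X) (cong (_* H) ∑X)))))
      (trans (∑-comm Fn Fn _)
        (trans (∑-cong Fn λ b → trans (∑-*ˡ Fn (Y b) (λ a → Z a b)) (cong (Y b *_) (∑Zˡ b)))
               (trans (∑-*ʳ Fn H Y) (cong (_* H) ∑Y)))))))
    sumᵣ : ∑∑ Fn Fn (λ a b → ρ * ρ * m * R a b) ≡ ρ * ρ * m * H
    sumᵣ = trans (∑∑-*ˡ Fn Fn (ρ * ρ * m) R) (cong (ρ * ρ * m *_) (∑-oldCell i x y))

  Φ-at : Vec (Fin n) m → Vec (Fin n) m → Fin m → ℕ
  Φ-at x y i = Φ i (lookup x) (lookup y) (lookup x i) (lookup y i)

  private
    Vs = vecs Fn m

  -- The head of js has the largest label, so resampling its cell leaves the other factors alone.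
  expose : ∀ js → AllPairs (λ i j → i ≢ j × label j ≤ label i) js →
           (n * n) ^ length js * ∑∑ Vs Vs (λ x y → ∏ js (Φ-at x y)) ≤ (8 * (n * n)) ^ length js * ∑∑ Vs Vs (λ _ _ → 1)
  expose []       []       = ≤-refl
  expose (i ∷ js) (later ∷ ps) = begin
    (n * n * N) * ∑∑ Vs Vs (λ x y → Φ-at x y i * ∏ js (Φ-at x y))
      ≡⟨ lemma₁ (n * n) N _ ⟩
    N * (n * n * ∑∑ Vs Vs (λ x y → Φ-at x y i * ∏ js (Φ-at x y)))
      ≡⟨ cong (N *_) (trans (cong (λ d → d * d * ∑∑ Vs Vs (λ x y → Φ-at x y i * ∏ js (Φ-at x y))) (sym (length-allFin n)))
           (resample₂ Fn (λ x y → Φ-at x y i * ∏ js (Φ-at x y)) i)) ⟩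
    N * ∑∑ Vs Vs (λ x y → ∑∑ Fn Fn (λ a b →
      Φ-at (x [ i ]≔ a) (y [ i ]≔ b) i * ∏ js (Φ-at (x [ i ]≔ a) (y [ i ]≔ b))))
      ≡⟨ cong (N *_) (∑∑-cong Vs Vs λ x y → trans
           (∑∑-cong Fn Fn λ a b → cong₂ _*_ (head-local x y a b) (∏-congAll (All.map (tail-local x y a b) later)))
           (∑∑-*ʳ Fn Fn (∏ js (Φ-at x y)) (Φ i (lookup x) (lookup y)))) ⟩
    N * ∑∑ Vs Vs (λ x y → ∑∑ Fn Fn (Φ i (lookup x) (lookup y)) * ∏ js (Φ-at x y))
      ≤⟨ *-monoʳ-≤ N (∑∑-mono Vs Vs λ x y → *-monoˡ-≤ (∏ js (Φ-at x y)) (∑∑-Φ i (lookup x) (lookup y))) ⟩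
    N * ∑∑ Vs Vs (λ x y → 8 * (n * n) * ∏ js (Φ-at x y))
      ≡⟨ cong (N *_) (∑∑-*ˡ Vs Vs (8 * (n * n)) _) ⟩
    N * (8 * (n * n) * ∑∑ Vs Vs (λ x y → ∏ js (Φ-at x y)))
      ≡⟨ lemma₂ N (8 * (n * n)) _ ⟩
    8 * (n * n) * (N * ∑∑ Vs Vs (λ x y → ∏ js (Φ-at x y)))
      ≤⟨ *-monoʳ-≤ (8 * (n * n)) (expose js ps) ⟩
    8 * (n * n) * ((8 * (n * n)) ^ length js * ∑∑ Vs Vs (λ _ _ → 1))
      ≡⟨ sym (*-assoc (8 * (n * n)) _ _) ⟩
    (8 * (n * n)) ^ suc (length js) * ∑∑ Vs Vs (λ _ _ → 1) ∎
    where
    open ≤-Reasoning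
    N = (n * n) ^ length js
    lemma₁ : ∀ s N t → (s * N) * t ≡ N * (s * t)
    lemma₁ = solve-∀
    lemma₂ : ∀ N s t → N * (s * t) ≡ s * (N * t)
    lemma₂ = solve-∀
    head-local : ∀ x y a b → Φ-at (x [ i ]≔ a) (y [ i ]≔ b) i ≡ Φ i (lookup x) (lookup y) a b
    head-local x y a b = trans
      (cong₂ (Φ i _ _) (lookup∘update i x a) (lookup∘update i y b))
      (Φ-cong i (λ j e → lookup∘update′ (before-≢ e) x a) (λ j e → lookup∘update′ (before-≢ e) y b) a b)
    tail-local : ∀ x y a b {j} → i ≢ j × label j ≤ label i → Φ-at (x [ i ]≔ a) (y [ i ]≔ b) j ≡ Φ-at x y j
    tail-local x y a b {j} (i≢j , j≤i) = trans
      (cong₂ (Φ j _ _) (lookup∘update′ (i≢j ∘ sym) x a) (lookup∘update′ (i≢j ∘ sym) y b))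
      (Φ-cong j (λ j′ e → lookup∘update′ (not-i e) x a) (λ j′ e → lookup∘update′ (not-i e) y b) _ _)
      where
      not-i : ∀ {j′} → before j′ j ≡ true → j′ ≢ i
      not-i e refl = contradiction (trans (sym e) (<ᵇ-false {label i} {label j} j≤i)) λ ()

  expose-all : 1 ≤ n → ∑∑ Vs Vs (λ x y → ∏ (allFin m) (Φ-at x y)) ≤ 8 ^ m * (n ^ m * n ^ m)
  expose-all 1≤n = *-cancelˡ-≤ ((n * n) ^ m) {{m^n≢0 (n * n) m {{m*n≢0 n n {{>-nonZero 1≤n}} {{>-nonZero 1≤n}}}}}} (begin
    (n * n) ^ m * ∑∑ Vs Vs (λ x y → ∏ (allFin m) (Φ-at x y))
      ≡⟨ cong ((n * n) ^ m *_) (∑∑-cong Vs Vs λ x y → sym (∏-↭ (Φ-at x y) (sort-↭ (allFin m)))) ⟩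
    (n * n) ^ m * ∑∑ Vs Vs (λ x y → ∏ order (Φ-at x y))
      ≤⟨ subst (λ l → (n * n) ^ l * ∑∑ Vs Vs (λ x y → ∏ order (Φ-at x y)) ≤ (8 * (n * n)) ^ l * ∑∑ Vs Vs (λ _ _ → 1))
           length-order (expose order order-pairs) ⟩
    (8 * (n * n)) ^ m * ∑∑ Vs Vs (λ _ _ → 1)
      ≡⟨ cong₂ _*_ (*-^ 8 (n * n) m) count ⟩
    8 ^ m * (n * n) ^ m * (n ^ m * n ^ m)
      ≡⟨ lemma (8 ^ m) ((n * n) ^ m) (n ^ m * n ^ m) ⟩
    (n * n) ^ m * (8 ^ m * (n ^ m * n ^ m)) ∎)
    where
    open ≤-Reasoning
    lemma : ∀ a b c → a * b * c ≡ b * (a * c)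
    lemma = solve-∀
    count : ∑∑ Vs Vs (λ _ _ → 1) ≡ n ^ m * n ^ m
    count = trans (∑-const Vs _) (trans (cong (length Vs *_) (sym (length≡∑1 Vs)))
      (cong₂ _*_ (length-vecs-allFin n m) (length-vecs-allFin n m)))

-- Averaging over labellings

∑-allFin-pigeonhole : ∀ {n} (f : Fin n → ℕ) b → 1 ≤ n → n * b ≤ ∑ (allFin n) f → ∃ λ i → b ≤ f i
∑-allFin-pigeonhole {n} f b 1≤n h with any? (λ i → b ≤? f i)
... | yes (i , b≤fi) = i , b≤fi
... | no  none = contradiction h (<⇒≱ (strict 1≤n f λ i → ≰⇒> λ b≤ → none (i , b≤)))
  where
  strict : ∀ {n} → 1 ≤ n → (f : Fin n → ℕ) → (∀ i → f i < b) → ∑ (allFin n) f < n * b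
  strict {suc zero}    _ f lt = ≤-trans (s≤s (≤-reflexive (+-identityʳ _))) (≤-trans (lt zero) (≤-reflexive (sym (+-identityʳ b))))
  strict {suc (suc n)} _ f lt = ≤-trans (s≤s (≤-reflexive (∑-allFin-suc (suc n) f)))
    (+-mono-≤ (lt zero) (<⇒≤ (strict (s≤s z≤n) (f ∘ suc) (lt ∘ suc))))

∑-vecs-pigeonhole : ∀ {n} k (f : Vec (Fin n) k → ℕ) b → 1 ≤ n → n ^ k * b ≤ ∑ (vecs (allFin n) k) f → ∃ λ v → b ≤ f v
∑-vecs-pigeonhole zero    f b 1≤n h =
  [] , ≤-trans (≤-reflexive (sym (+-identityʳ b))) (≤-trans h (≤-reflexive (+-identityʳ _)))
∑-vecs-pigeonhole {n} (suc k) f b 1≤n h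
  with a , ha ← ∑-allFin-pigeonhole (λ a → ∑ (vecs (allFin n) k) (λ v → f (a ∷ v))) (n ^ k * b) 1≤n
                  (≤-trans (≤-reflexive (sym (*-assoc n (n ^ k) b))) (≤-trans h (≤-reflexive (∑-vecs-suc (allFin n) k f))))
  with v , hv ← ∑-vecs-pigeonhole k (λ v → f (a ∷ v)) b 1≤n ha = a ∷ v , hv

≤∑-vecs : ∀ {n k} (f : Vec (Fin n) k → ℕ) v → f v ≤ ∑ (vecs (allFin n) k) f
≤∑-vecs f []          = m≤m+n (f []) 0
≤∑-vecs {n} {suc k} f (a ∷ v) = ≤-trans (≤∑-vecs (λ v → f (a ∷ v)) v)
  (≤-trans (≤∑-allFin (λ a → ∑ (vecs (allFin n) k) (λ v → f (a ∷ v))) a) (≤-reflexive (sym (∑-vecs-suc (allFin n) k f))))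

-- With k labels and t = 1 - 1/k, the average of min(2, number of mates with a smaller label) over
-- three distinct mates is 3t/2 - t²/4; nine is the least k for which this is at least 9/8.
Labels : ∀ m → List (Vec (Fin 9) m)
Labels = vecs (allFin 9)

open Labelling using (before; before-≢; old; oldCell)

-- Once both labels are resampled, 36 of the 81 pairs are strictly increasing, a proportion of 4/9.
∑-before : ∀ {m} {i j : Fin m} → j ≢ i →
           9 * ∑ (Labels m) (λ ℓ → ind (before ℓ j i)) ≡ 4 * 9 ^ m
∑-before {m} {i} {j} j≢i = *-cancelˡ-≡ _ _ 9 (begin
  9 * (9 * ∑ (Labels m) g)
    ≡⟨ cong (9 *_) (resample (allFin 9) g j) ⟩
  9 * ∑ (Labels m) (λ ℓ → ∑ (allFin 9) (λ b → g (ℓ [ j ]≔ b)))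
    ≡⟨ resample (allFin 9) _ i ⟩
  ∑ (Labels m) (λ ℓ → ∑ (allFin 9) (λ a → ∑ (allFin 9) (λ b → g ((ℓ [ i ]≔ a) [ j ]≔ b))))
    ≡⟨ ∑-cong (Labels m) (λ ℓ → ∑-cong (allFin 9) λ a → ∑-cong (allFin 9) λ b →
         cong₂ (λ s t → ind (toℕ s <ᵇ toℕ t)) (lookup∘update j (ℓ [ i ]≔ a) b)
           (trans (lookup∘update′ (j≢i ∘ sym) (ℓ [ i ]≔ a) b) (lookup∘update i ℓ a))) ⟩
  ∑ (Labels m) (λ _ → 36)
    ≡⟨ trans (∑-const (Labels m) 36) (trans (*-comm (length (Labels m)) 36) (cong (36 *_) (length-vecs-allFin 9 m))) ⟩
  36 * 9 ^ m
    ≡⟨ *-assoc 9 4 (9 ^ m) ⟩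
  9 * (4 * 9 ^ m) ∎)
  where
  open ≡-Reasoning
  g : Vec (Fin 9) m → ℕ
  g ℓ = ind (before ℓ j i)

-- As the four coordinates are distinct, their labels are independent. The favourable quadruples
-- number 0³ + 1³ + ... + 8³ = 36² = 1296, a proportion of 16/81.
∑-before³ : ∀ {m} {i j k l : Fin m} → j ≢ i → k ≢ i → l ≢ i → j ≢ k → j ≢ l → k ≢ l →
            9 * (9 * ∑ (Labels m) (λ ℓ → ind (before ℓ j i) * ind (before ℓ k i) * ind (before ℓ l i))) ≡ 16 * 9 ^ m
∑-before³ {m} {i} {j} {k} {l} j≢i k≢i l≢i j≢k j≢l k≢l = *-cancelˡ-≡ _ _ 9 (*-cancelˡ-≡ _ _ 9 (begin
  9 * (9 * (9 * (9 * ∑ (Labels m) g)))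
    ≡⟨ cong (λ s → 9 * (9 * (9 * s))) (resample (allFin 9) g l) ⟩
  9 * (9 * (9 * ∑ (Labels m) (λ ℓ → ∑ (allFin 9) (λ d → g (ℓ [ l ]≔ d)))))
    ≡⟨ cong (λ s → 9 * (9 * s)) (resample (allFin 9) _ k) ⟩
  9 * (9 * ∑ (Labels m) (λ ℓ → ∑ (allFin 9) (λ c → ∑ (allFin 9) (λ d → g ((ℓ [ k ]≔ c) [ l ]≔ d)))))
    ≡⟨ cong (9 *_) (resample (allFin 9) _ j) ⟩
  9 * ∑ (Labels m) (λ ℓ → ∑ (allFin 9) (λ b → ∑ (allFin 9) (λ c → ∑ (allFin 9) (λ d →
    g (((ℓ [ j ]≔ b) [ k ]≔ c) [ l ]≔ d)))))
    ≡⟨ resample (allFin 9) _ i ⟩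
  ∑ (Labels m) (λ ℓ → ∑ (allFin 9) (λ a → ∑ (allFin 9) (λ b → ∑ (allFin 9) (λ c → ∑ (allFin 9) (λ d →
    g ((((ℓ [ i ]≔ a) [ j ]≔ b) [ k ]≔ c) [ l ]≔ d))))))
    ≡⟨ ∑-cong (Labels m) (λ ℓ → ∑-cong (allFin 9) λ a → ∑-cong (allFin 9) λ b →
         ∑-cong (allFin 9) λ c → ∑-cong (allFin 9) λ d → g-update ℓ a b c d) ⟩
  ∑ (Labels m) (λ _ → quadruples)
    ≡⟨ trans (∑-const (Labels m) quadruples) (trans (*-comm (length (Labels m)) quadruples) (cong₂ _*_ quadruples≡ (length-vecs-allFin 9 m))) ⟩
  1296 * 9 ^ m
    ≡⟨ trans (*-assoc 9 144 (9 ^ m)) (cong (9 *_) (*-assoc 9 16 (9 ^ m))) ⟩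
  9 * (9 * (16 * 9 ^ m)) ∎))
  where
  open ≡-Reasoning
  lt : Fin 9 → Fin 9 → ℕ
  lt s t = ind (toℕ s <ᵇ toℕ t)
  g : Vec (Fin 9) m → ℕ
  g ℓ = ind (before ℓ j i) * ind (before ℓ k i) * ind (before ℓ l i)
  quadruples : ℕ
  quadruples = ∑ (allFin 9) (λ a → ∑ (allFin 9) (λ b → ∑ (allFin 9) (λ c → ∑ (allFin 9) (λ d →
    lt b a * lt c a * lt d a))))
  quadruples≡ : quadruples ≡ 1296
  quadruples≡ = refl
  g-update : ∀ ℓ a b c d → g ((((ℓ [ i ]≔ a) [ j ]≔ b) [ k ]≔ c) [ l ]≔ d) ≡ lt b a * lt c a * lt d a
  g-update ℓ a b c d = cong₂ _*_ (cong₂ _*_ (cong₂ lt at-j at-i) (cong₂ lt at-k at-i)) (cong₂ lt at-l at-i)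
    where
    ℓ₁ = ℓ [ i ]≔ a
    ℓ₂ = ℓ₁ [ j ]≔ b
    ℓ₃ = ℓ₂ [ k ]≔ c
    ℓ₄ = ℓ₃ [ l ]≔ d
    at-i : lookup ℓ₄ i ≡ a
    at-i = trans (lookup∘update′ (l≢i ∘ sym) ℓ₃ d) (trans (lookup∘update′ (k≢i ∘ sym) ℓ₂ c)
             (trans (lookup∘update′ (j≢i ∘ sym) ℓ₁ b) (lookup∘update i ℓ a)))
    at-j : lookup ℓ₄ j ≡ b
    at-j = trans (lookup∘update′ j≢l ℓ₃ d) (trans (lookup∘update′ j≢k ℓ₂ c) (lookup∘update j ℓ₁ b))
    at-k : lookup ℓ₄ k ≡ c
    at-k = trans (lookup∘update′ k≢l ℓ₃ d) (lookup∘update k ℓ₂ c)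
    at-l : lookup ℓ₄ l ≡ d
    at-l = lookup∘update l ℓ₃ d

-- The case of a repeated cell, where one earlier copy already has weight 3: the average of 3 + 8w
-- is at least 3 + 8 · 3 · 4/9 = 41/3, above the largest possible demand 4 · 3 = 12.
repeat-arithmetic : ∀ N B W → 9 * B ≡ 4 * N → 3 * B ≤ W → N * 12 ≤ 3 * N + 8 * W
repeat-arithmetic N B W 9B≡4N 3B≤W = *-cancelˡ-≤ 3 (begin
  3 * (N * 12)           ≡⟨ lemma₁ N ⟩
  36 * N                 ≤⟨ *-monoˡ-≤ N (≤ᵇ⇒≤ 36 41 tt) ⟩
  41 * N                 ≡⟨ lemma₂ N ⟩
  9 * N + 8 * (4 * N)    ≡⟨ cong (λ s → 9 * N + 8 * s) (sym 9B≡4N) ⟩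
  9 * N + 8 * (9 * B)    ≡⟨ lemma₃ N B ⟩
  3 * (3 * N + 8 * (3 * B)) ≤⟨ *-monoʳ-≤ 3 (+-monoʳ-≤ (3 * N) (*-monoʳ-≤ 8 3B≤W)) ⟩
  3 * (3 * N + 8 * W)    ∎)
  where
  open ≤-Reasoning
  lemma₁ : ∀ N → 3 * (N * 12) ≡ 36 * N
  lemma₁ = solve-∀
  lemma₂ : ∀ N → 41 * N ≡ 9 * N + 8 * (4 * N)
  lemma₂ = solve-∀
  lemma₃ : ∀ N B → 9 * N + 8 * (9 * B) ≡ 3 * (3 * N + 8 * (3 * B))
  lemma₃ = solve-∀

-- With s mates present and p = 1 if all three are, the claim is 4s ≤ 3 + 8 (4s/9 - 16p/81), here
-- multiplied by 81. For s = 3 it reads 1100 ≤ 1107, the narrowest of the eight cases.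
mates-arithmetic : ∀ N a b c {A B C D W} →
  9 * A ≡ 4 * N * ind a → 9 * B ≡ 4 * N * ind b → 9 * C ≡ 4 * N * ind c →
  9 * (9 * D) ≤ 16 * N * (ind a * ind b * ind c) → A + B + C ≤ W + D →
  N * (4 * (ind a + ind b + ind c)) ≤ 3 * N + 8 * W
mates-arithmetic N a b c {A} {B} {C} {D} {W} hA hB hC hD hW = *-cancelˡ-≤ 81 (+-cancelʳ-≤ (8 * (9 * (9 * D))) _ _ (begin
  81 * (N * (4 * s)) + 8 * (9 * (9 * D))
    ≤⟨ +-monoʳ-≤ (81 * (N * (4 * s))) (*-monoʳ-≤ 8 hD) ⟩
  81 * (N * (4 * s)) + 8 * (16 * N * p)
    ≡⟨ lemma₁ N s p ⟩
  N * (324 * s + 128 * p)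
    ≤⟨ *-monoʳ-≤ N (numeric a b c) ⟩
  N * (288 * s + 243)
    ≡⟨ lemma₂ N (ind a) (ind b) (ind c) ⟩
  243 * N + 72 * (4 * N * ind a + 4 * N * ind b + 4 * N * ind c)
    ≡⟨ cong (λ t → 243 * N + 72 * t) (sym (cong₂ _+_ (cong₂ _+_ hA hB) hC)) ⟩
  243 * N + 72 * (9 * A + 9 * B + 9 * C)
    ≡⟨ lemma₃ N A B C ⟩
  243 * N + 648 * (A + B + C)
    ≤⟨ +-monoʳ-≤ (243 * N) (*-monoʳ-≤ 648 hW) ⟩
  243 * N + 648 * (W + D)
    ≡⟨ lemma₄ N W D ⟩
  81 * (3 * N + 8 * W) + 8 * (9 * (9 * D)) ∎))
  where
  open ≤-Reasoning
  s = ind a + ind b + ind c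
  p = ind a * ind b * ind c
  lemma₁ : ∀ N s p → 81 * (N * (4 * s)) + 8 * (16 * N * p) ≡ N * (324 * s + 128 * p)
  lemma₁ = solve-∀
  lemma₂ : ∀ N a b c → N * (288 * (a + b + c) + 243) ≡ 243 * N + 72 * (4 * N * a + 4 * N * b + 4 * N * c)
  lemma₂ = solve-∀
  lemma₃ : ∀ N a b c → 243 * N + 72 * (9 * a + 9 * b + 9 * c) ≡ 243 * N + 648 * (a + b + c)
  lemma₃ = solve-∀
  lemma₄ : ∀ N w d → 243 * N + 648 * (w + d) ≡ 81 * (3 * N + 8 * w) + 8 * (9 * (9 * d))
  lemma₄ = solve-∀
  numeric : ∀ a b c → 324 * (ind a + ind b + ind c) + 128 * (ind a * ind b * ind c) ≤
                      288 * (ind a + ind b + ind c) + 243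
  numeric false false false = ≤ᵇ⇒≤ _ _ tt
  numeric false false true  = ≤ᵇ⇒≤ _ _ tt
  numeric false true  false = ≤ᵇ⇒≤ _ _ tt
  numeric false true  true  = ≤ᵇ⇒≤ _ _ tt
  numeric true  false false = ≤ᵇ⇒≤ _ _ tt
  numeric true  false true  = ≤ᵇ⇒≤ _ _ tt
  numeric true  true  false = ≤ᵇ⇒≤ _ _ tt
  numeric true  true  true  = ≤ᵇ⇒≤ _ _ tt

∑-affine : ∀ {m} (f : Vec (Fin 9) m → ℕ) → ∑ (Labels m) (λ ℓ → 3 + 8 * f ℓ) ≡ 3 * 9 ^ m + 8 * ∑ (Labels m) f
∑-affine {m} f = trans (∑-+ (Labels m) _ _) (cong₂ _+_
  (trans (∑-const (Labels m) 3) (trans (cong (_* 3) (length-vecs-allFin 9 m)) (*-comm (9 ^ m) 3)))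
  (∑-*ˡ (Labels m) 8 f))

vanish : ∀ {m} (f : Vec (Fin 9) m → ℕ) {b} → (∀ ℓ → f ℓ ≡ 0) → 9 * (9 * ∑ (Labels m) f) ≤ b
vanish {m} f f≡0 = ≤-trans (≤-reflexive (cong (λ s → 9 * (9 * s)) (trans (∑-cong (Labels m) f≡0) (∑-zero (Labels m))))) z≤n

-- Weights of coincidences

positive : ℕ → ℕ
positive zero    = 0
positive (suc _) = 1

-- X, Y, Z, R count the earlier coordinates sharing the row, the column, the symbol, or the cell.
-- Three coincidences count fully only for a repeated cell: otherwise two of them already cost
-- as much probability as three.
weight : (X Y Z R : ℕ) → ℕ
weight X Y Z zero    = 2 ⊓ (positive X + positive Y + positive Z)
weight X Y Z (suc _) = 3

positive-ind : ∀ b {X} → ind b ≤ X → ind b ≤ positive X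
positive-ind false         _ = z≤n
positive-ind true {suc X}  _ = s≤s z≤n

weight-mono : ∀ X Y Z R {s} → s ≤ positive X + positive Y + positive Z → 2 ⊓ s ≤ weight X Y Z R
weight-mono X Y Z zero    s≤ = ⊓-mono-≤ (≤-refl {2}) s≤
weight-mono X Y Z (suc _) s≤ = ≤-trans (m⊓n≤m 2 _) (n≤1+n 2)

-- Capping the sum at 2 loses something only when all three indicators are 1, and then exactly 1,
-- which is their product.
weight-lower : ∀ a b c {X Y Z R} → ind a ≤ X → ind b ≤ Y → ind c ≤ Z →
               ind a + ind b + ind c ≤ weight X Y Z R + ind a * ind b * ind c
weight-lower a b c {X} {Y} {Z} {R} a≤ b≤ c≤ = ≤-trans (cap a b c)
  (+-monoˡ-≤ (ind a * ind b * ind c) (weight-mono X Y Z R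
    (+-mono-≤ (+-mono-≤ (positive-ind a a≤) (positive-ind b b≤)) (positive-ind c c≤))))
  where
  cap : ∀ a b c → ind a + ind b + ind c ≤ 2 ⊓ (ind a + ind b + ind c) + ind a * ind b * ind c
  cap false false false = ≤-refl
  cap false false true  = ≤-refl
  cap false true  false = ≤-refl
  cap false true  true  = ≤-refl
  cap true  false false = ≤-refl
  cap true  false true  = ≤-refl
  cap true  true  false = ≤-refl
  cap true  true  true  = ≤-refl

weight-repeat : ∀ b {X Y Z R} → ind b ≤ R → 3 * ind b ≤ weight X Y Z R
weight-repeat false              _ = z≤n
weight-repeat true {R = suc _}   _ = ≤-refl

module _ {n : ℕ} (_⊙_ : Fin n → Fin n → Fin n)
  (⊙-injʳ : ∀ a {b b′} → a ⊙ b ≡ a ⊙ b′ → b ≡ b′)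
  (⊙-injˡ : ∀ b {a a′} → a ⊙ b ≡ a′ ⊙ b → a ≡ a′)
  {m : ℕ} (x y : Fin m → Fin n) where

  private
    z : Fin m → Fin n
    z j = x j ⊙ y j

  weight-at : Vec (Fin 9) m → Fin m → ℕ
  weight-at ℓ i = weight (old ℓ i x (x i)) (old ℓ i y (y i)) (old ℓ i z (z i)) (oldCell ℓ i x y (x i) (y i))

  nonunique : Fin m → ℕ
  nonunique i = ind ⌊ repeat? x i ⌋ + ind ⌊ repeat? y i ⌋ + ind ⌊ repeat? z i ⌋

  -- Only the mate stored in the decision is followed. Other coordinates with the same value can
  -- only increase `old`, and a single mate has an exactly computable chance of being earlier.
  mate : ∀ {w : Fin m → Fin n} {i} → Dec (Repeat w i) → Vec (Fin 9) m → Bool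
  mate {i = i} (yes (j , _)) ℓ = before ℓ j i
  mate         (no _)        ℓ = false

  ind≤old : ∀ (ℓ : Vec (Fin 9) m) i j (w : Fin m → Fin n) → w j ≡ w i → ind (before ℓ j i) ≤ old ℓ i w (w i)
  ind≤old ℓ i j w eq = ≤-trans
    (≤-reflexive (sym (trans (cong (λ b → ind (before ℓ j i) * ind b) (⌊⌋-true (w i ≟F w j) (sym eq))) (*-identityʳ _))))
    (≤∑-allFin (λ j → ind (before ℓ j i) * ind (eqF (w i) (w j))) j)

  mate≤old : ∀ {i} (w : Fin m → Fin n) (d : Dec (Repeat w i)) ℓ → ind (mate d ℓ) ≤ old ℓ i w (w i)
  mate≤old w (yes (j , _ , eq)) ℓ = ind≤old ℓ _ j w eq
  mate≤old w (no _)             ℓ = z≤n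

  ∑-mate : ∀ {i} {w : Fin m → Fin n} (d : Dec (Repeat w i)) →
           9 * ∑ (Labels m) (λ ℓ → ind (mate d ℓ)) ≡ 4 * 9 ^ m * ind ⌊ d ⌋
  ∑-mate (yes (j , j≢i , _)) = trans (∑-before j≢i) (sym (*-identityʳ _))
  ∑-mate (no _)              = trans (cong (9 *_) (∑-zero (Labels m))) (sym (*-zeroʳ (4 * 9 ^ m)))

  ∑-mates : ∀ {i} → ¬ (∃ λ j → j ≢ i × x j ≡ x i × y j ≡ y i) →
            (dx : Dec (Repeat x i)) (dy : Dec (Repeat y i)) (dz : Dec (Repeat z i)) →
            9 * (9 * ∑ (Labels m) (λ ℓ → ind (mate dx ℓ) * ind (mate dy ℓ) * ind (mate dz ℓ)))
            ≤ 16 * 9 ^ m * (ind ⌊ dx ⌋ * ind ⌊ dy ⌋ * ind ⌊ dz ⌋)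
  ∑-mates {i} new (yes (j , j≢i , xj)) (yes (k , k≢i , yk)) (yes (l , l≢i , zl)) =
    ≤-reflexive (trans (∑-before³ j≢i k≢i l≢i j≢k j≢l k≢l) (sym (*-identityʳ _)))
    where
    j≢k : j ≢ k
    j≢k refl = new (j , j≢i , xj , yk)
    j≢l : j ≢ l
    j≢l refl = new (j , j≢i , xj , ⊙-injʳ (x i) (trans (cong (_⊙ y j) (sym xj)) zl))
    k≢l : k ≢ l
    k≢l refl = new (k , k≢i , ⊙-injˡ (y i) (trans (cong (x k ⊙_) (sym yk)) zl) , yk)
  ∑-mates new dx@(no _) dy dz = vanish (λ ℓ → ind (mate dx ℓ) * ind (mate dy ℓ) * ind (mate dz ℓ)) λ ℓ → refl
  ∑-mates new dx@(yes (j , _)) dy@(no _) dz = vanish (λ ℓ → ind (mate dx ℓ) * ind (mate dy ℓ) * ind (mate dz ℓ)) λ ℓ → cong (_* ind (mate dz ℓ)) (*-zeroʳ (ind (before ℓ j _)))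
  ∑-mates new dx@(yes (j , _)) dy@(yes (k , _)) dz@(no _) = vanish (λ ℓ → ind (mate dx ℓ) * ind (mate dy ℓ) * ind (mate dz ℓ)) λ ℓ → *-zeroʳ (ind (before ℓ j _) * ind (before ℓ k _))

  -- Eight times the claim that the mean weight at `i` is at least half of `nonunique i`, minus 3/8.
  -- If another coordinate has the same cell, that one coordinate suffices; otherwise the three
  -- mates are distinct and inclusion-exclusion applies.
  weight-average : ∀ i → 9 ^ m * (4 * nonunique i) ≤ ∑ (Labels m) (λ ℓ → 3 + 8 * weight-at ℓ i)
  weight-average i with any? (λ j → ¬? (j ≟F i) ×-dec ((x j ≟F x i) ×-dec (y j ≟F y i)))
  ... | yes (j , j≢i , xj , yj) = ≤-trans
    (*-monoʳ-≤ (9 ^ m) (*-monoʳ-≤ 4 (+-mono-≤ (+-mono-≤ (ind-≤1 ⌊ repeat? x i ⌋) (ind-≤1 ⌊ repeat? y i ⌋)) (ind-≤1 ⌊ repeat? z i ⌋))))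
    (≤-trans (repeat-arithmetic (9 ^ m) (∑ (Labels m) (λ ℓ → ind (before ℓ j i))) (∑ (Labels m) (λ ℓ → weight-at ℓ i))
        (∑-before j≢i)
        (≤-trans (≤-reflexive (sym (∑-*ˡ (Labels m) 3 _))) (∑-mono (Labels m) λ ℓ →
          weight-repeat (before ℓ j i) {X = old ℓ i x (x i)} {Y = old ℓ i y (y i)} {Z = old ℓ i z (z i)} (cell ℓ))))
      (≤-reflexive (sym (∑-affine λ ℓ → weight-at ℓ i))))
    where
    cell : ∀ ℓ → ind (before ℓ j i) ≤ oldCell ℓ i x y (x i) (y i)
    cell ℓ = ≤-trans
      (≤-reflexive (sym (trans (cong₂ (λ b c → ind (before ℓ j i) * (ind b * ind c))
        (⌊⌋-true (x i ≟F x j) (sym xj)) (⌊⌋-true (y i ≟F y j) (sym yj))) (*-identityʳ _))))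
      (≤∑-allFin (λ j → ind (before ℓ j i) * (ind (eqF (x i) (x j)) * ind (eqF (y i) (y j)))) j)
  ... | no new = ≤-trans
    (mates-arithmetic (9 ^ m) ⌊ rx ⌋ ⌊ ry ⌋ ⌊ rz ⌋
      {∑ (Labels m) A} {∑ (Labels m) B} {∑ (Labels m) C} {∑ (Labels m) D} {∑ (Labels m) (λ ℓ → weight-at ℓ i)}
      (∑-mate rx) (∑-mate ry) (∑-mate rz) (∑-mates new rx ry rz)
      (≤-trans (≤-reflexive (sym (trans (∑-+ (Labels m) _ C) (cong (_+ ∑ (Labels m) C) (∑-+ (Labels m) A B)))))
        (≤-trans (∑-mono (Labels m) λ ℓ →
             weight-lower (mate rx ℓ) (mate ry ℓ) (mate rz ℓ) {R = oldCell ℓ i x y (x i) (y i)}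
               (mate≤old x rx ℓ) (mate≤old y ry ℓ) (mate≤old z rz ℓ))
          (≤-reflexive (∑-+ (Labels m) (λ ℓ → weight-at ℓ i) D)))))
    (≤-reflexive (sym (∑-affine λ ℓ → weight-at ℓ i)))
    where
    rx = repeat? x i
    ry = repeat? y i
    rz = repeat? z i
    A B C D : Vec (Fin 9) m → ℕ
    A ℓ = ind (mate rx ℓ)
    B ℓ = ind (mate ry ℓ)
    C ℓ = ind (mate rz ℓ)
    D ℓ = A ℓ * B ℓ * C ℓ

  -- Some labelling does at least as well as the mean. The pigeonhole principle thus takes the place
  -- of convexity of the exponential.
  good-labelling : ∃ λ ℓ → 4 * ∑ (allFin m) nonunique ≤ 3 * m + 8 * ∑ (allFin m) (weight-at ℓ)
  good-labelling = ∑-vecs-pigeonhole m (λ ℓ → 3 * m + 8 * ∑ (allFin m) (weight-at ℓ)) _ (s≤s z≤n) (begin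
    9 ^ m * (4 * ∑ (allFin m) nonunique)
      ≡⟨ trans (cong (9 ^ m *_) (sym (∑-*ˡ (allFin m) 4 nonunique))) (sym (∑-*ˡ (allFin m) (9 ^ m) _)) ⟩
    ∑ (allFin m) (λ i → 9 ^ m * (4 * nonunique i))
      ≤⟨ ∑-mono (allFin m) weight-average ⟩
    ∑ (allFin m) (λ i → ∑ (Labels m) (λ ℓ → 3 + 8 * weight-at ℓ i))
      ≡⟨ ∑-comm (allFin m) (Labels m) _ ⟩
    ∑ (Labels m) (λ ℓ → ∑ (allFin m) (λ i → 3 + 8 * weight-at ℓ i))
      ≡⟨ ∑-cong (Labels m) (λ ℓ → trans (∑-+ (allFin m) _ _)
           (cong₂ _+_ (trans (∑-allFin-const m 3) (*-comm m 3)) (∑-*ˡ (allFin m) 8 _))) ⟩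
    ∑ (Labels m) (λ ℓ → 3 * m + 8 * ∑ (allFin m) (weight-at ℓ)) ∎)
    where open ≤-Reasoning

-- The bound for the restriction to A

restrict : ∀ {k} {X : Set} (A : Subset k) → (Fin k → X) → Fin (card A) → X
restrict (true ∷ A)  x zero    = x zero
restrict (true ∷ A)  x (suc i) = restrict A (x ∘ suc) i
restrict (false ∷ A) x i       = restrict A (x ∘ suc) i

restrict-cong : ∀ {k} {X : Set} (A : Subset k) {x y : Fin k → X} → (∀ i → x i ≡ y i) →
                ∀ i → restrict A x i ≡ restrict A y i
restrict-cong (true ∷ A)  x≗y zero    = x≗y zero
restrict-cong (true ∷ A)  x≗y (suc i) = restrict-cong A (x≗y ∘ suc) i
restrict-cong (false ∷ A) x≗y i       = restrict-cong A (x≗y ∘ suc) i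

restrict-⊙ : ∀ {k} {X : Set} (_⊙_ : X → X → X) (A : Subset k) (x y : Fin k → X) i →
             restrict A (λ j → x j ⊙ y j) i ≡ restrict A x i ⊙ restrict A y i
restrict-⊙ _⊙_ (true ∷ A)  x y zero    = refl
restrict-⊙ _⊙_ (true ∷ A)  x y (suc i) = restrict-⊙ _⊙_ A (x ∘ suc) (y ∘ suc) i
restrict-⊙ _⊙_ (false ∷ A) x y i       = restrict-⊙ _⊙_ A (x ∘ suc) (y ∘ suc) i

select : ∀ {k} {X : Set} (A : Subset k) → Vec X k → Vec X (card A)
select []          []      = []
select (true ∷ A)  (a ∷ v) = a ∷ select A v
select (false ∷ A) (a ∷ v) = select A v

lookup-select : ∀ {k} {X : Set} (A : Subset k) (v : Vec X k) i → restrict A (lookup v) i ≡ lookup (select A v) i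
lookup-select (true ∷ A)  (a ∷ v) zero    = refl
lookup-select (true ∷ A)  (a ∷ v) (suc i) = lookup-select A v i
lookup-select (false ∷ A) (a ∷ v) i       = lookup-select A v i

-- Each vector on A has n^(k - card A) extensions; the identity is cross-multiplied so that no
-- subtraction occurs in the exponent.
∑-select : ∀ {n k} (A : Subset k) (g : Vec (Fin n) (card A) → ℕ) →
           n ^ card A * ∑ (vecs (allFin n) k) (g ∘ select A) ≡ n ^ k * ∑ (vecs (allFin n) (card A)) g
∑-select []          g = refl
∑-select {n} {suc k} (true ∷ A) g = begin
  n * n ^ card A * ∑ (vecs (allFin n) (suc k)) (g ∘ select (true ∷ A))
    ≡⟨ cong (n * n ^ card A *_) (∑-vecs-suc (allFin n) k _) ⟩
  n * n ^ card A * ∑ (allFin n) (λ a → ∑ (vecs (allFin n) k) (λ v → g (a ∷ select A v)))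
    ≡⟨ trans (*-assoc n _ _) (cong (n *_) (trans (sym (∑-*ˡ (allFin n) (n ^ card A) _))
         (trans (∑-cong (allFin n) λ a → ∑-select A (g ∘ (a ∷_))) (∑-*ˡ (allFin n) (n ^ k) _)))) ⟩
  n * (n ^ k * ∑ (allFin n) (λ a → ∑ (vecs (allFin n) (card A)) (λ v → g (a ∷ v))))
    ≡⟨ trans (sym (*-assoc n _ _)) (cong (n * n ^ k *_) (sym (∑-vecs-suc (allFin n) (card A) g))) ⟩
  n * n ^ k * ∑ (vecs (allFin n) (suc (card A))) g ∎
  where open ≡-Reasoning
∑-select {n} {suc k} (false ∷ A) g = begin
  n ^ card A * ∑ (vecs (allFin n) (suc k)) (g ∘ select (false ∷ A))
    ≡⟨ cong (n ^ card A *_) (trans (∑-vecs-suc (allFin n) k _) (∑-allFin-const n _)) ⟩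
  n ^ card A * (n * ∑ (vecs (allFin n) k) (g ∘ select A))
    ≡⟨ lemma (n ^ card A) n _ ⟩
  n * (n ^ card A * ∑ (vecs (allFin n) k) (g ∘ select A))
    ≡⟨ cong (n *_) (∑-select A g) ⟩
  n * (n ^ k * ∑ (vecs (allFin n) (card A)) g)
    ≡⟨ sym (*-assoc n _ _) ⟩
  n * n ^ k * ∑ (vecs (allFin n) (card A)) g ∎
  where
  open ≡-Reasoning
  lemma : ∀ p n s → p * (n * s) ≡ n * (p * s)
  lemma = solve-∀

∑∑-select : ∀ {n k} (A : Subset k) (g : Vec (Fin n) (card A) → Vec (Fin n) (card A) → ℕ) →
  n ^ card A * n ^ card A * ∑∑ (vecs (allFin n) k) (vecs (allFin n) k) (λ x y → g (select A x) (select A y)) ≡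
  n ^ k * n ^ k * ∑∑ (vecs (allFin n) (card A)) (vecs (allFin n) (card A)) g
∑∑-select {n} {k} A g = begin
  p * p * ∑ Vk (λ x → ∑ Vk (λ y → g (select A x) (select A y)))
    ≡⟨ trans (*-assoc p p _) (cong (p *_) (trans (sym (∑-*ˡ Vk p _))
         (trans (∑-cong Vk λ x → ∑-select A (g (select A x))) (∑-*ˡ Vk r _)))) ⟩
  p * (r * ∑ Vk (λ x → ∑ Va (g (select A x))))
    ≡⟨ lemma p r _ ⟩
  r * (p * ∑ Vk (λ x → ∑ Va (g (select A x))))
    ≡⟨ cong (r *_) (∑-select A (λ x → ∑ Va (g x))) ⟩
  r * (r * ∑∑ Va Va g)
    ≡⟨ sym (*-assoc r r _) ⟩
  r * r * ∑∑ Va Va g ∎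
  where
  open ≡-Reasoning
  p = n ^ card A
  r = n ^ k
  Vk = vecs (allFin n) k
  Va = vecs (allFin n) (card A)
  lemma : ∀ p r s → p * (r * s) ≡ r * (p * s)
  lemma = solve-∀

-- This is n^n times the absolute value of P_A 1_S at any point whose restriction to A is `w`, as
-- `absF-P-1S` shows.
amplitude : ∀ {m} n → (Fin m → Fin n) → ℕ
amplitude n w = ∣ alt (λ B → uniq (vals B w)) (Vℤ n) ∣

amplitude-cong : ∀ {m n} {w w′ : Fin m → Fin n} → (∀ i → w i ≡ w′ i) → amplitude n w ≡ amplitude n w′
amplitude-cong {n = n} w≗w′ = cong ∣_∣ (alt-cong (λ B → cong uniq (vals-cong B w≗w′)) (Vℤ n))

-- The parameter `κ` stands in for max(1, ρ/m), the price of a repeated cell; its two hypotheses say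
-- that it is at least both.
module Bound {n : ℕ} (_⊙_ : Fin n → Fin n → Fin n)
  (∑-⊙ʳ : ∀ a c → ∑ (allFin n) (λ b → ind (eqF (a ⊙ b) c)) ≡ 1)
  (∑-⊙ˡ : ∀ b c → ∑ (allFin n) (λ a → ind (eqF (a ⊙ b) c)) ≡ 1)
  (⊙-injʳ : ∀ a {b b′} → a ⊙ b ≡ a ⊙ b′ → b ≡ b′)
  (⊙-injˡ : ∀ b {a a′} → a ⊙ b ≡ a′ ⊙ b → a ≡ a′)
  (m q κ : ℕ) (1≤m : 1 ≤ m) (2m≤n : 2 * m ≤ n) (q⁸m≤n : q ^ 8 * m ≤ n) (1≤q : 1 ≤ q)
  (q⁸≤mκ : q ^ 8 ≤ m * κ) (1≤κ : 1 ≤ κ) where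

  private
    ρ = q ^ 8
    Vs = vecs (allFin n) m

    1≤n : 1 ≤ n
    1≤n = ≤-trans 1≤m (≤-trans (m≤m+n m _) 2m≤n)

    instance
      q≢0 : NonZero q
      q≢0 = >-nonZero 1≤q

  open Exposure _⊙_ ∑-⊙ʳ ∑-⊙ˡ {m} ρ q⁸m≤n

  -- Weights 0, 1 and 2 are matched by the constant, linear and quadratic parts of `potential`.
  -- Weight 3 occurs only with a repeated cell, where ρ³ ≤ κ ρ² m falls under the last term.
  weight≤potential : ∀ (ℓ : Vec (Fin 9) m) X Y Z R → ρ ^ weight X Y Z R ≤ κ * potential ℓ X Y Z R
  weight≤potential ℓ X Y Z zero = ≤-trans (split X Y Z)
    (≤-trans (m≤m+n (1 + ρ * (X + Y + Z) + ρ * ρ * (X * Y + X * Z + Y * Z)) (ρ * ρ * m * 0))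
      (≤-trans (≤-reflexive (sym (*-identityˡ (potential ℓ X Y Z 0)))) (*-monoˡ-≤ (potential ℓ X Y Z 0) 1≤κ)))
    where
    none : ∀ s t → 1 ≤ 1 + ρ * s + ρ * ρ * t
    none s t = s≤s z≤n
    one : ∀ s t → 1 ≤ s → ρ * 1 ≤ 1 + ρ * s + ρ * ρ * t
    one s t 1≤s = ≤-trans (*-monoʳ-≤ ρ 1≤s) (≤-trans (n≤1+n (ρ * s)) (m≤m+n (1 + ρ * s) _))
    two : ∀ s t → 1 ≤ t → ρ * (ρ * 1) ≤ 1 + ρ * s + ρ * ρ * t
    two s t 1≤t = ≤-trans (≤-reflexive (sym (*-assoc ρ ρ 1))) (≤-trans (*-monoʳ-≤ (ρ * ρ) 1≤t) (m≤n+m _ (1 + ρ * s)))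
    split : ∀ X Y Z → ρ ^ weight X Y Z zero ≤ 1 + ρ * (X + Y + Z) + ρ * ρ * (X * Y + X * Z + Y * Z)
    split zero    zero    zero    = none 0 0
    split zero    zero    (suc Z) = one (suc Z) 0 (s≤s z≤n)
    split zero    (suc Y) zero    = one (suc Y + 0) (suc Y * 0) (s≤s z≤n)
    split zero    (suc Y) (suc Z) = two (suc Y + suc Z) (suc Y * suc Z) (s≤s z≤n)
    split (suc X) zero    zero    = one (suc X + 0 + 0) (suc X * 0 + suc X * 0 + 0) (s≤s z≤n)
    split (suc X) zero    (suc Z) = two (suc X + 0 + suc Z) (suc X * 0 + suc X * suc Z + 0)
      (≤-trans (s≤s z≤n) (≤-trans (m≤n+m (suc X * suc Z) (suc X * 0)) (m≤m+n _ 0)))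
    split (suc X) (suc Y) zero    = two (suc X + suc Y + 0) (suc X * suc Y + suc X * 0 + suc Y * 0) (s≤s z≤n)
    split (suc X) (suc Y) (suc Z) = two (suc X + suc Y + suc Z) (suc X * suc Y + suc X * suc Z + suc Y * suc Z) (s≤s z≤n)
  weight≤potential ℓ X Y Z (suc R) = begin
    ρ * (ρ * (ρ * 1))                 ≡⟨ lemma₁ ρ ⟩
    ρ * ρ * ρ                         ≤⟨ *-monoʳ-≤ (ρ * ρ) q⁸≤mκ ⟩
    ρ * ρ * (m * κ)                   ≡⟨ lemma₂ ρ m κ ⟩
    κ * (ρ * ρ * m * 1)               ≤⟨ *-monoʳ-≤ κ (*-monoʳ-≤ (ρ * ρ * m) {1} {suc R} (s≤s z≤n)) ⟩
    κ * (ρ * ρ * m * suc R)           ≤⟨ *-monoʳ-≤ κ (m≤n+m _ (1 + ρ * (X + Y + Z) + ρ * ρ * (X * Y + X * Z + Y * Z))) ⟩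
    κ * potential ℓ X Y Z (suc R)     ∎
    where
    open ≤-Reasoning
    lemma₁ : ∀ r → r * (r * (r * 1)) ≡ r * r * r
    lemma₁ = solve-∀
    lemma₂ : ∀ r m k → r * r * (m * k) ≡ k * (r * r * m * 1)
    lemma₂ = solve-∀

  module _ (x y : Vec (Fin n) m) where

    repeats₃ : ℕ
    repeats₃ = repeats (lookup x) + repeats (lookup y) + repeats (λ i → lookup x i ⊙ lookup y i)

    private
      d : Fin m → ℕ
      d = nonunique _⊙_ ⊙-injʳ ⊙-injˡ (lookup x) (lookup y)

      w : Vec (Fin 9) m → Fin m → ℕ
      w = weight-at _⊙_ ⊙-injʳ ⊙-injˡ (lookup x) (lookup y)

    ∑-nonunique : ∑ (allFin m) d ≡ repeats₃
    ∑-nonunique = trans (∑-+ (allFin m) _ _) (cong (_+ repeats (λ i → lookup x i ⊙ lookup y i)) (∑-+ (allFin m) _ _))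

    -- The good labelling varies with `x` and `y`, so it is replaced by the sum over all labellings
    -- before these are averaged.
    repeats-bound : q ^ (4 * repeats₃) ≤ q ^ (3 * m) * κ ^ m * ∑ (Labels m) (λ ℓ → ∏ (allFin m) (Φ-at ℓ x y))
    repeats-bound with ℓ , good ← good-labelling _⊙_ ⊙-injʳ ⊙-injˡ (lookup x) (lookup y) = begin
      q ^ (4 * repeats₃)
        ≡⟨ cong (λ s → q ^ (4 * s)) (sym ∑-nonunique) ⟩
      q ^ (4 * ∑ (allFin m) d)
        ≤⟨ ^-monoʳ-≤ q good ⟩
      q ^ (3 * m + 8 * ∑ (allFin m) (w ℓ))
        ≡⟨ trans (^-distribˡ-+-* q (3 * m) (8 * ∑ (allFin m) (w ℓ))) (cong (q ^ (3 * m) *_) (sym (^-*-assoc q 8 (∑ (allFin m) (w ℓ))))) ⟩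
      q ^ (3 * m) * ρ ^ ∑ (allFin m) (w ℓ)
        ≡⟨ cong (q ^ (3 * m) *_) (sym (∏-^ (allFin m) ρ (w ℓ))) ⟩
      q ^ (3 * m) * ∏ (allFin m) (λ i → ρ ^ w ℓ i)
        ≤⟨ *-monoʳ-≤ (q ^ (3 * m)) (∏-mono (allFin m) λ i → weight≤potential ℓ _ _ _ _) ⟩
      q ^ (3 * m) * ∏ (allFin m) (λ i → κ * Φ-at ℓ x y i)
        ≡⟨ cong (q ^ (3 * m) *_) (trans (∏-*ˡ (allFin m) κ (Φ-at ℓ x y)) (cong (λ l → κ ^ l * ∏ (allFin m) (Φ-at ℓ x y)) (length-allFin m))) ⟩
      q ^ (3 * m) * (κ ^ m * ∏ (allFin m) (Φ-at ℓ x y))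
        ≡⟨ sym (*-assoc (q ^ (3 * m)) (κ ^ m) _) ⟩
      q ^ (3 * m) * κ ^ m * ∏ (allFin m) (Φ-at ℓ x y)
        ≤⟨ *-monoʳ-≤ (q ^ (3 * m) * κ ^ m) (≤∑-vecs (λ ℓ → ∏ (allFin m) (Φ-at ℓ x y)) ℓ) ⟩
      q ^ (3 * m) * κ ^ m * ∑ (Labels m) (λ ℓ → ∏ (allFin m) (Φ-at ℓ x y)) ∎
      where open ≤-Reasoning

  ∑-repeats-bound : ∑∑ Vs Vs (λ x y → q ^ (4 * repeats₃ x y)) ≤
                    q ^ (3 * m) * κ ^ m * (9 ^ m * (8 ^ m * (n ^ m * n ^ m)))
  ∑-repeats-bound = begin
    ∑∑ Vs Vs (λ x y → q ^ (4 * repeats₃ x y))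
      ≤⟨ ∑∑-mono Vs Vs repeats-bound ⟩
    ∑∑ Vs Vs (λ x y → q ^ (3 * m) * κ ^ m * ∑ (Labels m) (λ ℓ → F ℓ x y))
      ≡⟨ ∑∑-*ˡ Vs Vs (q ^ (3 * m) * κ ^ m) _ ⟩
    q ^ (3 * m) * κ ^ m * ∑∑ Vs Vs (λ x y → ∑ (Labels m) (λ ℓ → F ℓ x y))
      ≡⟨ cong (q ^ (3 * m) * κ ^ m *_) (trans (∑-cong Vs λ x → ∑-comm Vs (Labels m) _) (∑-comm Vs (Labels m) _)) ⟩
    q ^ (3 * m) * κ ^ m * ∑ (Labels m) (λ ℓ → ∑∑ Vs Vs (F ℓ))
      ≤⟨ *-monoʳ-≤ (q ^ (3 * m) * κ ^ m) (∑-mono (Labels m) λ ℓ → expose-all ℓ 1≤n) ⟩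
    q ^ (3 * m) * κ ^ m * ∑ (Labels m) (λ _ → 8 ^ m * (n ^ m * n ^ m))
      ≡⟨ cong (q ^ (3 * m) * κ ^ m *_) (trans (∑-const (Labels m) _) (cong (_* (8 ^ m * (n ^ m * n ^ m))) (length-vecs-allFin 9 m))) ⟩
    q ^ (3 * m) * κ ^ m * (9 ^ m * (8 ^ m * (n ^ m * n ^ m))) ∎
    where
    open ≤-Reasoning
    F : Vec (Fin 9) m → Vec (Fin n) m → Vec (Fin n) m → ℕ
    F ℓ x y = ∏ (allFin m) (Φ-at ℓ x y)

  -- Each single value gains q⁴ = ρ^(1/2). Normalising by q^(4m), as if every value were single,
  -- moves the deficit to the repeated values.
  amplitude-bound : ∀ (w : Fin m → Fin n) → amplitude n w * q ^ (4 * m) ≤ 8 ^ m * n ! * q ^ (4 * repeats w)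
  amplitude-bound w = begin
    amplitude n w * q ^ (4 * m)
      ≡⟨ cong (λ k → amplitude n w * q ^ (4 * k)) (sym (single+repeats w)) ⟩
    amplitude n w * q ^ (4 * (# (single w) + repeats w))
      ≡⟨ cong (amplitude n w *_) (trans (cong (q ^_) (*-distribˡ-+ 4 (# (single w)) (repeats w)))
           (trans (^-distribˡ-+-* q (4 * # (single w)) (4 * repeats w))
                  (cong (_* q ^ (4 * repeats w)) (sym (^-*-assoc q 4 (# (single w))))))) ⟩
    amplitude n w * ((q ^ 4) ^ (# (single w)) * q ^ (4 * repeats w))
      ≡⟨ sym (*-assoc (amplitude n w) _ _) ⟩
    amplitude n w * (q ^ 4) ^ (# (single w)) * q ^ (4 * repeats w)
      ≤⟨ *-monoˡ-≤ (q ^ (4 * repeats w))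
           (alt-V-bound n m q 1≤m 2m≤n q⁸m≤n 1≤q (single w) (λ B → uniq (vals B w)) (uniq-ignores-single w)) ⟩
    8 ^ m * n ! * q ^ (4 * repeats w) ∎
    where open ≤-Reasoning

  triple : Vec (Fin n) m → Vec (Fin n) m → ℕ
  triple x y = amplitude n (lookup x) * amplitude n (lookup y) * amplitude n (λ i → lookup x i ⊙ lookup y i)

  -- Three factors 8 ^ m come from the three amplitudes, `κ ^ m` from repeated cells, 9 ^ m from the
  -- labellings, and the last 8 ^ m from the exposure.
  loss : ℕ
  loss = 8 ^ m * 8 ^ m * 8 ^ m * (κ ^ m * (9 ^ m * 8 ^ m))

  ∑-triple-bound : q ^ (9 * m) * ∑∑ Vs Vs triple ≤ n ! * n ! * n ! * loss * (n ^ m * n ^ m)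
  ∑-triple-bound = *-cancelˡ-≤ (q ^ (3 * m)) {{m^n≢0 q (3 * m)}} (begin
    q ^ (3 * m) * (q ^ (9 * m) * ∑∑ Vs Vs triple)
      ≡⟨ trans (sym (*-assoc (q ^ (3 * m)) (q ^ (9 * m)) _)) (trans (cong (_* ∑∑ Vs Vs triple) exponent)
           (trans (*-comm (u * u * u) _) (sym (∑∑-*ʳ Vs Vs (u * u * u) triple)))) ⟩
    ∑∑ Vs Vs (λ x y → triple x y * (u * u * u))
      ≤⟨ ∑∑-mono Vs Vs pointwise ⟩
    ∑∑ Vs Vs (λ x y → g * g * g * q ^ (4 * repeats₃ x y))
      ≡⟨ ∑∑-*ˡ Vs Vs (g * g * g) _ ⟩
    g * g * g * ∑∑ Vs Vs (λ x y → q ^ (4 * repeats₃ x y))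
      ≤⟨ *-monoʳ-≤ (g * g * g) ∑-repeats-bound ⟩
    g * g * g * (q ^ (3 * m) * κ ^ m * (9 ^ m * (8 ^ m * (n ^ m * n ^ m))))
      ≡⟨ lemma (8 ^ m) (n !) (q ^ (3 * m)) (κ ^ m) (9 ^ m) (n ^ m) ⟩
    q ^ (3 * m) * (n ! * n ! * n ! * loss * (n ^ m * n ^ m)) ∎)
    where
    open ≤-Reasoning
    u = q ^ (4 * m)
    g = 8 ^ m * n !
    lemma : ∀ e f p k i b → (e * f) * (e * f) * (e * f) * (p * k * (i * (e * (b * b)))) ≡
                            p * (f * f * f * (e * e * e * (k * (i * e))) * (b * b))
    lemma = solve-∀
    -- Three gains of q^(4m) against the loss q^(3m) of the labellings: 12 - 3 = 9.
    exponent : q ^ (3 * m) * q ^ (9 * m) ≡ u * u * u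
    exponent = trans (sym (^-distribˡ-+-* q (3 * m) (9 * m))) (trans (cong (q ^_) (twelve m))
      (trans (^-distribˡ-+-* q (4 * m + 4 * m) (4 * m)) (cong (_* u) (^-distribˡ-+-* q (4 * m) (4 * m)))))
      where
      twelve : ∀ m → 3 * m + 9 * m ≡ 4 * m + 4 * m + 4 * m
      twelve = solve-∀
    pointwise : ∀ x y → triple x y * (u * u * u) ≤ g * g * g * q ^ (4 * repeats₃ x y)
    pointwise x y = begin
      a * b * c * (u * u * u)
        ≡⟨ l₁ a b c u ⟩
      a * u * (b * u) * (c * u)
        ≤⟨ *-mono-≤ (*-mono-≤ (amplitude-bound (lookup x)) (amplitude-bound (lookup y)))
                    (amplitude-bound (λ i → lookup x i ⊙ lookup y i)) ⟩
      g * q ^ (4 * rx) * (g * q ^ (4 * ry)) * (g * q ^ (4 * rz))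
        ≡⟨ l₂ g (q ^ (4 * rx)) (q ^ (4 * ry)) (q ^ (4 * rz)) ⟩
      g * g * g * (q ^ (4 * rx) * q ^ (4 * ry) * q ^ (4 * rz))
        ≡⟨ cong (g * g * g *_) (sym (trans (cong (q ^_) (l₃ rx ry rz)) (trans (^-distribˡ-+-* q (4 * rx + 4 * ry) (4 * rz))
             (cong (_* q ^ (4 * rz)) (^-distribˡ-+-* q (4 * rx) (4 * ry)))))) ⟩
      g * g * g * q ^ (4 * repeats₃ x y) ∎
      where
      a = amplitude n (lookup x)
      b = amplitude n (lookup y)
      c = amplitude n (λ i → lookup x i ⊙ lookup y i)
      rx = repeats (lookup x)
      ry = repeats (lookup y)
      rz = repeats (λ i → lookup x i ⊙ lookup y i)
      l₁ : ∀ a b c u → a * b * c * (u * u * u) ≡ a * u * (b * u) * (c * u)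
      l₁ = solve-∀
      l₂ : ∀ g a b c → g * a * (g * b) * (g * c) ≡ g * g * g * (a * b * c)
      l₂ = solve-∀
      l₃ : ∀ a b c → 4 * (a + b + c) ≡ 4 * a + 4 * b + 4 * c
      l₃ = solve-∀

-- Rational values

sfrac : ℤ → ℕ → ℚ
sfrac i zero    = 0ℚ
sfrac i (suc d) = i ℚ./ suc d

sfrac-pos : ∀ a d → sfrac (pos a) d ≡ frac a d
sfrac-pos a zero    = refl
sfrac-pos a (suc d) = refl

toℚᵘ-/ : ∀ i d → toℚᵘ (i ℚ./ suc d) ≃ᵘ mkℚᵘ i d
toℚᵘ-/ i d = ℚ.toℚᵘ-fromℚᵘ (mkℚᵘ i d)

sfrac-+ : ∀ i j d → sfrac i d ℚ.+ sfrac j d ≡ sfrac (i ℤ.+ j) d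
sfrac-+ i j zero    = refl
sfrac-+ i j (suc d) = ℚ.toℚᵘ-injective (begin
  toℚᵘ (i ℚ./ suc d ℚ.+ j ℚ./ suc d)
    ≈⟨ ℚ.toℚᵘ-homo-+ (i ℚ./ suc d) (j ℚ./ suc d) ⟩
  toℚᵘ (i ℚ./ suc d) ℚᵘ.+ toℚᵘ (j ℚ./ suc d)
    ≈⟨ ℚᵘ.+-cong (toℚᵘ-/ i d) (toℚᵘ-/ j d) ⟩
  mkℚᵘ i d ℚᵘ.+ mkℚᵘ j d
    ≈⟨ *≡* (trans (lemma i j (pos (suc d))) (cong ((i ℤ.+ j) ℤ.*_) (sym (ℤ.pos-* (suc d) (suc d))))) ⟩
  mkℚᵘ (i ℤ.+ j) d
    ≈⟨ ℚᵘ.≃-sym (toℚᵘ-/ (i ℤ.+ j) d) ⟩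
  toℚᵘ ((i ℤ.+ j) ℚ./ suc d) ∎)
  where
  open import Relation.Binary.Reasoning.Setoid ℚᵘ.≃-setoid
  lemma : ∀ i j e → (i ℤ.* e ℤ.+ j ℤ.* e) ℤ.* e ≡ (i ℤ.+ j) ℤ.* (e ℤ.* e)
  lemma = ℤ-Ring.solve-∀

sfrac-neg : ∀ i d → ℚ.- sfrac i d ≡ sfrac (ℤ.- i) d
sfrac-neg i zero    = refl
sfrac-neg i (suc d) = ℚ.toℚᵘ-injective (begin
  toℚᵘ (ℚ.- (i ℚ./ suc d))       ≈⟨ ℚ.toℚᵘ-homo‿- (i ℚ./ suc d) ⟩
  ℚᵘ.- toℚᵘ (i ℚ./ suc d)        ≈⟨ ℚᵘ.-‿cong (toℚᵘ-/ i d) ⟩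
  mkℚᵘ (ℤ.- i) d                 ≈⟨ ℚᵘ.≃-sym (toℚᵘ-/ (ℤ.- i) d) ⟩
  toℚᵘ ((ℤ.- i) ℚ./ suc d)       ∎)
  where open import Relation.Binary.Reasoning.Setoid ℚᵘ.≃-setoid

∣sfrac∣ : ∀ i d → ℚ.∣ sfrac i d ∣ ≡ frac ∣ i ∣ d
∣sfrac∣ i        zero    = refl
∣sfrac∣ (pos a)  (suc d) = ℚ.0≤p⇒∣p∣≡p (ℚ.nonNegative⁻¹ (frac a (suc d)) {{ℚ.normalize-nonNeg a (suc d)}})
∣sfrac∣ -[1+ a ] (suc d) = trans (ℚ.∣-p∣≡∣p∣ (frac (suc a) (suc d))) (∣sfrac∣ (pos (suc a)) (suc d))

frac-zero : ∀ d → frac 0 d ≡ 0ℚ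
frac-zero zero    = refl
frac-zero (suc d) = ℚ.toℚᵘ-injective (ℚᵘ.≃-trans (toℚᵘ-/ (pos 0) d) (*≡* refl))

frac-+ : ∀ a b d → frac a d ℚ.+ frac b d ≡ frac (a + b) d
frac-+ a b d = trans (cong₂ ℚ._+_ (sym (sfrac-pos a d)) (sym (sfrac-pos b d)))
  (trans (sfrac-+ (pos a) (pos b) d) (sfrac-pos (a + b) d))

frac-* : ∀ a d b e → frac a d ℚ.* frac b e ≡ frac (a * b) (d * e)
frac-* a zero    b e       = ℚ.*-zeroˡ (frac b e)
frac-* a (suc d) b zero    rewrite *-zeroʳ d = ℚ.*-zeroʳ (frac a (suc d))
frac-* a (suc d) b (suc e) = ℚ.toℚᵘ-injective (begin
  toℚᵘ (pos a ℚ./ suc d ℚ.* (pos b ℚ./ suc e))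
    ≈⟨ ℚ.toℚᵘ-homo-* (pos a ℚ./ suc d) (pos b ℚ./ suc e) ⟩
  toℚᵘ (pos a ℚ./ suc d) ℚᵘ.* toℚᵘ (pos b ℚ./ suc e)
    ≈⟨ ℚᵘ.*-cong (toℚᵘ-/ (pos a) d) (toℚᵘ-/ (pos b) e) ⟩
  mkℚᵘ (pos a ℤ.* pos b) (e + d * suc e)
    ≡⟨ cong (λ i → mkℚᵘ i (e + d * suc e)) (sym (ℤ.pos-* a b)) ⟩
  mkℚᵘ (pos (a * b)) (e + d * suc e)
    ≈⟨ ℚᵘ.≃-sym (toℚᵘ-/ (pos (a * b)) (e + d * suc e)) ⟩
  toℚᵘ (pos (a * b) ℚ./ (suc d * suc e)) ∎)
  where open import Relation.Binary.Reasoning.Setoid ℚᵘ.≃-setoid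

frac-^ : ∀ a d k → frac a d ^ℚ k ≡ frac (a ^ k) (d ^ k)
frac-^ a d zero    = refl
frac-^ a d (suc k) = trans (cong (frac a d ℚ.*_) (frac-^ a d k)) (frac-* a d (a ^ k) (d ^ k))

frac-≤ : ∀ a d b e → 1 ≤ d → 1 ≤ e → a * e ≤ b * d → frac a d ℚ.≤ frac b e
frac-≤ a (suc d) b (suc e) _ _ h = ℚ.toℚᵘ-cancel-≤
  (ℚᵘ.≤-respˡ-≃ (ℚᵘ.≃-sym (toℚᵘ-/ (pos a) d)) (ℚᵘ.≤-respʳ-≃ (ℚᵘ.≃-sym (toℚᵘ-/ (pos b) e))
    (*≤* (subst₂ ℤ._≤_ (ℤ.pos-* a (suc e)) (ℤ.pos-* b (suc d)) (+≤+ h)))))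

-- Sums and averages of fractions with a common denominator

sumℚ-++ : ∀ xs ys → sumℚ (xs ++ ys) ≡ sumℚ xs ℚ.+ sumℚ ys
sumℚ-++ []       ys = sym (ℚ.+-identityˡ (sumℚ ys))
sumℚ-++ (x ∷ xs) ys = trans (cong (x ℚ.+_) (sumℚ-++ xs ys)) (sym (ℚ.+-assoc x (sumℚ xs) (sumℚ ys)))

sumℚ-frac : ∀ {X : Set} (D : List X) {f : X → ℚ} {g : X → ℕ} {d} →
            (∀ a → f a ≡ frac (g a) d) → sumℚ (map f D) ≡ frac (∑ D g) d
sumℚ-frac []      {d = d}         f≡ = sym (frac-zero d)
sumℚ-frac (a ∷ D) {g = g} {d = d} f≡ =
  trans (cong₂ ℚ._+_ (f≡ a) (sumℚ-frac D {g = g} {d} f≡)) (frac-+ (g a) (∑ D g) d)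

sumℚ-concatMap : ∀ {X : Set} (D : List X) {h : X → List ℚ} {g : X → ℕ} {d} →
                 (∀ a → sumℚ (h a) ≡ frac (g a) d) → sumℚ (concatMap h D) ≡ frac (∑ D g) d
sumℚ-concatMap []      {d = d}                 h≡ = sym (frac-zero d)
sumℚ-concatMap (a ∷ D) {h} {g} {d = d} h≡ = trans (sumℚ-++ (h a) (concatMap h D))
  (trans (cong₂ ℚ._+_ (h≡ a) (sumℚ-concatMap D {h} {g} {d} h≡)) (frac-+ (g a) (∑ D g) d))

length-concatMap : ∀ {X : Set} (D : List X) {h : X → List ℚ} {g : X → ℕ} →
                   (∀ a → length (h a) ≡ g a) → length (concatMap h D) ≡ ∑ D g
length-concatMap []      h≡ = refl
length-concatMap (a ∷ D) {h} h≡ = trans (length-++ (h a)) (cong₂ _+_ (h≡ a) (length-concatMap D h≡))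

avg-frac : ∀ l {s d k} → sumℚ l ≡ frac s d → length l ≡ k → avg l ≡ frac s (d * k)
-- The average of the empty list is 0, in agreement with the value of `frac` at denominator 0.
avg-frac []       {s} {d} _ refl = sym (cong (frac s) (*-zeroʳ d))
avg-frac (q ∷ qs) {s} {d} S refl = trans (cong (ℚ._* frac 1 (suc (length qs))) S)
  (trans (frac-* s d 1 (suc (length qs))) (cong (λ t → frac t (d * suc (length qs))) (*-identityʳ s)))

-- The projection of the indicator of bijections

ext : ∀ {k} (A : Subset k) → Subset (card A) → Subset k
ext []          B       = []
ext (true ∷ A)  (b ∷ B) = b ∷ ext A B
ext (false ∷ A) B       = false ∷ ext A B

vals-ext : ∀ {k} {X : Set} (A : Subset k) (B : Subset (card A)) (x : Fin k → X) →
           vals (ext A B) x ≡ vals B (restrict A x)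
vals-ext []          []          x = refl
vals-ext (true ∷ A)  (true ∷ B)  x = cong (x zero ∷_) (vals-ext A B (x ∘ suc))
vals-ext (true ∷ A)  (false ∷ B) x = vals-ext A B (x ∘ suc)
vals-ext (false ∷ A) B           x = vals-ext A B (x ∘ suc)

sign-suc : ∀ k → sign (suc k) ≡ ℚ.- sign k
sign-suc zero          = refl
sign-suc (suc zero)    = refl
sign-suc (suc (suc k)) = sign-suc k

card-subsetsOf : ∀ {k} (A : Subset k) → All (λ B → card B ≤ card A) (subsetsOf A)
card-subsetsOf []          = z≤n ∷ []
card-subsetsOf (true ∷ A)  = All.++⁺ (All.map⁺ (All.map s≤s (card-subsetsOf A)))
                                     (All.map⁺ (All.map m≤n⇒m≤1+n (card-subsetsOf A)))
card-subsetsOf (false ∷ A) = All.map⁺ (card-subsetsOf A)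

sumℚ-map-neg : ∀ {X : Set} {D : List X} {f g : X → ℚ} → All (λ a → f a ≡ ℚ.- g a) D →
               sumℚ (map f D) ≡ ℚ.- sumℚ (map g D)
sumℚ-map-neg []       = refl
sumℚ-map-neg {D = a ∷ D} {g = g} (e ∷ es) =
  trans (cong₂ ℚ._+_ e (sumℚ-map-neg es)) (sym (ℚ.neg-distrib-+ (g a) (sumℚ (map g D))))

-- Through `ext` the subsets of A become subsets of `Fin (card A)`. Those containing the first
-- element of A and those omitting it give the two halves of `alt`, the latter with the opposite
-- sign.
signed-sum : ∀ {k} (A : Subset k) (F : Subset k → ℚ) (p : Subset k → Bool) (v : ℕ → ℤ) d →
  (∀ B → F B ≡ sfrac (if p B then v (card B) else 0ℤ) d) →
  sumℚ (map (λ B → sign (card A ∸ card B) ℚ.* F B) (subsetsOf A)) ≡ sfrac (alt (p ∘ ext A) v) d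
signed-sum []         F p v d F≡ =
  trans (ℚ.+-identityʳ _) (trans (ℚ.*-identityˡ (F [])) (F≡ []))
signed-sum (false ∷ A) F p v d F≡ = trans
  (cong sumℚ (sym (map-∘ {g = λ B → sign (card A ∸ card B) ℚ.* F B} {f = false ∷_} (subsetsOf A))))
  (signed-sum A (F ∘ (false ∷_)) (p ∘ (false ∷_)) v d (F≡ ∘ (false ∷_)))
signed-sum (true ∷ A) F p v d F≡ = begin
  sumℚ (map G (map (true ∷_) S ++ map (false ∷_) S))
    ≡⟨ cong sumℚ (map-++ G (map (true ∷_) S) (map (false ∷_) S)) ⟩
  sumℚ (map G (map (true ∷_) S) ++ map G (map (false ∷_) S))
    ≡⟨ sumℚ-++ (map G (map (true ∷_) S)) _ ⟩
  sumℚ (map G (map (true ∷_) S)) ℚ.+ sumℚ (map G (map (false ∷_) S))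
    ≡⟨ cong₂ ℚ._+_ (cong sumℚ (sym (map-∘ {g = G} {f = true ∷_} S))) (cong sumℚ (sym (map-∘ {g = G} {f = false ∷_} S))) ⟩
  sumℚ (map (G ∘ (true ∷_)) S) ℚ.+ sumℚ (map (G ∘ (false ∷_)) S)
    ≡⟨ cong₂ ℚ._+_ (signed-sum A (F ∘ (true ∷_)) (p ∘ (true ∷_)) (v ∘ suc) d (F≡ ∘ (true ∷_)))
         (trans (sumℚ-map-neg {f = G ∘ (false ∷_)} {g = λ B → sign (card A ∸ card B) ℚ.* F (false ∷ B)}
            (All.map (λ {B} → flip-sign {B}) (card-subsetsOf A)))
                (cong ℚ.-_ (signed-sum A (F ∘ (false ∷_)) (p ∘ (false ∷_)) v d (F≡ ∘ (false ∷_))))) ⟩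
  sfrac a₁ d ℚ.+ ℚ.- sfrac a₀ d
    ≡⟨ trans (cong (sfrac a₁ d ℚ.+_) (sfrac-neg a₀ d)) (sfrac-+ a₁ (ℤ.- a₀) d) ⟩
  sfrac (a₁ ℤ.- a₀) d ∎
  where
  open ≡-Reasoning
  S = subsetsOf A
  G : Subset _ → ℚ
  G B = sign (suc (card A) ∸ card B) ℚ.* F B
  a₁ = alt (p ∘ (true ∷_) ∘ ext A) (v ∘ suc)
  a₀ = alt (p ∘ (false ∷_) ∘ ext A) v
  -- Since `∸` truncates, the sign changes with the parity only because `card B ≤ card A`.
  flip-sign : ∀ {B} → card B ≤ card A → G (false ∷ B) ≡ ℚ.- (sign (card A ∸ card B) ℚ.* F (false ∷ B))
  flip-sign {B} le = trans
    (cong (ℚ._* F (false ∷ B)) (trans (cong sign (+-∸-assoc 1 le)) (sign-suc (card A ∸ card B))))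
    (sym (ℚ.neg-distribˡ-* (sign (card A ∸ card B)) (F (false ∷ B))))

1S≡frac : ∀ {n} (x : Pt n) → 1S x ≡ frac (ind (isBij x)) 1
1S≡frac x with isBij x
... | true  = refl
... | false = refl

Q-1S : ∀ {n} (B : Subset n) (x : Pt n) →
       Q B 1S x ≡ sfrac (if uniq (vals B x) then Vℤ n (card B) else 0ℤ) (n ^ n)
Q-1S {n} B x = begin
  avg (map (λ y → 1S (merge B x y)) (allFuns n n))
    ≡⟨ avg-frac (map (λ y → 1S (merge B x y)) (allFuns n n)) {∑ (allFuns n n) (λ y → ind (isBij (merge B x y)))} {1}
         (sumℚ-frac (allFuns n n) {g = λ y → ind (isBij (merge B x y))} {d = 1} λ y → 1S≡frac (merge B x y))
         (trans (length-map _ (allFuns n n)) (length-allFuns n n)) ⟩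
  frac (∑ (allFuns n n) (λ y → ind (isBij (merge B x y)))) (1 * n ^ n)
    ≡⟨ cong₂ frac (count-bijections B x) (*-identityˡ (n ^ n)) ⟩
  frac (ind (uniq (vals B x)) * V n (card B)) (n ^ n)
    ≡⟨ sym (sfrac-pos _ (n ^ n)) ⟩
  sfrac (pos (ind (uniq (vals B x)) * V n (card B))) (n ^ n)
    ≡⟨ cong (λ i → sfrac i (n ^ n)) (select-ind (uniq (vals B x)) (V n (card B))) ⟩
  sfrac (if uniq (vals B x) then Vℤ n (card B) else 0ℤ) (n ^ n) ∎
  where
  open ≡-Reasoning
  select-ind : ∀ b v → pos (ind b * v) ≡ (if b then pos v else 0ℤ)
  select-ind true  v = cong pos (+-identityʳ v)
  select-ind false v = refl

absF-P-1S : ∀ {n} (A : Subset n) (x : Pt n) →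
            absF (P A 1S) x ≡ frac (amplitude n (restrict A x)) (n ^ n)
absF-P-1S {n} A x = begin
  ℚ.∣ P A 1S x ∣
    ≡⟨ cong ℚ.∣_∣ (signed-sum A (λ B → Q B 1S x) (λ B → uniq (vals B x)) (Vℤ n) (n ^ n) (λ B → Q-1S B x)) ⟩
  ℚ.∣ sfrac (alt (λ B → uniq (vals (ext A B) x)) (Vℤ n)) (n ^ n) ∣
    ≡⟨ ∣sfrac∣ (alt (λ B → uniq (vals (ext A B) x)) (Vℤ n)) (n ^ n) ⟩
  frac ∣ alt (λ B → uniq (vals (ext A B) x)) (Vℤ n) ∣ (n ^ n)
    ≡⟨ cong (λ i → frac ∣ i ∣ (n ^ n)) (alt-cong (λ B → cong uniq (vals-ext A B x)) (Vℤ n)) ⟩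
  frac (amplitude n (restrict A x)) (n ^ n) ∎
  where open ≡-Reasoning

-- The constraint is a product over coordinates, each with exactly one admissible value, so a single
-- point survives. In this way the points of Lⁿ are parametrised by x and y alone.
∑-product-set : ∀ {n} k (R : Fin k → Fin n → Bool) (R! : ∀ i → ExactlyOne (R i)) (h : (Fin k → Fin n) → ℕ) →
  Extensional h →
  ∑ (allFuns k n) (λ z → ind (allB k (λ i → R i (z i))) * h z) ≡ h (λ i → proj₁ (R! i))
∑-product-set zero    R R! h h-ext =
  trans (+-identityʳ _) (trans (+-identityʳ _) (h-ext _ _ λ ()))
∑-product-set {n} (suc k) R R! h h-ext = begin
  ∑ (allFuns (suc k) n) (λ z → ind (allB (suc k) (λ i → R i (z i))) * h z)
    ≡⟨ ∑-allFuns-suc k n _ (λ f f′ f≗f′ → cong₂ _*_ (cong ind (allB-cong (suc k) λ i → cong (R i) (f≗f′ i))) (h-ext f f′ f≗f′)) ⟩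
  ∑ (allFin n) (λ a → ∑ (allFuns k n) (λ f → ind (R zero a ∧ allB k (λ i → R (suc i) (f i))) * h (cons a f)))
    ≡⟨ ∑-cong (allFin n) (λ a → trans
         (∑-cong (allFuns k n) λ f → trans (cong (_* h (cons a f)) (ind-∧ (R zero a) _)) (*-assoc (ind (R zero a)) _ _))
         (trans (∑-*ˡ (allFuns k n) (ind (R zero a)) _) (cong (ind (R zero a) *_)
           (∑-product-set k (R ∘ suc) (R! ∘ suc) (h ∘ cons a) λ f f′ f≗f′ →
             h-ext _ _ λ { zero → refl ; (suc i) → f≗f′ i })))) ⟩
  ∑ (allFin n) (λ a → ind (R zero a) * h (cons a (λ i → proj₁ (R! (suc i)))))
    ≡⟨ ∑-exactlyOne (R zero) (R! zero) _ ⟩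
  h (cons (proj₁ (R! zero)) (λ i → proj₁ (R! (suc i))))
    ≡⟨ h-ext _ _ (λ { zero → refl ; (suc i) → refl }) ⟩
  h (λ i → proj₁ (R! i)) ∎
  where
  open ≡-Reasoning
  allB-cong : ∀ k {p p′ : Fin k → Bool} → (∀ i → p i ≡ p′ i) → allB k p ≡ allB k p′
  allB-cong zero    p≗p′ = refl
  allB-cong (suc k) p≗p′ = cong₂ _∧_ (p≗p′ zero) (allB-cong k (p≗p′ ∘ suc))

-- The trilinear form of a latin square

module _ {n : ℕ} {L : Triples n} (latin : IsLatinSquare L) where

  open IsLatinSquare latin

  _⊙_ : Fin n → Fin n → Fin n
  a ⊙ b = proj₁ (xy a b)

  ⊙-sound : ∀ a b → L a b (a ⊙ b) ≡ true
  ⊙-sound a b = proj₁ (proj₂ (xy a b))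

  ⊙-unique : ∀ a b c → L a b c ≡ true → c ≡ a ⊙ b
  ⊙-unique a b = proj₂ (proj₂ (xy a b))

  ⊙-injʳ : ∀ a {b b′} → a ⊙ b ≡ a ⊙ b′ → b ≡ b′
  ⊙-injʳ a {b} {b′} eq = trans (one b (⊙-sound a b)) (sym (one b′ (trans (cong (L a b′) eq) (⊙-sound a b′))))
    where one = proj₂ (proj₂ (zx (a ⊙ b) a))

  ⊙-injˡ : ∀ b {a a′} → a ⊙ b ≡ a′ ⊙ b → a ≡ a′
  ⊙-injˡ b {a} {a′} eq = trans (one a (⊙-sound a b)) (sym (one a′ (trans (cong (L a′ b) eq) (⊙-sound a′ b))))
    where one = proj₂ (proj₂ (yz b (a ⊙ b)))

  ∑-fibre : (f : Fin n → Fin n) (c d : Fin n) → f d ≡ c → (∀ a → f a ≡ c → a ≡ d) →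
            ∑ (allFin n) (λ a → ind (eqF (f a) c)) ≡ 1
  ∑-fibre f c d fd≡c uniq-d = trans (∑-cong (allFin n) λ a → sym (*-identityʳ _))
    (∑-unique (λ a → eqF (f a) c) (λ _ → 1) d (trans (cong (λ e → eqF e c) fd≡c) (eqF-refl c))
      (λ a e → uniq-d a (eqF-sound e)))

  ∑-⊙ʳ : ∀ a c → ∑ (allFin n) (λ b → ind (eqF (a ⊙ b) c)) ≡ 1
  ∑-⊙ʳ a c with b , Labc , only ← zx c a = ∑-fibre (a ⊙_) c b (sym (⊙-unique a b c Labc))
    λ b′ eq → only b′ (trans (cong (L a b′) (sym eq)) (⊙-sound a b′))

  ∑-⊙ˡ : ∀ b c → ∑ (allFin n) (λ a → ind (eqF (a ⊙ b) c)) ≡ 1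
  ∑-⊙ˡ b c with a , Labc , only ← yz b c = ∑-fibre (_⊙ b) c a (sym (⊙-unique a b c Labc))
    λ a′ eq → only a′ (trans (cong (L a′ b) (sym eq)) (⊙-sound a′ b))

  module _ (A : Subset n) where

    private
      N = n ^ n
      Fs = allFuns n n
      Vs = vecs (allFin n) n

      amp : Pt n → ℕ
      amp x = amplitude n (restrict A x)

      amp-ext : Extensional amp
      amp-ext f f′ f≗f′ = amplitude-cong (restrict-cong A f≗f′)

      prodPt : Pt n → Pt n → Pt n
      prodPt x y i = x i ⊙ y i

    tripleSum : ℕ
    tripleSum = ∑∑ Vs Vs λ x y →
      amplitude n (lookup (select A x)) * amplitude n (lookup (select A y)) *
      amplitude n (λ i → lookup (select A x) i ⊙ lookup (select A y) i)

    ∑-Lⁿ : ∀ (h : Pt n → Pt n → Pt n → ℕ) →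
      (∀ x y → Extensional (h x y)) →
      ∑ Fs (λ x → ∑ Fs (λ y → ∑ Fs (λ z → ind (inLn L x y z) * h x y z))) ≡
      ∑∑ Fs Fs (λ x y → h x y (prodPt x y))
    ∑-Lⁿ h h-ext = ∑∑-cong Fs Fs λ x y →
      ∑-product-set n (λ i → L (x i) (y i)) (λ i → xy (x i) (y i)) (h x y) (h-ext x y)

    ∑∑-allFuns : ∀ (g : Pt n → Pt n → ℕ) →
      (∀ x → Extensional (g x)) → (∀ y → Extensional (λ x → g x y)) →
      ∑∑ Fs Fs g ≡ ∑∑ Vs Vs (λ x y → g (lookup x) (lookup y))
    ∑∑-allFuns g ext₂ ext₁ = trans
      (∑-cong Fs λ x → ∑-allFuns n n (g x) (ext₂ x))
      (∑-allFuns n n _ λ f f′ f≗f′ → ∑-cong Vs λ y → ext₁ (lookup y) f f′ f≗f′)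

    count-Lⁿ : ∑ Fs (λ x → ∑ Fs (λ y → ∑ Fs (λ z → ind (inLn L x y z)))) ≡ N * N
    count-Lⁿ = begin
      ∑ Fs (λ x → ∑ Fs (λ y → ∑ Fs (λ z → ind (inLn L x y z))))
        ≡⟨ ∑∑-cong Fs Fs (λ x y → ∑-cong Fs λ z → sym (*-identityʳ _)) ⟩
      ∑ Fs (λ x → ∑ Fs (λ y → ∑ Fs (λ z → ind (inLn L x y z) * 1)))
        ≡⟨ ∑-Lⁿ (λ _ _ _ → 1) (λ _ _ _ _ _ → refl) ⟩
      ∑∑ Fs Fs (λ _ _ → 1)
        ≡⟨ trans (∑-const Fs _) (cong (length Fs *_) (sym (length≡∑1 Fs))) ⟩
      length Fs * length Fs
        ≡⟨ cong₂ _*_ (length-allFuns n n) (length-allFuns n n) ⟩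
      N * N ∎
      where open ≡-Reasoning

    ∑-Lⁿ-amp : ∑ Fs (λ x → ∑ Fs (λ y → ∑ Fs (λ z → ind (inLn L x y z) * (amp x * amp y * amp z)))) ≡ tripleSum
    ∑-Lⁿ-amp = begin
      ∑ Fs (λ x → ∑ Fs (λ y → ∑ Fs (λ z → ind (inLn L x y z) * (amp x * amp y * amp z))))
        ≡⟨ ∑-Lⁿ (λ x y z → amp x * amp y * amp z)
             (λ x y f f′ f≗f′ → cong (amp x * amp y *_) (amp-ext f f′ f≗f′)) ⟩
      ∑∑ Fs Fs (λ x y → amp x * amp y * amp (prodPt x y))
        ≡⟨ ∑∑-allFuns (λ x y → amp x * amp y * amp (prodPt x y))
             (λ x f f′ f≗f′ → cong₂ (λ s t → amp x * s * t) (amp-ext f f′ f≗f′)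
               (amp-ext _ _ λ i → cong (x i ⊙_) (f≗f′ i)))
             (λ y f f′ f≗f′ → cong₂ (λ s t → s * amp y * t) (amp-ext f f′ f≗f′)
               (amp-ext _ _ λ i → cong (_⊙ y i) (f≗f′ i))) ⟩
      ∑∑ Vs Vs (λ x y → amp (lookup x) * amp (lookup y) * amp (prodPt (lookup x) (lookup y)))
        ≡⟨ ∑∑-cong Vs Vs (λ x y → cong₂ _*_
             (cong₂ _*_ (amplitude-cong (lookup-select A x)) (amplitude-cong (lookup-select A y)))
             (amplitude-cong λ i → trans (restrict-⊙ _⊙_ A (lookup x) (lookup y) i)
               (cong₂ _⊙_ (lookup-select A x i) (lookup-select A y i)))) ⟩
      tripleSum ∎
      where open ≡-Reasoning

    -- Of the five factors in the denominator three normalise the functions and two are the size of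
    -- Lⁿ.
    Λ-frac : Λ L (absF (P A 1S)) (absF (P A 1S)) (absF (P A 1S)) ≡ frac tripleSum (N * N * N * (N * N))
    Λ-frac = avg-frac (concatMap plane Fs) {tripleSum} {D}
      (trans (sumℚ-concatMap Fs {plane} {λ x → ∑ Fs (λ y → ∑ Fs (g x y))} {D} λ x →
               sumℚ-concatMap Fs {line x} {λ y → ∑ Fs (g x y)} {D} λ y →
               sumℚ-concatMap Fs {entry x y} {g x y} {D} λ z → term x y z)
             (cong (λ s → frac s D) ∑-Lⁿ-amp))
      (trans (length-concatMap Fs {h = plane} λ x → length-concatMap Fs {h = line x} λ y →
               length-concatMap Fs {h = entry x y} λ z → size (inLn L x y z) _)
             count-Lⁿ)
      where
      f = absF (P A 1S)
      D = N * N * N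
      g : Pt n → Pt n → Pt n → ℕ
      g x y z = ind (inLn L x y z) * (amp x * amp y * amp z)
      entry : Pt n → Pt n → Pt n → List ℚ
      entry x y z = if inLn L x y z then (f x ℚ.* f y ℚ.* f z) ∷ [] else []
      line : Pt n → Pt n → List ℚ
      line x y = concatMap (entry x y) Fs
      plane : Pt n → List ℚ
      plane x = concatMap (line x) Fs
      size : ∀ b (q : ℚ) → length (if b then q ∷ [] else []) ≡ ind b
      size true  q = refl
      size false q = refl
      value : ∀ x y z → f x ℚ.* f y ℚ.* f z ≡ frac (amp x * amp y * amp z) (N * N * N)
      value x y z = trans (cong₂ ℚ._*_ (trans (cong₂ ℚ._*_ (absF-P-1S A x) (absF-P-1S A y)) (frac-* (amp x) N (amp y) N)) (absF-P-1S A z))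
                          (frac-* (amp x * amp y) (N * N) (amp z) N)
      term : ∀ x y z → sumℚ (entry x y z) ≡
                       frac (ind (inLn L x y z) * (amp x * amp y * amp z)) (N * N * N)
      term x y z with inLn L x y z
      ... | true  = trans (ℚ.+-identityʳ _) (trans (value x y z) (cong (λ t → frac t (N * N * N)) (sym (+-identityʳ _))))
      ... | false = sym (frac-zero (N * N * N))

-- The main estimate

-- Downward search for the integer part of (n/m)^(1/8), started at n, where the upper bound is
-- clear.
root₈ : ∀ {n m} → m ≤ n → 1 ≤ m → ∃ λ q → 1 ≤ q × q ^ 8 * m ≤ n × n < suc q ^ 8 * m
root₈ {n} {m} m≤n 1≤m = search n (≤-trans (≤-reflexive (cong suc (sym (*-identityʳ n))))
  (*-mono-≤ {suc n} {suc n ^ 8} {1} {m} (m≤m*n (suc n) (suc n ^ 7) {{m^n≢0 (suc n) 7}}) 1≤m))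
  where
  search : ∀ k → n < suc k ^ 8 * m → ∃ λ q → 1 ≤ q × q ^ 8 * m ≤ n × n < suc q ^ 8 * m
  -- The search cannot reach 0, because this would mean n < m.
  search zero    n<m = contradiction m≤n (<⇒≱ (≤-trans n<m (≤-reflexive (+-identityʳ m))))
  search (suc k) n<  with suc k ^ 8 * m ≤? n
  ... | yes ≤n = suc k , s≤s z≤n , ≤n , n<
  ... | no  ≰n = search k (≰⇒> ≰n)

n<2^n : ∀ k → k < 2 ^ k
n<2^n zero    = s≤s z≤n
n<2^n (suc k) = ≤-trans (s≤s (n<2^n k)) (≤-trans (≤-reflexive (+-comm 1 (2 ^ k)))
  (+-monoʳ-≤ (2 ^ k) (≤-trans (m^n>0 2 k) (m≤m+n (2 ^ k) 0))))

-- Since ρ ≤ (⌊ρ/m⌋ + 1) m and k + 1 ≤ 2^k, the choice κ = 2^⌊ρ/m⌋ dominates ρ/m, while its m-th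
-- power is at most 2^ρ.
ρ≤m*2^[ρ/m] : ∀ ρ m .{{_ : NonZero m}} → ρ ≤ m * 2 ^ (ρ / m)
ρ≤m*2^[ρ/m] ρ m = begin
  ρ                       ≡⟨ m≡m%n+[m/n]*n ρ m ⟩
  ρ % m + ρ / m * m       ≤⟨ +-monoˡ-≤ (ρ / m * m) (<⇒≤ (m%n<n ρ m)) ⟩
  suc (ρ / m) * m         ≤⟨ *-monoˡ-≤ m (n<2^n (ρ / m)) ⟩
  2 ^ (ρ / m) * m         ≡⟨ *-comm (2 ^ (ρ / m)) m ⟩
  m * 2 ^ (ρ / m)         ∎
  where open ≤-Reasoning

≤cdiv : ∀ {ρ n} m → 1 ≤ m → ρ * m ≤ n → ρ ≤ cdiv n m
≤cdiv {ρ} {n} (suc k) _ h = ≤-trans (≤-reflexive (sym (m*n/n≡m ρ (suc k))))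
  (/-monoˡ-≤ (suc k) (≤-trans h (m≤m+n n k)))

module _ {n : ℕ} {L : Triples n} (latin : IsLatinSquare L) (A : Subset n)
  (1≤m : 1 ≤ card A) (2m≤n : 2 * card A ≤ n) (K : ℕ) (K-large : 18874368 ≤ K) where

  private
    m = card A
    c = cdiv n m
    N = n ^ n
    T = tripleSum latin A

    instance
      m≢0 : NonZero m
      m≢0 = >-nonZero 1≤m

    m≤n : m ≤ n
    m≤n = ≤-trans (m≤m+n m _) 2m≤n

    1≤n : 1 ≤ n
    1≤n = ≤-trans 1≤m m≤n

    instance
      n≢0 : NonZero n
      n≢0 = >-nonZero 1≤n

      n^m≢0 : NonZero (n ^ m * n ^ m)
      n^m≢0 = m*n≢0 (n ^ m) (n ^ m) {{m^n≢0 n m}} {{m^n≢0 n m}}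

    q : ℕ
    q = proj₁ (root₈ m≤n 1≤m)

    1≤q : 1 ≤ q
    1≤q = proj₁ (proj₂ (root₈ m≤n 1≤m))

    q⁸m≤n : q ^ 8 * m ≤ n
    q⁸m≤n = proj₁ (proj₂ (proj₂ (root₈ m≤n 1≤m)))

    n<[1+q]⁸m : n < suc q ^ 8 * m
    n<[1+q]⁸m = proj₂ (proj₂ (proj₂ (root₈ m≤n 1≤m)))

    κ : ℕ
    κ = 2 ^ (q ^ 8 / m)

  open Bound (_⊙_ latin) (∑-⊙ʳ latin) (∑-⊙ˡ latin) (⊙-injʳ latin) (⊙-injˡ latin)
    m q κ 1≤m 2m≤n q⁸m≤n 1≤q (ρ≤m*2^[ρ/m] (q ^ 8) m) (m^n>0 2 (q ^ 8 / m))

  -- Repeated cells are the only source of the term n/m in the exponent, which enters here through ρ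
  -- ≤ n/m.
  κ^m≤2^c : κ ^ m ≤ 2 ^ c
  κ^m≤2^c = ≤-trans (≤-reflexive (^-*-assoc 2 (q ^ 8 / m) m))
    (^-monoʳ-≤ 2 (≤-trans (m/n*n≤m (q ^ 8) m) (≤cdiv m 1≤m q⁸m≤n)))

  -- The constant is 512 · 8⁴ · 9: the 512 = 2⁹ pays for rounding n/m down to q⁸, the rest is `loss`
  -- without `κ ^ m`.
  loss-bound : 2 ^ (9 * m) * loss ≤ K ^ (m + c)
  loss-bound = begin
    2 ^ (9 * m) * (8 ^ m * 8 ^ m * 8 ^ m * (κ ^ m * (9 ^ m * 8 ^ m)))
      ≡⟨ cong (_* loss) (sym (^-*-assoc 2 9 m)) ⟩
    512 ^ m * (8 ^ m * 8 ^ m * 8 ^ m * (κ ^ m * (9 ^ m * 8 ^ m)))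
      ≡⟨ lemma (512 ^ m) (8 ^ m) (9 ^ m) (κ ^ m) ⟩
    512 ^ m * (8 ^ m * (8 ^ m * (8 ^ m * (8 ^ m * 9 ^ m)))) * κ ^ m
      ≡⟨ cong (_* κ ^ m) collect ⟩
    18874368 ^ m * κ ^ m
      ≤⟨ *-mono-≤ (^-monoˡ-≤ m K-large) (≤-trans κ^m≤2^c (^-monoˡ-≤ c (≤-trans (≤ᵇ⇒≤ 2 18874368 tt) K-large))) ⟩
    K ^ m * K ^ c
      ≡⟨ sym (^-distribˡ-+-* K m c) ⟩
    K ^ (m + c) ∎
    where
    open ≤-Reasoning
    lemma : ∀ f e i k → f * (e * e * e * (k * (i * e))) ≡ f * (e * (e * (e * (e * i)))) * k
    lemma = solve-∀
    step : ∀ a b {s} → s ≡ b ^ m → a ^ m * s ≡ (a * b) ^ m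
    step a b e = trans (cong (a ^ m *_) e) (sym (*-^ a b m))
    collect : 512 ^ m * (8 ^ m * (8 ^ m * (8 ^ m * (8 ^ m * 9 ^ m)))) ≡ 18874368 ^ m
    collect = step 512 36864 (step 8 4608 (step 8 576 (step 8 72 (step 8 9 refl))))

  T-bound : q ^ (9 * m) * T ≤ N * N * (n ! * n ! * n ! * loss)
  T-bound = *-cancelˡ-≤ (n ^ m * n ^ m) (begin
    p * (q ^ (9 * m) * T)
      ≡⟨ lemma₁ p (q ^ (9 * m)) T ⟩
    q ^ (9 * m) * (p * T)
      ≡⟨ cong (q ^ (9 * m) *_) (∑∑-select {k = n} A triple) ⟩
    q ^ (9 * m) * (N * N * ∑∑ (vecs (allFin n) m) (vecs (allFin n) m) triple)
      ≡⟨ lemma₂ (q ^ (9 * m)) (N * N) (∑∑ (vecs (allFin n) m) (vecs (allFin n) m) triple) ⟩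
    N * N * (q ^ (9 * m) * ∑∑ (vecs (allFin n) m) (vecs (allFin n) m) triple)
      ≤⟨ *-monoʳ-≤ (N * N) ∑-triple-bound ⟩
    N * N * (n ! * n ! * n ! * loss * p)
      ≡⟨ lemma₃ (N * N) (n ! * n ! * n ! * loss) p ⟩
    p * (N * N * (n ! * n ! * n ! * loss)) ∎)
    where
    open ≤-Reasoning
    p = n ^ m * n ^ m
    lemma₁ : ∀ p r T → p * (r * T) ≡ r * (p * T)
    lemma₁ = solve-∀
    lemma₂ : ∀ r a s → r * (a * s) ≡ a * (r * s)
    lemma₂ = solve-∀
    lemma₃ : ∀ a b p → a * (b * p) ≡ p * (a * b)
    lemma₃ = solve-∀

  -- As q ≥ 1, the rounding error q + 1 ≤ 2q costs a factor 2^(9m) once the eighth root is taken.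
  n^9m-bound : n ^ (9 * m) ≤ (2 ^ (9 * m)) ^ 8 * (q ^ (9 * m)) ^ 8 * m ^ (9 * m)
  n^9m-bound = begin
    n ^ (9 * m)
      ≤⟨ ^-monoˡ-≤ (9 * m) (≤-trans (<⇒≤ n<[1+q]⁸m) (*-monoˡ-≤ m (^-monoˡ-≤ 8 1+q≤2q))) ⟩
    ((2 * q) ^ 8 * m) ^ (9 * m)
      ≡⟨ *-^ ((2 * q) ^ 8) m (9 * m) ⟩
    ((2 * q) ^ 8) ^ (9 * m) * m ^ (9 * m)
      ≡⟨ cong (_* m ^ (9 * m)) (begin-equality
           ((2 * q) ^ 8) ^ (9 * m)                ≡⟨ swap-^ (2 * q) 8 (9 * m) ⟩
           ((2 * q) ^ (9 * m)) ^ 8                ≡⟨ cong (_^ 8) (*-^ 2 q (9 * m)) ⟩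
           (2 ^ (9 * m) * q ^ (9 * m)) ^ 8        ≡⟨ *-^ (2 ^ (9 * m)) (q ^ (9 * m)) 8 ⟩
           (2 ^ (9 * m)) ^ 8 * (q ^ (9 * m)) ^ 8  ∎) ⟩
    (2 ^ (9 * m)) ^ 8 * (q ^ (9 * m)) ^ 8 * m ^ (9 * m) ∎
    where
    open ≤-Reasoning
    1+q≤2q : suc q ≤ 2 * q
    1+q≤2q = ≤-trans (+-monoˡ-≤ q 1≤q) (≤-reflexive (cong (q +_) (sym (+-identityʳ q))))
    swap-^ : ∀ a k l → (a ^ k) ^ l ≡ (a ^ l) ^ k
    swap-^ a k l = trans (^-*-assoc a k l) (trans (cong (a ^_) (*-comm k l)) (sym (^-*-assoc a l k)))

  D : ℕ
  D = N * N * N * (N * N)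

  numerator-bound : T ^ 8 * (N ^ 24 * n ^ (9 * m) * 1 ^ (8 * (m + c))) ≤
                    (n !) ^ 24 * m ^ (9 * m) * K ^ (8 * (m + c)) * D ^ 8
  numerator-bound = begin
    T ^ 8 * (N ^ 24 * n ^ (9 * m) * 1 ^ (8 * (m + c)))
      ≡⟨ cong₂ (λ s t → T ^ 8 * (s * n ^ (9 * m) * t)) (sym (^-*-assoc N 3 8)) (^-zeroˡ (8 * (m + c))) ⟩
    T ^ 8 * ((N ^ 3) ^ 8 * n ^ (9 * m) * 1)
      ≤⟨ *-monoʳ-≤ (T ^ 8) (*-monoˡ-≤ 1 (*-monoʳ-≤ ((N ^ 3) ^ 8) n^9m-bound)) ⟩
    T ^ 8 * ((N ^ 3) ^ 8 * (a ^ 8 * b ^ 8 * M) * 1)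
      ≡⟨ lemma₁ (T ^ 8) ((N ^ 3) ^ 8) (a ^ 8) (b ^ 8) M ⟩
    M * ((N ^ 3) ^ 8 * (a ^ 8 * (b ^ 8 * T ^ 8)))
      ≡⟨ cong (M *_) (sym (trans (*-^ (N ^ 3) (a * (b * T)) 8) (cong ((N ^ 3) ^ 8 *_)
           (trans (*-^ a (b * T) 8) (cong (a ^ 8 *_) (*-^ b T 8)))))) ⟩
    -- Apart from `M` everything is an eighth power, so it is enough to prove `base`, the inequality
    -- before raising to the eighth.
    M * (N ^ 3 * (a * (b * T))) ^ 8
      ≤⟨ *-monoʳ-≤ M (^-monoˡ-≤ 8 base) ⟩
    M * ((n !) ^ 3 * (K ^ (m + c) * D)) ^ 8
      ≡⟨ cong (M *_) (trans (*-^ ((n !) ^ 3) (K ^ (m + c) * D) 8)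
           (cong₂ _*_ (^-*-assoc (n !) 3 8) (trans (*-^ (K ^ (m + c)) D 8)
             (cong (_* D ^ 8) (trans (^-*-assoc K (m + c) 8) (cong (K ^_) (*-comm (m + c) 8))))))) ⟩
    M * ((n !) ^ 24 * (K ^ (8 * (m + c)) * D ^ 8))
      ≡⟨ lemma₂ M ((n !) ^ 24) (K ^ (8 * (m + c))) (D ^ 8) ⟩
    (n !) ^ 24 * M * K ^ (8 * (m + c)) * D ^ 8 ∎
    where
    open ≤-Reasoning
    a = 2 ^ (9 * m)
    b = q ^ (9 * m)
    M = m ^ (9 * m)
    lemma₁ : ∀ T N a b M → T * (N * (a * b * M) * 1) ≡ M * (N * (a * (b * T)))
    lemma₁ = solve-∀
    lemma₂ : ∀ M f k d → M * (f * (k * d)) ≡ f * M * k * d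
    lemma₂ = solve-∀
    base : N ^ 3 * (a * (b * T)) ≤ (n !) ^ 3 * (K ^ (m + c) * D)
    base = begin
      N ^ 3 * (a * (b * T))
        ≤⟨ *-monoʳ-≤ (N ^ 3) (*-monoʳ-≤ a T-bound) ⟩
      N ^ 3 * (a * (N * N * (n ! * n ! * n ! * loss)))
        ≡⟨ lemma₃ N a (n !) loss ⟩
      (n !) ^ 3 * (a * loss * D)
        ≤⟨ *-monoʳ-≤ ((n !) ^ 3) (*-monoˡ-≤ D loss-bound) ⟩
      (n !) ^ 3 * (K ^ (m + c) * D) ∎
      where
      lemma₃ : ∀ N a f l → N * (N * (N * 1)) * (a * (N * N * (f * f * f * l))) ≡
                           f * (f * (f * 1)) * (a * l * (N * N * N * (N * N)))
      lemma₃ = solve-∀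

  Λ-bound : Λ L (absF (P A 1S)) (absF (P A 1S)) (absF (P A 1S)) ^ℚ 8 ℚ.≤
            frac (n !) N ^ℚ 24 ℚ.* (frac m n ^ℚ (9 * m)) ℚ.* (frac K 1 ^ℚ (8 * (m + c)))
  Λ-bound = subst₂ ℚ._≤_ (sym lhs) (sym rhs)
    (frac-≤ (T ^ 8) (D ^ 8) _ (N ^ 24 * n ^ (9 * m) * 1 ^ (8 * (m + c)))
      (m^n>0 D {{D≢0}} 8) 1≤den numerator-bound)
    where
    instance
      N≢0 : NonZero N
      N≢0 = m^n≢0 n n
    D≢0 : NonZero D
    D≢0 = m*n≢0 (N * N * N) (N * N) {{m*n≢0 (N * N) N {{m*n≢0 N N}}}} {{m*n≢0 N N}}
    1≤den : 1 ≤ N ^ 24 * n ^ (9 * m) * 1 ^ (8 * (m + c))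
    1≤den = *-mono-≤ (*-mono-≤ (m^n>0 N 24) (m^n>0 n (9 * m))) (m^n>0 1 (8 * (m + c)))
    lhs : Λ L (absF (P A 1S)) (absF (P A 1S)) (absF (P A 1S)) ^ℚ 8 ≡ frac (T ^ 8) (D ^ 8)
    lhs = trans (cong (_^ℚ 8) (Λ-frac latin A)) (frac-^ T D 8)
    rhs : frac (n !) N ^ℚ 24 ℚ.* (frac m n ^ℚ (9 * m)) ℚ.* (frac K 1 ^ℚ (8 * (m + c))) ≡
          frac ((n !) ^ 24 * m ^ (9 * m) * K ^ (8 * (m + c))) (N ^ 24 * n ^ (9 * m) * 1 ^ (8 * (m + c)))
    rhs = trans (cong₂ ℚ._*_ (trans (cong₂ ℚ._*_ (frac-^ (n !) N 24) (frac-^ m n (9 * m)))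
                                    (frac-* ((n !) ^ 24) (N ^ 24) (m ^ (9 * m)) (n ^ (9 * m))))
                             (frac-^ K 1 (8 * (m + c))))
                (frac-* ((n !) ^ 24 * m ^ (9 * m)) (N ^ 24 * n ^ (9 * m)) (K ^ (8 * (m + c))) (1 ^ (8 * (m + c))))

theorem6p8 : Σ ℕ λ C → Σ ℕ λ K →
    ∀ (n : ℕ) (L : Triples n) → IsLatinSquare L → (A : Subset n) →
    1 Data.Nat.≤ card A → C Data.Nat.* card A Data.Nat.≤ n →
    (Λ L (absF (P A 1S)) (absF (P A 1S)) (absF (P A 1S))) ^ℚ 8
    Data.Rational.≤
    (frac (n !) (n ^ n) ^ℚ 24)
    Data.Rational.* (frac (card A) n ^ℚ (9 Data.Nat.* card A))
    Data.Rational.* (frac K 1 ^ℚ (8 Data.Nat.* (card A Data.Nat.+ cdiv n (card A))))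
-- The 2 is what `V-double` requires, and 2 ^ 25 is the least power of two above 512 · 8⁴ · 9.
theorem6p8 = 2 , 2 ^ 25 , λ n L latin A 1≤m 2m≤n → Λ-bound latin A 1≤m 2m≤n (2 ^ 25) (≤ᵇ⇒≤ _ _ tt)
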